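{- For every even integer $n \ge 174$, $D(n) \ge n/2 + 1$.
   Context: Let $P$ be a finite set of points in the plane. A disk (of positive radius) is empty (with respect to $P$) if its interior contains no point of $P$. Disks are called pairwise-disjoint if their interiors are pairwise disjoint (so two disks may touch at a common boundary point). $D(P)$ is the minimum number of disks in a family of pairwise-disjoint empty disks such that each point of $P$ lies on the boundary of at least one disk of the family. $D(n)$ is the maximum of $D(P)$ over all sets $P$ of $n$ points in the plane. -}

module Defs where

open import Data.Empty using (⊥)
open import Data.Fin.Base using (Fin)
open import Data.Nat.Base as ℕ using (ℕ; _⊔_)
import Data.Nat.Properties as ℕ
open import Data.Product.Base using (_×_; _,_; proj₁; proj₂; ∃-syntax)
open import Data.Rational.Base as ℚ using (ℚ; 0ℚ; 1ℚ; ½; ∣_∣; 1/_)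
import Data.Rational.Properties as ℚ
open import Data.Rational.Solver using (module +-*-Solver)
open import Function.Definitions using (Injective)
open import Relation.Binary.PropositionalEquality
  using (_≡_; _≢_; refl; sym; trans; cong; subst; subst₂)
open import Relation.Nullary.Negation using (¬_)

------------------------------------------------------------------------
-- Real numbers: Cauchy sequences of rationals, with `_≈_` as equality.

IsCauchy : (ℕ → ℚ) → Set
IsCauchy s = ∀ ε → 0ℚ ℚ.< ε →
  ∃[ N ] (∀ m n → N ℕ.≤ m → N ℕ.≤ n → ∣ s m ℚ.- s n ∣ ℚ.< ε)

record ℝ : Set where
  constructor mkℝ
  field
    seq    : ℕ → ℚ
    cauchy : IsCauchy seq

open ℝ public

infix  4 _≈_ _<_
infixl 6 _+_ _-_
infixl 7 _*_
infix  8 -_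

_≈_ : ℝ → ℝ → Set
x ≈ y = ∀ ε → 0ℚ ℚ.< ε →
  ∃[ N ] (∀ n → N ℕ.≤ n → ∣ seq x n ℚ.- seq y n ∣ ℚ.< ε)

_<_ : ℝ → ℝ → Set
x < y = ∃[ ε ] (0ℚ ℚ.< ε × ∃[ N ] (∀ n → N ℕ.≤ n → seq x n ℚ.+ ε ℚ.< seq y n))

fromℚ : ℚ → ℝ
fromℚ q = mkℝ (λ _ → q) λ ε 0<ε → 0 , λ _ _ _ _ →
  subst (λ z → ∣ z ∣ ℚ.< ε) (sym (ℚ.+-inverseʳ q)) 0<ε

0ℝ : ℝ
0ℝ = fromℚ 0ℚ

private
  open +-*-Solver

  half-pos : ∀ ε → 0ℚ ℚ.< ε → 0ℚ ℚ.< ½ ℚ.* ε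
  half-pos ε 0<ε = subst (ℚ._< ½ ℚ.* ε) (ℚ.*-zeroʳ ½) (ℚ.*-monoʳ-<-pos ½ 0<ε)

  half+half : ∀ ε → ½ ℚ.* ε ℚ.+ ½ ℚ.* ε ≡ ε
  half+half ε = trans (sym (ℚ.*-distribʳ-+ ε ½ ½)) (ℚ.*-identityˡ ε)

  +-regroup : ∀ a b c d → (a ℚ.+ b) ℚ.- (c ℚ.+ d) ≡ (a ℚ.- c) ℚ.+ (b ℚ.- d)
  +-regroup = solve 4 (λ a b c d → (a :+ b) :- (c :+ d) := (a :- c) :+ (b :- d)) refl

  neg-regroup : ∀ a b → ℚ.- a ℚ.- (ℚ.- b) ≡ ℚ.- (a ℚ.- b)
  neg-regroup = solve 2 (λ a b → :- a :- (:- b) := :- (a :- b)) refl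

  *-regroup : ∀ a b c d → a ℚ.* b ℚ.- c ℚ.* d ≡ a ℚ.* (b ℚ.- d) ℚ.+ d ℚ.* (a ℚ.- c)
  *-regroup = solve 4 (λ a b c d → a :* b :- c :* d := a :* (b :- d) :+ d :* (a :- c)) refl

  recentre : ∀ a b → (a ℚ.- b) ℚ.+ b ≡ a
  recentre = solve 2 (λ a b → (a :- b) :+ b := a) refl

  eventually-bounded : ∀ x → ∃[ B ] (0ℚ ℚ.< B ×
    ∃[ N ] (∀ n → N ℕ.≤ n → ∣ seq x n ∣ ℚ.≤ B))
  eventually-bounded x with cauchy x 1ℚ (ℚ.positive⁻¹ 1ℚ)
  ... | N , close = 1ℚ ℚ.+ ∣ seq x N ∣
      , ℚ.+-mono-<-≤ (ℚ.positive⁻¹ 1ℚ) (ℚ.0≤∣p∣ (seq x N))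
      , N , λ n N≤n → ℚ.≤-trans
          (subst (λ z → ∣ z ∣ ℚ.≤ ∣ seq x n ℚ.- seq x N ∣ ℚ.+ ∣ seq x N ∣)
                 (recentre (seq x n) (seq x N))
                 (ℚ.∣p+q∣≤∣p∣+∣q∣ (seq x n ℚ.- seq x N) (seq x N)))
          (ℚ.+-monoˡ-≤ ∣ seq x N ∣ (ℚ.<⇒≤ (close n N N≤n ℕ.≤-refl)))

  ∣*∣-bound : ∀ {a d B δ} → 0ℚ ℚ.< B → ∣ a ∣ ℚ.≤ B → ∣ d ∣ ℚ.< δ → ∣ a ℚ.* d ∣ ℚ.< B ℚ.* δ
  ∣*∣-bound {a} {d} {B} {δ} 0<B a≤B d<δ =
    subst (ℚ._< B ℚ.* δ) (sym (ℚ.∣p*q∣≡∣p∣*∣q∣ a d))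
      (ℚ.≤-<-trans
        (ℚ.*-monoʳ-≤-nonNeg ∣ d ∣ {{ℚ.nonNegative (ℚ.0≤∣p∣ d)}} a≤B)
        (ℚ.*-monoʳ-<-pos B {{ℚ.positive 0<B}} d<δ))

  split-ε : ∀ A B ε → 0ℚ ℚ.< A → 0ℚ ℚ.< B → 0ℚ ℚ.< ε →
    ∃[ δ ] (0ℚ ℚ.< δ × A ℚ.* δ ℚ.+ B ℚ.* δ ≡ ε)
  split-ε A B ε 0<A 0<B 0<ε = rescale (A ℚ.+ B) (ℚ.positive (ℚ.+-mono-< 0<A 0<B)) refl
    where
    rescale : ∀ C → ℚ.Positive C → A ℚ.+ B ≡ C →
      ∃[ δ ] (0ℚ ℚ.< δ × A ℚ.* δ ℚ.+ B ℚ.* δ ≡ ε)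
    rescale C C-pos A+B≡C = C⁻¹ ℚ.* ε
      , subst (ℚ._< C⁻¹ ℚ.* ε) (ℚ.*-zeroʳ C⁻¹)
          (ℚ.*-monoʳ-<-pos C⁻¹ {{ℚ.1/pos⇒pos C {{C-pos}}}} 0<ε)
      , trans (sym (ℚ.*-distribʳ-+ (C⁻¹ ℚ.* ε) A B))
          (trans (cong (ℚ._* (C⁻¹ ℚ.* ε)) A+B≡C)
            (trans (sym (ℚ.*-assoc C C⁻¹ ε))
              (trans (cong (ℚ._* ε) (ℚ.*-inverseʳ C {{ℚ.pos⇒nonZero C {{C-pos}}}}))
                (ℚ.*-identityˡ ε))))
      where
      C⁻¹ : ℚ
      C⁻¹ = (1/ C) {{ℚ.pos⇒nonZero C {{C-pos}}}}

  product-close : ∀ {A B δ ε} a b c d → 0ℚ ℚ.< A → 0ℚ ℚ.< B →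
    A ℚ.* δ ℚ.+ B ℚ.* δ ≡ ε → ∣ a ∣ ℚ.≤ A → ∣ d ∣ ℚ.≤ B →
    ∣ a ℚ.- c ∣ ℚ.< δ → ∣ b ℚ.- d ∣ ℚ.< δ → ∣ a ℚ.* b ℚ.- c ℚ.* d ∣ ℚ.< ε
  product-close {A} {B} a b c d 0<A 0<B split a≤A d≤B a~c b~d =
    subst₂ (λ z → ∣ z ∣ ℚ.<_) (sym (*-regroup a b c d)) split
      (ℚ.≤-<-trans (ℚ.∣p+q∣≤∣p∣+∣q∣ (a ℚ.* (b ℚ.- d)) (d ℚ.* (a ℚ.- c)))
        (ℚ.+-mono-< (∣*∣-bound {a} {b ℚ.- d} {A} 0<A a≤A b~d)
                    (∣*∣-bound {d} {a ℚ.- c} {B} 0<B d≤B a~c)))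

_+_ : ℝ → ℝ → ℝ
x + y = mkℝ (λ n → seq x n ℚ.+ seq y n) sum-cauchy
  where
  sum-cauchy : IsCauchy (λ n → seq x n ℚ.+ seq y n)
  sum-cauchy ε 0<ε = N₁ ⊔ N₂ , close
    where
    0<ε/2 : 0ℚ ℚ.< ½ ℚ.* ε
    0<ε/2 = half-pos ε 0<ε

    N₁ N₂ : ℕ
    N₁ = proj₁ (cauchy x (½ ℚ.* ε) 0<ε/2)
    N₂ = proj₁ (cauchy y (½ ℚ.* ε) 0<ε/2)

    close : ∀ m n → N₁ ⊔ N₂ ℕ.≤ m → N₁ ⊔ N₂ ℕ.≤ n →
      ∣ (seq x m ℚ.+ seq y m) ℚ.- (seq x n ℚ.+ seq y n) ∣ ℚ.< ε
    close m n h k = subst₂ (λ z → ∣ z ∣ ℚ.<_)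
      (sym (+-regroup (seq x m) (seq y m) (seq x n) (seq y n))) (half+half ε)
      (ℚ.≤-<-trans (ℚ.∣p+q∣≤∣p∣+∣q∣ (seq x m ℚ.- seq x n) (seq y m ℚ.- seq y n))
        (ℚ.+-mono-<
          (proj₂ (cauchy x (½ ℚ.* ε) 0<ε/2) m n
            (ℕ.m⊔n≤o⇒m≤o N₁ N₂ h) (ℕ.m⊔n≤o⇒m≤o N₁ N₂ k))
          (proj₂ (cauchy y (½ ℚ.* ε) 0<ε/2) m n
            (ℕ.m⊔n≤o⇒n≤o N₁ N₂ h) (ℕ.m⊔n≤o⇒n≤o N₁ N₂ k))))

-_ : ℝ → ℝ
- x = mkℝ (λ n → ℚ.- seq x n) λ ε 0<ε →
  proj₁ (cauchy x ε 0<ε) , λ m n N≤m N≤n →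
    subst (ℚ._< ε)
      (sym (trans (cong ∣_∣ (neg-regroup (seq x m) (seq x n)))
                  (ℚ.∣-p∣≡∣p∣ (seq x m ℚ.- seq x n))))
      (proj₂ (cauchy x ε 0<ε) m n N≤m N≤n)

_-_ : ℝ → ℝ → ℝ
x - y = x + - y

_*_ : ℝ → ℝ → ℝ
x * y = mkℝ (λ n → seq x n ℚ.* seq y n) product-cauchy
  where
  product-cauchy : IsCauchy (λ n → seq x n ℚ.* seq y n)
  product-cauchy ε 0<ε = N , close
    where
    A B : ℚ
    A = proj₁ (eventually-bounded x)
    B = proj₁ (eventually-bounded y)

    0<A : 0ℚ ℚ.< A
    0<A = proj₁ (proj₂ (eventually-bounded x))

    0<B : 0ℚ ℚ.< B
    0<B = proj₁ (proj₂ (eventually-bounded y))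

    scaled : ∃[ δ ] (0ℚ ℚ.< δ × A ℚ.* δ ℚ.+ B ℚ.* δ ≡ ε)
    scaled = split-ε A B ε 0<A 0<B 0<ε

    δ : ℚ
    δ = proj₁ scaled

    0<δ : 0ℚ ℚ.< δ
    0<δ = proj₁ (proj₂ scaled)

    M₁ M₂ N₁ N₂ N : ℕ
    M₁ = proj₁ (proj₂ (proj₂ (eventually-bounded x)))
    M₂ = proj₁ (proj₂ (proj₂ (eventually-bounded y)))
    N₁ = proj₁ (cauchy x δ 0<δ)
    N₂ = proj₁ (cauchy y δ 0<δ)
    N  = (M₁ ⊔ M₂) ⊔ (N₁ ⊔ N₂)

    M≤ : ∀ {n} → N ℕ.≤ n → M₁ ⊔ M₂ ℕ.≤ n
    M≤ = ℕ.m⊔n≤o⇒m≤o (M₁ ⊔ M₂) (N₁ ⊔ N₂)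

    N≤ : ∀ {n} → N ℕ.≤ n → N₁ ⊔ N₂ ℕ.≤ n
    N≤ = ℕ.m⊔n≤o⇒n≤o (M₁ ⊔ M₂) (N₁ ⊔ N₂)

    close : ∀ m n → N ℕ.≤ m → N ℕ.≤ n →
      ∣ seq x m ℚ.* seq y m ℚ.- seq x n ℚ.* seq y n ∣ ℚ.< ε
    close m n h k = product-close (seq x m) (seq y m) (seq x n) (seq y n)
      0<A 0<B (proj₂ (proj₂ scaled))
      (proj₂ (proj₂ (proj₂ (eventually-bounded x))) m (ℕ.m⊔n≤o⇒m≤o M₁ M₂ (M≤ h)))
      (proj₂ (proj₂ (proj₂ (eventually-bounded y))) n (ℕ.m⊔n≤o⇒n≤o M₁ M₂ (M≤ k)))
      (proj₂ (cauchy x δ 0<δ) m n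
        (ℕ.m⊔n≤o⇒m≤o N₁ N₂ (N≤ h)) (ℕ.m⊔n≤o⇒m≤o N₁ N₂ (N≤ k)))
      (proj₂ (cauchy y δ 0<δ) m n
        (ℕ.m⊔n≤o⇒n≤o N₁ N₂ (N≤ h)) (ℕ.m⊔n≤o⇒n≤o N₁ N₂ (N≤ k)))

------------------------------------------------------------------------
-- Points and disks in the plane

ℝ² : Set
ℝ² = ℝ × ℝ

_≈²_ : ℝ² → ℝ² → Set
(x , y) ≈² (x′ , y′) = x ≈ x′ × y ≈ y′

dist² : ℝ² → ℝ² → ℝ
dist² (x , y) (x′ , y′) = (x - x′) * (x - x′) + (y - y′) * (y - y′)

record Disk : Set where
  field
    centre   : ℝ²
    radius   : ℝ
    positive : 0ℝ < radius

open Disk public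

-- Distances are compared through their squares, as radii are positive.

_∈Interior_ : ℝ² → Disk → Set
p ∈Interior D = dist² p (centre D) < radius D * radius D

_∈Boundary_ : ℝ² → Disk → Set
p ∈Boundary D = dist² p (centre D) ≈ radius D * radius D

InteriorDisjoint : Disk → Disk → Set
InteriorDisjoint D E = ∀ p → p ∈Interior D → p ∈Interior E → ⊥

record PointSet (n : ℕ) : Set where
  field
    point    : Fin n → ℝ²
    distinct : Injective _≡_ _≈²_ point

open PointSet public

Empty : ∀ {n} → PointSet n → Disk → Set
Empty P D = ∀ i → ¬ (point P i ∈Interior D)

-- Disks with disjoint interiors are distinct, so the family has k members.
record Cover {n : ℕ} (P : PointSet n) (k : ℕ) : Set where
  field
    disk     : Fin k → Disk
    disjoint : ∀ i j → i ≢ j → InteriorDisjoint (disk i) (disk j)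
    empty    : ∀ i → Empty P (disk i)
    covers   : ∀ i → ∃[ j ] (point P i ∈Boundary disk j)

------------------------------------------------------------------------
-- D(P) and D(n)

IsMinimum IsMaximum : (ℕ → Set) → ℕ → Set
IsMinimum S m = S m × (∀ k → S k → m ℕ.≤ k)
IsMaximum S m = S m × (∀ k → S k → k ℕ.≤ m)

-- Attaining these extrema depends on undecidable comparisons of reals, so
-- D(P) and D(n) are given by their graphs rather than as functions to ℕ;
-- `IsDₚ P d` reads D(P) = d and `IsD n d` reads D(n) = d.

IsDₚ : ∀ {n} → PointSet n → ℕ → Set
IsDₚ P = IsMinimum (Cover P)

IsD : ℕ → ℕ → Set
IsD n = IsMaximum (λ d → ∃[ P ] IsDₚ {n} P d)

{-# OPTIONS --safe #-}
-- The n points are m = n - 1 points spaced almost equally on the unit circle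
-- and its centre, the hub.  An empty disk touches at most two points of the
-- circle, and these are neighbours.  Suppose that a disk touches the hub and a
-- point p of the circle.  Inside the circle it is almost tangent at p, and a
-- disk that touches the next two points on one side of p has to avoid it.  So
-- this disk is pushed outwards until its radius no longer depends on m, and the
-- same holds for a disk that touches the two points after these.  When m ≥ 173
-- the two outer disks overlap.  Hence on either side of p some disk touches only
-- one point of the circle, and counting yields at least (m + 2) / 2 disks.
--
-- The computation is done in half-plane coordinates, in which the circle becomes
-- the x-axis, the hub becomes (0 , 1), and points on the circle are given by
-- tangents of half-angles.

module Submission where

-- Centre and radius of a disk are Cauchy reals, whose signs cannot be decided, while all points are
-- rational. A disk therefore enters only through the limits of a form that is affine in three
-- coefficients. Each geometric claim becomes a certificate: a combination of limits known to be
-- positive, nonnegative or zero, with rational coefficients of the right sign, that a ring identity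
-- matches with the desired expression. Half-angle coordinates keep these identities polynomial in
-- rational data.
--
-- Rational points also stand in the way of a regular polygon. All gaps but one are equal, and the
-- last one, the seam, is wider by a relative error of at most 1/100000 in the half-angle tangent.
-- The numerical estimates leave slack for this error.
--
-- For the count, every disk offers two slots to the circle points assigned to it, and distinct
-- points occupy distinct slots. Each of the two lone points leaves a slot of its disk free, so
-- `m + 2 ≤ 2 k`.

-- Rational inequalities and signs of limits

module Limits where

  open import Data.Empty using (⊥; ⊥-elim)
  open import Data.Nat.Base as ℕ using (ℕ)
  import Data.Nat.Properties as ℕ
  open import Data.Product.Base using (_×_; _,_; ∃-syntax)
  open import Data.Rational.Base
  open import Data.Rational.Properties as ℚ using (positive⁻¹; _≤?_; _<?_)
  open import Data.Sum.Base using (inj₁; inj₂)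
  open import Relation.Binary.PropositionalEquality
    using (_≡_; refl; sym; trans; cong; subst; subst₂)
  open import Relation.Binary.Definitions using (tri<; tri≈; tri>)
  open import Relation.Nullary.Decidable using (True; toWitness; dec⇒maybe)
  open import Tactic.RingSolver using (solve-∀)
  open import Tactic.RingSolver.Core.AlmostCommutativeRing
    using (AlmostCommutativeRing; fromCommutativeRing)

  ring : AlmostCommutativeRing _ _
  ring = fromCommutativeRing ℚ.+-*-commutativeRing (λ x → dec⇒maybe (0ℚ ℚ.≟ x))

  0<! : ∀ {q} {pf : True (0ℚ <? q)} → 0ℚ < q
  0<! {pf = pf} = toWitness pf

  0≤! : ∀ {q} {pf : True (0ℚ ≤? q)} → 0ℚ ≤ q
  0≤! {pf = pf} = toWitness pf

  0<* : ∀ {p q} → 0ℚ < p → 0ℚ < q → 0ℚ < p * q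
  0<* {p} {q} 0<p 0<q = positive⁻¹ (p * q)
    {{ℚ.pos*pos⇒pos p {{positive 0<p}} q {{positive 0<q}}}}

  0≤* : ∀ {p q} → 0ℚ ≤ p → 0ℚ ≤ q → 0ℚ ≤ p * q
  0≤* {p} {q} 0≤p 0≤q = ℚ.nonNegative⁻¹ (p * q)
    {{ℚ.nonNeg*nonNeg⇒nonNeg p {{nonNegative 0≤p}} q {{nonNegative 0≤q}}}}

  0≤+ : ∀ {p q} → 0ℚ ≤ p → 0ℚ ≤ q → 0ℚ ≤ p + q
  0≤+ = ℚ.+-mono-≤

  0<+ : ∀ {p q} → 0ℚ < p → 0ℚ < q → 0ℚ < p + q
  0<+ = ℚ.+-mono-<

  0<+≤ : ∀ {p q} → 0ℚ < p → 0ℚ ≤ q → 0ℚ < p + q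
  0<+≤ = ℚ.+-mono-<-≤

  0≤+< : ∀ {p q} → 0ℚ ≤ p → 0ℚ < q → 0ℚ < p + q
  0≤+< = ℚ.+-mono-≤-<

  0≤sq : ∀ p → 0ℚ ≤ p * p
  0≤sq p with ℚ.≤-total 0ℚ p
  ... | inj₁ 0≤p = 0≤* 0≤p 0≤p
  ... | inj₂ p≤0 = subst (0ℚ ≤_) (square-neg p) (0≤* (ℚ.neg-antimono-≤ p≤0) (ℚ.neg-antimono-≤ p≤0))
    where
    square-neg : ∀ p → (- p) * (- p) ≡ p * p
    square-neg = solve-∀ ring

  private
    cancel : ∀ p q → (q - p) + p ≡ q
    cancel = solve-∀ ring

  <⇒0< : ∀ {p q} → p < q → 0ℚ < q - p
  <⇒0< {p} {q} p<q = subst (_< q - p) (ℚ.+-inverseʳ p) (ℚ.+-monoˡ-< (- p) p<q)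

  0<⇒< : ∀ {p q} → 0ℚ < q - p → p < q
  0<⇒< {p} {q} 0<q-p = subst₂ _<_ (ℚ.+-identityˡ p) (cancel p q) (ℚ.+-monoˡ-< p 0<q-p)

  ≤⇒0≤ : ∀ {p q} → p ≤ q → 0ℚ ≤ q - p
  ≤⇒0≤ {p} {q} p≤q = subst (_≤ q - p) (ℚ.+-inverseʳ p) (ℚ.+-monoˡ-≤ (- p) p≤q)

  0≤⇒≤ : ∀ {p q} → 0ℚ ≤ q - p → p ≤ q
  0≤⇒≤ {p} {q} 0≤q-p = subst₂ _≤_ (ℚ.+-identityˡ p) (cancel p q) (ℚ.+-monoˡ-≤ p 0≤q-p)

  0<⇒0≤ : ∀ {p} → 0ℚ < p → 0ℚ ≤ p
  0<⇒0≤ = ℚ.<⇒≤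

  0<-subst : ∀ {p q} → p ≡ q → 0ℚ < p → 0ℚ < q
  0<-subst = subst (0ℚ <_)

  0≤-subst : ∀ {p q} → p ≡ q → 0ℚ ≤ p → 0ℚ ≤ q
  0≤-subst = subst (0ℚ ≤_)

  0<-0≤⇒⊥ : ∀ {p} → 0ℚ < p → 0ℚ ≤ - p → ⊥
  0<-0≤⇒⊥ {p} 0<p 0≤-p = ℚ.<-irrefl refl
    (subst (0ℚ <_) (ℚ.+-inverseʳ p) (0<+≤ 0<p 0≤-p))

  0<-cancel : ∀ {p q} → 0ℚ < p → 0ℚ < p * q → 0ℚ < q
  0<-cancel {p} {q} 0<p 0<pq = ℚ.*-cancelˡ-<-nonNeg p {{nonNegative (0<⇒0≤ 0<p)}}
    (subst (_< p * q) (sym (ℚ.*-zeroʳ p)) 0<pq)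

  0≤-cancel : ∀ {p q} → 0ℚ < p → 0ℚ ≤ p * q → 0ℚ ≤ q
  0≤-cancel {p} {q} 0<p 0≤pq = ℚ.*-cancelˡ-≤-pos p {{positive 0<p}}
    (subst (_≤ p * q) (sym (ℚ.*-zeroʳ p)) 0≤pq)

  reciprocal : ∀ q → 0ℚ < q → ∃[ r ] (0ℚ < r × q * r ≡ 1ℚ)
  reciprocal q 0<q = r
    , positive⁻¹ r {{ℚ.1/pos⇒pos q {{positive 0<q}}}}
    , ℚ.*-inverseʳ q {{ℚ.pos⇒nonZero q {{positive 0<q}}}}
    where
    r : ℚ
    r = (1/ q) {{ℚ.pos⇒nonZero q {{positive 0<q}}}}

  Seq : Set
  Seq = ℕ → ℚ

  Eventually : (ℕ → Set) → Set
  Eventually P = ∃[ N ] (∀ n → N ℕ.≤ n → P n)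

  ev-map₂ : ∀ {P Q R : ℕ → Set} → (∀ n → P n → Q n → R n) →
    Eventually P → Eventually Q → Eventually R
  ev-map₂ f (M , p) (N , q) = M ℕ.⊔ N , λ n M⊔N≤n →
    f n (p n (ℕ.m⊔n≤o⇒m≤o M N M⊔N≤n)) (q n (ℕ.m⊔n≤o⇒n≤o M N M⊔N≤n))

  ev-map : ∀ {P Q : ℕ → Set} → (∀ n → P n → Q n) → Eventually P → Eventually Q
  ev-map f (N , p) = N , λ n N≤n → f n (p n N≤n)

  -- For a convergent F these say that its limit is ≥ 0, > 0 and = 0.
  record NonNeg∞ (F : Seq) : Set where
    constructor nonNeg∞
    field above : ∀ ε → 0ℚ < ε → Eventually (λ n → 0ℚ < F n + ε)

  record Pos∞ (F : Seq) : Set where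
    constructor pos∞
    field
      margin   : ℚ
      0<margin : 0ℚ < margin
      above    : Eventually (λ n → 0ℚ < F n - margin)

  Zero∞ : Seq → Set
  Zero∞ F = NonNeg∞ F × NonNeg∞ (λ n → - F n)

  open NonNeg∞

  private
    half-sum : ∀ a b e → (a + ½ * e) + (b + ½ * e) ≡ (a + b) + e
    half-sum a b e = trans (regroup a b (½ * e))
      (cong (a + b +_) (trans (sym (ℚ.*-distribʳ-+ e ½ ½)) (ℚ.*-identityˡ e)))
      where
      regroup : ∀ a b h → (a + h) + (b + h) ≡ (a + b) + (h + h)
      regroup = solve-∀ ring

    half-diff : ∀ a b e → (a - e) + (b + ½ * e) ≡ (a + b) - ½ * e
    half-diff a b e = trans (cong (λ z → (a - z) + (b + ½ * e))
        (sym (trans (sym (ℚ.*-distribʳ-+ e ½ ½)) (ℚ.*-identityˡ e))))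
      (regroup a b (½ * e))
      where
      regroup : ∀ a b h → (a - (h + h)) + (b + h) ≡ (a + b) - h
      regroup = solve-∀ ring

    0<½* : ∀ {e} → 0ℚ < e → 0ℚ < ½ * e
    0<½* = 0<* {½} 0<!

  NonNeg∞-resp : ∀ {F G} → (∀ n → F n ≡ G n) → NonNeg∞ F → NonNeg∞ G
  NonNeg∞-resp F≡G F≥0 = nonNeg∞ λ ε 0<ε →
    ev-map (λ n → 0<-subst (cong (_+ ε) (F≡G n))) (above F≥0 ε 0<ε)

  Pos∞-resp : ∀ {F G} → (∀ n → F n ≡ G n) → Pos∞ F → Pos∞ G
  Pos∞-resp F≡G (pos∞ ε 0<ε F>ε) =
    pos∞ ε 0<ε (ev-map (λ n → 0<-subst (cong (_- ε) (F≡G n))) F>ε)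

  Zero∞-resp : ∀ {F G} → (∀ n → F n ≡ G n) → Zero∞ F → Zero∞ G
  Zero∞-resp F≡G (F≥0 , F≤0) =
    NonNeg∞-resp F≡G F≥0 , NonNeg∞-resp (λ n → cong -_ (F≡G n)) F≤0

  NonNeg∞-+ : ∀ {F G} → NonNeg∞ F → NonNeg∞ G → NonNeg∞ (λ n → F n + G n)
  NonNeg∞-+ {F} {G} F≥0 G≥0 = nonNeg∞ λ ε 0<ε → ev-map₂
    (λ n p q → 0<-subst (half-sum (F n) (G n) ε) (0<+ p q))
    (above F≥0 (½ * ε) (0<½* 0<ε)) (above G≥0 (½ * ε) (0<½* 0<ε))

  Pos∞-+ : ∀ {F G} → Pos∞ F → NonNeg∞ G → Pos∞ (λ n → F n + G n)
  Pos∞-+ {F} {G} (pos∞ ε 0<ε F>ε) G≥0 = pos∞ (½ * ε) (0<½* 0<ε) (ev-map₂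
    (λ n p q → 0<-subst (half-diff (F n) (G n) ε) (0<+ p q))
    F>ε (above G≥0 (½ * ε) (0<½* 0<ε)))

  NonNeg∞-const : ∀ {c} → 0ℚ ≤ c → NonNeg∞ (λ _ → c)
  NonNeg∞-const 0≤c = nonNeg∞ λ ε 0<ε → 0 , λ _ _ → 0≤+< 0≤c 0<ε

  Pos∞-const : ∀ {c} → 0ℚ < c → Pos∞ (λ _ → c)
  Pos∞-const {c} 0<c = pos∞ (½ * c) (0<½* 0<c) (0 , λ _ _ →
    0<-subst (trans (half c (½ * c)) (cong (_- ½ * c)
      (trans (sym (ℚ.*-distribʳ-+ c ½ ½)) (ℚ.*-identityˡ c)))) (0<½* 0<c))
    where
    half : ∀ c h → h ≡ (h + h) - h
    half = solve-∀ ring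

  Pos∞⇒NonNeg∞ : ∀ {F} → Pos∞ F → NonNeg∞ F
  Pos∞⇒NonNeg∞ {F} (pos∞ ε 0<ε F>ε) = nonNeg∞ λ δ 0<δ → ev-map
    (λ n p → 0<-subst (regroup (F n) ε δ) (0<+ p (0<+ 0<ε 0<δ))) F>ε
    where
    regroup : ∀ a e d → (a - e) + (e + d) ≡ a + d
    regroup = solve-∀ ring

  Pos∞-* : ∀ {c F} → 0ℚ < c → Pos∞ F → Pos∞ (λ n → c * F n)
  Pos∞-* {c} {F} 0<c (pos∞ ε 0<ε F>ε) = pos∞ (c * ε) (0<* 0<c 0<ε)
    (ev-map (λ n p → 0<-subst (distrib c (F n) ε) (0<* 0<c p)) F>ε)
    where
    distrib : ∀ c a e → c * (a - e) ≡ c * a - c * e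
    distrib = solve-∀ ring

  NonNeg∞-* : ∀ {c F} → 0ℚ ≤ c → NonNeg∞ F → NonNeg∞ (λ n → c * F n)
  NonNeg∞-* {c} {F} 0≤c F≥0 with ℚ.<-cmp 0ℚ c
  ... | tri> _ _ c<0 = ⊥-elim (ℚ.<-irrefl refl (ℚ.<-≤-trans c<0 0≤c))
  ... | tri≈ _ refl _ = NonNeg∞-resp (λ n → sym (ℚ.*-zeroˡ (F n))) (NonNeg∞-const ℚ.≤-refl)
  ... | tri< 0<c _ _ = nonNeg∞ λ ε 0<ε → let (r , 0<r , cr≡1) = reciprocal c 0<c in
    ev-map (λ n p → 0<-subst
        (trans (regroup c (F n) r ε)
          (cong (c * F n +_) (trans (cong (_* ε) cr≡1) (ℚ.*-identityˡ ε))))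
        (0<* 0<c p))
      (above F≥0 (r * ε) (0<* 0<r 0<ε))
    where
    regroup : ∀ c a r e → c * (a + r * e) ≡ c * a + (c * r) * e
    regroup = solve-∀ ring

  -- Touching conditions may thus enter a certificate with coefficients of either sign, whereas
  -- avoidance conditions need nonnegative ones.
  Zero∞-* : ∀ c {F} → Zero∞ F → Zero∞ (λ n → c * F n)
  Zero∞-* c {F} (F≥0 , F≤0) with ℚ.≤-total 0ℚ c
  ... | inj₁ 0≤c = NonNeg∞-* 0≤c F≥0
      , NonNeg∞-resp (λ n → sym (ℚ.neg-distribʳ-* c (F n))) (NonNeg∞-* 0≤c F≤0)
  ... | inj₂ c≤0 = NonNeg∞-resp (λ n → neg*neg c (F n)) (NonNeg∞-* (ℚ.neg-antimono-≤ c≤0) F≤0)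
      , NonNeg∞-resp (λ n → sym (ℚ.neg-distribˡ-* c (F n))) (NonNeg∞-* (ℚ.neg-antimono-≤ c≤0) F≥0)
    where
    neg*neg : ∀ p q → - p * - q ≡ p * q
    neg*neg = solve-∀ ring

  NonNeg∞-cancel : ∀ {c F} → 0ℚ < c → NonNeg∞ (λ n → c * F n) → NonNeg∞ F
  NonNeg∞-cancel {c} {F} 0<c cF≥0 = let (r , 0<r , cr≡1) = reciprocal c 0<c in
    NonNeg∞-resp
      (λ n → trans (regroup c r (F n)) (trans (cong (_* F n) cr≡1) (ℚ.*-identityˡ (F n))))
      (NonNeg∞-* (0<⇒0≤ 0<r) cF≥0)
    where
    regroup : ∀ c r a → r * (c * a) ≡ (c * r) * a
    regroup = solve-∀ ring

  Pos∞-cancel : ∀ {c F} → 0ℚ < c → Pos∞ (λ n → c * F n) → Pos∞ F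
  Pos∞-cancel {c} {F} 0<c cF>0 = let (r , 0<r , cr≡1) = reciprocal c 0<c in
    Pos∞-resp
      (λ n → trans (regroup c r (F n)) (trans (cong (_* F n) cr≡1) (ℚ.*-identityˡ (F n))))
      (Pos∞-* 0<r cF>0)
    where
    regroup : ∀ c r a → r * (c * a) ≡ (c * r) * a
    regroup = solve-∀ ring

  Zero∞-cancel : ∀ {c F} → 0ℚ < c → Zero∞ (λ n → c * F n) → Zero∞ F
  Zero∞-cancel {c} {F} 0<c (cF≥0 , cF≤0) = NonNeg∞-cancel 0<c cF≥0
    , NonNeg∞-cancel 0<c (NonNeg∞-resp (λ n → ℚ.neg-distribʳ-* c (F n)) cF≤0)

  Pos∞-NonNeg∞⇒⊥ : ∀ {F} → Pos∞ F → NonNeg∞ (λ n → - F n) → ⊥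
  Pos∞-NonNeg∞⇒⊥ {F} F>0 F≤0 = zero-not-pos
    (Pos∞-resp {G = λ _ → 0ℚ} (λ n → ℚ.+-inverseʳ (F n)) (Pos∞-+ F>0 F≤0))
    where
    negate : ∀ ε → (0ℚ - ε) + ε ≡ 0ℚ
    negate = solve-∀ ring

    zero-not-pos : Pos∞ (λ _ → 0ℚ) → ⊥
    zero-not-pos (pos∞ ε 0<ε (N , p)) =
      ℚ.<-irrefl (sym (negate ε)) (0<+ (p N ℕ.≤-refl) 0<ε)

-- Disks as quadratic forms in half-plane coordinates

module Forms where

  open Limits
  open import Data.Integer.Base using (+_)
  open import Data.Product.Base using (proj₁)
  open import Data.Rational.Base
  open import Relation.Binary.PropositionalEquality using (_≡_)
  open import Tactic.RingSolver using (solve-∀)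

  -- The quadratic A (x² + y²) + B x + C y + E that defines a disk in the
  -- coordinates of the upper half-plane, normalised by A + E - C = 4.
  record Form : Set where
    field A B E : Seq

  open Form

  -- The normalisation eliminates the coefficient of `y`. It says that the form takes the value 4 at
  -- `(0 , - 1)`, the image of the point at infinity of the plane.
  form : ℚ → ℚ → ℚ → ℚ → ℚ → ℚ
  form a b e x y = a * (x * x + y * y) + b * x + (a + e - + 4 / 1) * y + e

  value : Form → ℚ → ℚ → Seq
  value f x y n = form (A f n) (B f n) (E f n) x y

  module _ (f : Form)
    (origin : Zero∞ (value f 0ℚ 0ℚ)) (hub : Zero∞ (value f 0ℚ 1ℚ))
    {a : ℚ} (0<a : 0ℚ < a) (back : NonNeg∞ (value f (- a) 0ℚ))
    where

    -- In the limit, `origin` and `hub` force `E = 0` and `A = 2`, and `back` gives `B ≤ 2 a`. For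
    -- `ξ ≥ 0` the form is then at most twice `ξ² + a ξ + η² - η`, whose zero circle passes through
    -- the contact point, the hub and the neighbour `(- a , 0)`.
    contact-disk : ∀ {ξ η} → 0ℚ ≤ ξ → 0ℚ < η - (ξ * ξ + a * ξ + η * η) →
      Pos∞ (λ n → - value f ξ η n)
    contact-disk {ξ} {η} 0≤ξ inside = Pos∞-cancel {+ 2 / 1 * a} (0<* {+ 2 / 1} 0<! 0<a)
      (Pos∞-resp (λ n → identity (A f n) (B f n) (E f n) a ξ η)
        (Pos∞-+ (Pos∞-+ (Pos∞-const (0<* {+ 4 / 1} 0<! (0<* 0<a inside)))
                        (NonNeg∞-* (0≤* {+ 2 / 1} 0≤! 0≤ξ) back))
                (NonNeg∞-+ (proj₁ (Zero∞-* hubCoeff hub)) (proj₁ (Zero∞-* originCoeff origin)))))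
      where
      S hubCoeff originCoeff : ℚ
      S = a * (ξ * ξ + η * η) + ξ * (a * a)
      hubCoeff = - (S + a * η)
      originCoeff = + 2 / 1 * (S - (a + ξ))

      identity : ∀ A B E a ξ η →
        (+ 4 / 1 * (a * (η - (ξ * ξ + a * ξ + η * η)))
          + + 2 / 1 * ξ * (A * ((- a) * (- a) + 0ℚ * 0ℚ) + B * (- a) + (A + E - + 4 / 1) * 0ℚ + E))
          + (- ((a * (ξ * ξ + η * η) + ξ * (a * a)) + a * η)
              * (A * (0ℚ * 0ℚ + 1ℚ * 1ℚ) + B * 0ℚ + (A + E - + 4 / 1) * 1ℚ + E)
            + + 2 / 1 * ((a * (ξ * ξ + η * η) + ξ * (a * a)) - (a + ξ))
              * (A * (0ℚ * 0ℚ + 0ℚ * 0ℚ) + B * 0ℚ + (A + E - + 4 / 1) * 0ℚ + E))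
        ≡ + 2 / 1 * a * - (A * (ξ * ξ + η * η) + B * ξ + (A + E - + 4 / 1) * η + E)
      identity = solve-∀ ring

  module _ (f : Form) {x₁ x₂ : ℚ} (x₁<x₂ : 0ℚ < x₂ - x₁) (0<1+x₁x₂ : 0ℚ < 1ℚ + x₁ * x₂)
    (left : Zero∞ (value f x₁ 0ℚ)) (right : Zero∞ (value f x₂ 0ℚ))
    (hub : NonNeg∞ (value f 0ℚ 1ℚ))
    where

    -- The roots `x₁` and `x₂` give `E = A x₁ x₂`, and the hub condition reads `A + E ≥ 2`;
    -- together, `A (1 + x₁ x₂) ≥ 2`.
    leading-pos : Pos∞ (A f)
    leading-pos = Pos∞-cancel {+ 2 / 1 * ((x₂ - x₁) * (1ℚ + x₁ * x₂))}
      (0<* {+ 2 / 1} 0<! (0<* x₁<x₂ 0<1+x₁x₂))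
      (Pos∞-resp (λ n → identity (A f n) (B f n) (E f n) x₁ x₂)
        (Pos∞-+ (Pos∞-+ (Pos∞-const (0<* {+ 4 / 1} 0<! x₁<x₂))
                        (NonNeg∞-* (0<⇒0≤ x₁<x₂) hub))
                (NonNeg∞-+ (proj₁ (Zero∞-* (- (+ 2 / 1) * x₂) left))
                           (proj₁ (Zero∞-* (+ 2 / 1 * x₁) right)))))
      where
      identity : ∀ A B E x₁ x₂ →
        (+ 4 / 1 * (x₂ - x₁)
          + (x₂ - x₁) * (A * (0ℚ * 0ℚ + 1ℚ * 1ℚ) + B * 0ℚ + (A + E - + 4 / 1) * 1ℚ + E))
        + (- (+ 2 / 1) * x₂ * (A * (x₁ * x₁ + 0ℚ * 0ℚ) + B * x₁ + (A + E - + 4 / 1) * 0ℚ + E)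
          + + 2 / 1 * x₁ * (A * (x₂ * x₂ + 0ℚ * 0ℚ) + B * x₂ + (A + E - + 4 / 1) * 0ℚ + E))
        ≡ + 2 / 1 * ((x₂ - x₁) * (1ℚ + x₁ * x₂)) * A
      identity = solve-∀ ring

    -- A disk through two points of the circle that avoids a point above the
    -- chord is forced to bulge far below it.
    bulge : ∀ {ξ η X Y} → 0ℚ < η → 0ℚ ≤ Y →
      0ℚ < Y * ((x₂ - ξ) * (ξ - x₁) - η * η) - η * ((X - x₁) * (X - x₂) + Y * Y) →
      NonNeg∞ (value f ξ η) → Pos∞ (λ n → - value f X (- Y) n)
    bulge {ξ} {η} {X} {Y} 0<η 0≤Y 0<Δ outside = Pos∞-cancel {(x₂ - x₁) * η} (0<* x₁<x₂ 0<η)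
      (Pos∞-resp (λ n → identity (A f n) (B f n) (E f n) x₁ x₂ ξ η X Y)
        -- With both roots known, the form is `A ((x - x₁) (x - x₂) + y²) + C y`. Weighting the
        -- condition at `(ξ , η)` by `Y` and the target by `η` cancels `C`.
        (Pos∞-+ (Pos∞-+ (Pos∞-* (0<* x₁<x₂ 0<Δ) leading-pos)
                        (NonNeg∞-* (0≤* (0<⇒0≤ x₁<x₂) 0≤Y) outside))
                (NonNeg∞-+ (proj₁ (Zero∞-* (- (Y * (x₂ - ξ) + η * (x₂ - X))) left))
                           (proj₁ (Zero∞-* (- (Y * (ξ - x₁) + η * (X - x₁))) right)))))
      where
      identity : ∀ A B E x₁ x₂ ξ η X Y →
        ((x₂ - x₁) * (Y * ((x₂ - ξ) * (ξ - x₁) - η * η) - η * ((X - x₁) * (X - x₂) + Y * Y)) * A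
          + (x₂ - x₁) * Y * (A * (ξ * ξ + η * η) + B * ξ + (A + E - + 4 / 1) * η + E))
        + (- (Y * (x₂ - ξ) + η * (x₂ - X))
            * (A * (x₁ * x₁ + 0ℚ * 0ℚ) + B * x₁ + (A + E - + 4 / 1) * 0ℚ + E)
          + - (Y * (ξ - x₁) + η * (X - x₁))
            * (A * (x₂ * x₂ + 0ℚ * 0ℚ) + B * x₂ + (A + E - + 4 / 1) * 0ℚ + E))
        ≡ (x₂ - x₁) * η * - (A * (X * X + (- Y) * (- Y)) + B * X + (A + E - + 4 / 1) * (- Y) + E)
      identity = solve-∀ ring

-- Tangent bounds and the numerical inequalities

module Estimates where

  open Limits
  open import Data.Integer.Base using (+_)
  open import Data.Product.Base using (_×_; _,_; proj₁; proj₂; ∃-syntax)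
  open import Data.Rational.Base
  import Data.Rational.Properties as ℚ
  open import Relation.Binary.PropositionalEquality using (_≡_; sym; trans; cong)
  open import Tactic.RingSolver using (solve-∀)

  -- An upper bound for the square of the half-angle tangent of a gap: with 173
  -- gaps this tangent is just below 0.018165.
  tMax gapMax : ℚ
  tMax = + 33 / 100000
  gapMax = + 100001 / 100000

  -- Addition of half-angles, for tangents τ y and τ h with t = τ².
  module _ {t : ℚ} (0≤t : 0ℚ ≤ t) (t≤tMax : 0ℚ ≤ tMax - t) where

    tangent-sum : ∀ {y h lo hi hi′} →
      0ℚ ≤ lo → 0ℚ ≤ y - lo → 0ℚ ≤ hi - y → 0ℚ ≤ h - 1ℚ → 0ℚ ≤ gapMax - h →
      0ℚ < 1ℚ - tMax * (hi * gapMax) → 0ℚ ≤ hi′ → 0ℚ ≤ hi′ * (1ℚ - tMax * (hi * gapMax)) - (hi + gapMax) →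
      0ℚ < 1ℚ - t * (y * h) × ∃[ z ] (z * (1ℚ - t * (y * h)) ≡ y + h
        × 0ℚ ≤ z - (lo + 1ℚ + t * (lo * (lo + 1ℚ))) × 0ℚ ≤ hi′ - z)
    tangent-sum {y} {h} {lo} {hi} {hi′} 0≤lo lo≤y y≤hi 1≤h h≤gapMax 0<D₀ 0≤hi′ room =
      0<D , z , zD≡y+h , lower , upper
      where
      D : ℚ
      D = 1ℚ - t * (y * h)

      0≤y : 0ℚ ≤ y
      0≤y = 0≤-subst (e y lo) (0≤+ lo≤y 0≤lo)
        where e : ∀ y lo → (y - lo) + lo ≡ y
              e = solve-∀ ring

      0≤h : 0ℚ ≤ h
      0≤h = 0≤-subst (e h) (0≤+ 1≤h (0≤! {1ℚ}))
        where e : ∀ h → (h - 1ℚ) + 1ℚ ≡ h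
              e = solve-∀ ring

      0≤hi : 0ℚ ≤ hi
      0≤hi = 0≤-subst (e y hi) (0≤+ y≤hi 0≤y)
        where e : ∀ y hi → (hi - y) + y ≡ hi
              e = solve-∀ ring

      0≤gapMax : 0ℚ ≤ gapMax
      0≤gapMax = 0≤!

      D₀≤D : 0ℚ ≤ D - (1ℚ - tMax * (hi * gapMax))
      D₀≤D = 0≤-subst (e t y h hi gapMax tMax)
          (0≤+ (0≤* t≤tMax (0≤* 0≤hi 0≤gapMax))
               (0≤* 0≤t (0≤+ (0≤* 0≤y h≤gapMax) (0≤* y≤hi 0≤gapMax))))
        where
        e : ∀ t y h hi g m →
          (m - t) * (hi * g) + t * (y * (g - h) + (hi - y) * g)
          ≡ (1ℚ - t * (y * h)) - (1ℚ - m * (hi * g))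
        e = solve-∀ ring

      0<D : 0ℚ < D
      0<D = 0<-subst (e D (1ℚ - tMax * (hi * gapMax))) (0≤+< D₀≤D 0<D₀)
        where e : ∀ a b → (a - b) + b ≡ a
              e = solve-∀ ring

      r : ℚ
      r = proj₁ (reciprocal D 0<D)

      z : ℚ
      z = (y + h) * r

      zD≡y+h : z * D ≡ y + h
      zD≡y+h = trans (e (y + h) r D)
        (trans (cong ((y + h) *_) (proj₂ (proj₂ (reciprocal D 0<D)))) (ℚ.*-identityʳ (y + h)))
        where e : ∀ s r D → s * r * D ≡ s * (D * r)
              e = solve-∀ ring

      0≤z : 0ℚ ≤ z
      0≤z = 0≤* (0≤+ 0≤y 0≤h) (0<⇒0≤ (proj₁ (proj₂ (reciprocal D 0<D))))

      -- The addition formula in fixed-point form: the crude bound `lower₁`, inserted for `z` on the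
      -- right, produces the term in `t` of the lower bound.
      z-unfold : z ≡ y + h + t * (y * h) * z
      z-unfold = trans (e z (t * (y * h))) (cong (_+ t * (y * h) * z) zD≡y+h)
        where e : ∀ z w → z ≡ z * (1ℚ - w) + w * z
              e = solve-∀ ring

      lower₁ : 0ℚ ≤ z - (lo + 1ℚ)
      lower₁ = 0≤-subst (trans (e y h lo (t * (y * h) * z)) (cong (_- (lo + 1ℚ)) (sym z-unfold)))
          (0≤+ (0≤+ lo≤y 1≤h) (0≤* (0≤* 0≤t (0≤* 0≤y 0≤h)) 0≤z))
        where e : ∀ y h lo w → ((y - lo) + (h - 1ℚ)) + w ≡ (y + h + w) - (lo + 1ℚ)
              e = solve-∀ ring

      lower : 0ℚ ≤ z - (lo + 1ℚ + t * (lo * (lo + 1ℚ)))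
      lower = 0≤-subst (trans (e y h lo t z)
            (cong (_- (lo + 1ℚ + t * (lo * (lo + 1ℚ)))) (sym z-unfold)))
          (0≤+ (0≤+ lo≤y 1≤h)
            (0≤* 0≤t (0≤+ (0≤+ (0≤* (0≤* 0≤y 1≤h) 0≤z) (0≤* lo≤y 0≤z)) (0≤* 0≤lo lower₁))))
        where
        e : ∀ y h lo t z →
          ((y - lo) + (h - 1ℚ)) + t * ((y * (h - 1ℚ) * z + (y - lo) * z) + lo * (z - (lo + 1ℚ)))
          ≡ (y + h + t * (y * h) * z) - (lo + 1ℚ + t * (lo * (lo + 1ℚ)))
        e = solve-∀ ring

      upper : 0ℚ ≤ hi′ - z
      upper = 0≤-cancel 0<D (0≤-subst (trans
            (e hi′ D (1ℚ - tMax * (hi * gapMax)) hi gapMax y h)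
            (trans (cong (λ w → hi′ * D - w) (sym zD≡y+h)) (e′ hi′ D z)))
          (0≤+ (0≤+ room (0≤* 0≤hi′ D₀≤D)) (0≤+ y≤hi h≤gapMax)))
        where
        e : ∀ h′ D D₀ hi g y h →
          ((h′ * D₀ - (hi + g)) + h′ * (D - D₀)) + ((hi - y) + (g - h)) ≡ h′ * D - (y + h)
        e = solve-∀ ring

        e′ : ∀ h′ D z → h′ * D - z * D ≡ D * (h′ - z)
        e′ = solve-∀ ring

  ≤-via : ∀ p q r → 0ℚ ≤ q - p → 0ℚ ≤ r - q → 0ℚ ≤ r - p
  ≤-via p q r p≤q q≤r = 0≤-subst (e p q r) (0≤+ p≤q q≤r)
    where
    e : ∀ p q r → (q - p) + (r - q) ≡ r - p
    e = solve-∀ ring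

  -- The witnesses (ξ , η) = (c τ , d τ²) and (X , Y) = (k τ , Y) below were
  -- found numerically; 173 is the least odd number of equal gaps that admits such.
  k Y c₁ d₁ c₂ d₂ : ℚ
  k = + 3044 / 1000
  Y = + 121 / 10000
  c₁ = + 1364 / 1000
  d₁ = + 3228 / 1000
  c₂ = + 3422 / 1000
  d₂ = + 15209 / 1000

  -- The conclusion is the hypothesis of `contact-disk` at `(c τ , d τ²)` with `a = τ h`, divided by
  -- `τ²`: close to the contact point the disk is nearly the region above a parabola, hence the
  -- different powers of `τ`.
  inside-contact : ∀ {t h c d} → 0ℚ ≤ tMax - t → 0ℚ ≤ gapMax - h → 0ℚ ≤ c →
    0ℚ < d - (c * c + c * gapMax + d * d * tMax) →
    0ℚ < d - (c * c + h * c + d * d * t)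
  inside-contact {t} {h} {c} {d} t≤tMax h≤gapMax 0≤c room = 0<-subst (e t h c d gapMax tMax)
    (0<+≤ room (0≤+ (0≤* 0≤c h≤gapMax) (0≤* (0≤sq d) t≤tMax)))
    where
    e : ∀ t h c d g m →
      (d - (c * c + c * g + d * d * m)) + (c * (g - h) + d * d * (m - t))
      ≡ d - (c * c + h * c + d * d * t)
    e = solve-∀ ring

  module _ {t g m k Y c d : ℚ} (0≤t : 0ℚ ≤ t) (t≤m : 0ℚ ≤ m - t) (0≤Y : 0ℚ ≤ Y) (0≤d : 0ℚ ≤ d)
    where

    -- The conclusion is the hypothesis of `bulge`, divided by `τ²`. As `k` is at least `g` and `u`,
    -- the product `(k - y₁) (k - y₂)` is bounded by its value at `1` and `u`, and
    -- `(y₂ - c) (c - y₁)` from below by its value at `g` and `u`. What remains is affine in `t` and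
    -- decreasing, so `t = m` is the worst case.
    bulge₁ : ∀ {u y₁ y₂} → 0ℚ ≤ y₁ - 1ℚ → 0ℚ ≤ g - y₁ → 0ℚ ≤ y₂ - u →
      0ℚ ≤ c - g → 0ℚ ≤ u - c → 0ℚ ≤ k - g → 0ℚ ≤ k - u →
      0ℚ ≤ d * d * Y + d * ((k - 1ℚ) * (k - u)) →
      0ℚ < Y * ((u - c) * (c - g)) - d * (Y * Y) - m * (d * d * Y + d * ((k - 1ℚ) * (k - u))) →
      0ℚ < Y * ((y₂ - c) * (c - y₁) - d * d * t) - d * (t * ((k - y₁) * (k - y₂)) + Y * Y)
    bulge₁ {u} {y₁} {y₂} 1≤y₁ y₁≤g u≤y₂ g≤c c≤u g≤k u≤k 0≤slope room =
      0<-subst (e t y₁ y₂ k Y c d g m u)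
        (0<+≤ room (0≤+ (0≤* 0≤Y (0≤+ (0≤* u≤y₂ (≤-via y₁ g c y₁≤g g≤c)) (0≤* c≤u y₁≤g)))
          (0≤+ (0≤* (0≤* 0≤d 0≤t) (0≤+ (0≤* 1≤y₁ u≤k) (0≤* (≤-via y₁ g k y₁≤g g≤k) u≤y₂)))
               (0≤* t≤m 0≤slope))))
      where
      e : ∀ t y₁ y₂ k Y c d g m u →
        (Y * ((u - c) * (c - g)) - d * (Y * Y) - m * (d * d * Y + d * ((k - 1ℚ) * (k - u))))
        + (Y * ((y₂ - u) * (c - y₁) + (u - c) * (g - y₁))
          + (d * t * ((y₁ - 1ℚ) * (k - u) + (k - y₁) * (y₂ - u))
            + (m - t) * (d * d * Y + d * ((k - 1ℚ) * (k - u)))))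
        ≡ Y * ((y₂ - c) * (c - y₁) - d * d * t) - d * (t * ((k - y₁) * (k - y₂)) + Y * Y)
      e = solve-∀ ring

    -- Now `k` lies between `y₃` and `y₄`, so `(k - y₃) (k - y₄)` is nonpositive and helps; the
    -- worst case is `y₃ = g` and `y₄ = u + w t`. After a nonnegative term in `t²` is dropped, the
    -- bound is again affine and decreasing in `t`.
    bulge₂ : ∀ {u w y₃ y₄} → 0ℚ ≤ g - y₃ → 0ℚ ≤ w → 0ℚ ≤ y₄ - (u + w * t) →
      0ℚ ≤ c - g → 0ℚ ≤ u - c → 0ℚ ≤ k - g → 0ℚ ≤ u - k →
      0ℚ ≤ Y * (d * d) - w * (Y * (c - g)) - d * ((k - g) * (u - k)) →
      0ℚ < Y * ((u - c) * (c - g)) - d * (Y * Y)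
           - m * (Y * (d * d) - w * (Y * (c - g)) - d * ((k - g) * (u - k))) →
      0ℚ < Y * ((y₄ - c) * (c - y₃) - d * d * t) - d * (t * ((k - y₃) * (k - y₄)) + Y * Y)
    bulge₂ {u} {w} {y₃} {y₄} y₃≤g 0≤w u≤y₄ g≤c c≤u g≤k k≤u 0≤slope room =
      0<-subst (e t y₃ y₄ k Y c d g m u w)
        (0<+≤ room (0≤+ (0≤* t≤m 0≤slope)
          (0≤+ (0≤* 0≤Y (0≤+ (0≤* u≤y₄ (≤-via y₃ g c y₃≤g g≤c)) (0≤* (0≤+ c≤u (0≤* 0≤w 0≤t)) y₃≤g)))
               (0≤* (0≤* 0≤d 0≤t)
                 (0≤+ (0≤* y₃≤g k≤u) (0≤* (≤-via y₃ g k y₃≤g g≤k) (0≤+ u≤y₄ (0≤* 0≤w 0≤t))))))))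
      where
      e : ∀ t y₃ y₄ k Y c d g m u w →
        (Y * ((u - c) * (c - g)) - d * (Y * Y)
          - m * (Y * (d * d) - w * (Y * (c - g)) - d * ((k - g) * (u - k))))
        + ((m - t) * (Y * (d * d) - w * (Y * (c - g)) - d * ((k - g) * (u - k)))
          + (Y * ((y₄ - (u + w * t)) * (c - y₃) + ((u - c) + w * t) * (g - y₃))
            + d * t * ((g - y₃) * (u - k) + (k - y₃) * ((y₄ - (u + w * t)) + w * t))))
        ≡ Y * ((y₄ - c) * (c - y₃) - d * d * t) - d * (t * ((k - y₃) * (k - y₄)) + Y * Y)
      e = solve-∀ ring

  bulge-first : ∀ {t y₁ y₂} → 0ℚ ≤ t → 0ℚ ≤ tMax - t →
    0ℚ ≤ y₁ - 1ℚ → 0ℚ ≤ gapMax - y₁ → 0ℚ ≤ y₂ - + 2 / 1 →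
    0ℚ < Y * ((y₂ - c₁) * (c₁ - y₁) - d₁ * d₁ * t) - d₁ * (t * ((k - y₁) * (k - y₂)) + Y * Y)
  bulge-first {t} {y₁} {y₂} 0≤t t≤tMax 1≤y₁ y₁≤gapMax 2≤y₂ =
    bulge₁ {t} {gapMax} {tMax} {k} {Y} {c₁} {d₁} 0≤t t≤tMax 0≤! 0≤! {+ 2 / 1} {y₁} {y₂}
      1≤y₁ y₁≤gapMax 2≤y₂ 0≤! 0≤! 0≤! 0≤! 0≤! 0<!

  -- This is the tightest inequality: at `t = tMax` the margin is about 0.000014, of which the term
  -- `20 t` supplies about 0.000033. With `y₄ ≥ 4` alone these witnesses would fail.
  bulge-second : ∀ {t y₃ y₄} → 0ℚ ≤ t → 0ℚ ≤ tMax - t →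
    0ℚ ≤ + 30027 / 10000 - y₃ → 0ℚ ≤ y₄ - (+ 4 / 1 + + 20 / 1 * t) →
    0ℚ < Y * ((y₄ - c₂) * (c₂ - y₃) - d₂ * d₂ * t) - d₂ * (t * ((k - y₃) * (k - y₄)) + Y * Y)
  bulge-second {t} {y₃} {y₄} 0≤t t≤tMax y₃≤hi lo≤y₄ =
    bulge₂ {t} {+ 30027 / 10000} {tMax} {k} {Y} {c₂} {d₂} 0≤t t≤tMax 0≤! 0≤!
      {+ 4 / 1} {+ 20 / 1} {y₃} {y₄} y₃≤hi 0≤! lo≤y₄ 0≤! 0≤! 0≤! 0≤! 0≤! 0<!

-- The three-disk obstruction

module ThreeDisks where

  open Limits
  open Forms
  open Estimates
  open import Data.Empty using (⊥)
  open import Data.Integer.Base using (+_)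
  open import Data.Product.Base using (_×_; _,_; ∃-syntax)
  open import Data.Rational.Base
  open import Relation.Binary.PropositionalEquality using (_≡_)
  open import Relation.Nullary using (¬_)
  open import Tactic.RingSolver using (solve-∀)

  GapRange : ℚ → Set
  GapRange h = 0ℚ ≤ h - 1ℚ × 0ℚ ≤ gapMax - h

  -- The addition formula for the tangents `τ y` and `τ h` with sum `τ z`, cleared of its
  -- denominator.
  record Sum (τ y h z : ℚ) : Set where
    constructor sum
    field
      0<denominator : 0ℚ < 1ℚ - τ * τ * (y * h)
      value-eq      : z * (1ℚ - τ * τ * (y * h)) ≡ y + h

  -- Points with `0 < x` stay away from `(0 , - 1)`, so each of them comes from a point of the
  -- plane.
  Disjoint : Form → Form → Set
  Disjoint f g = ∀ x y → 0ℚ < x →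
    Pos∞ (λ n → - value f x y n) → Pos∞ (λ n → - value g x y n) → ⊥

  -- Excluding a positive limit yields a nonpositive one only for convergent sequences. A bare
  -- `Form` does not record convergence, so this consequence of it is passed along.
  Stable : Form → Set
  Stable f = ∀ x y → 0ℚ < y → ¬ Pos∞ (λ n → - value f x y n) → NonNeg∞ (value f x y)

  module _ {τ : ℚ} (0<τ : 0ℚ < τ) (t≤tMax : 0ℚ ≤ tMax - τ * τ) where

    private
      0<t : 0ℚ < τ * τ
      0<t = 0<* 0<τ 0<τ

      0≤t : 0ℚ ≤ τ * τ
      0≤t = 0<⇒0≤ 0<t

    private
      t : ℚ
      t = τ * τ

      -- The coefficients 2, 8 and 20 of `t` in the lower bounds of this and the next two steps are
      -- `(j³ - j) / 3` for `j = 2, 3, 4`: the first-order coefficients of `tan (j α) / tan α` in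
      -- `t = tan² α`. The upper bounds 2.0007 and 3.0027 also cover the spread allowed by `gapMax`.
      step₂ : ∀ {h₁ h₂} → GapRange h₁ → GapRange h₂ →
        ∃[ y ] (Sum τ h₁ h₂ y × 0ℚ ≤ y - (+ 2 / 1 + + 2 / 1 * t) × 0ℚ ≤ + 20007 / 10000 - y)
      step₂ {h₁} {h₂} (1≤h₁ , h₁≤) (1≤h₂ , h₂≤) = finish
        (tangent-sum 0≤t t≤tMax {h₁} {h₂} {1ℚ} {gapMax} {+ 20007 / 10000}
           0≤! 1≤h₁ h₁≤ 1≤h₂ h₂≤ 0<! 0≤! 0≤!)
        where
        e : ∀ y t → y - (1ℚ + 1ℚ + t * (1ℚ * (1ℚ + 1ℚ))) ≡ y - (+ 2 / 1 + + 2 / 1 * t)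
        e = solve-∀ ring

        finish : _ → _
        finish (0<D , y , y-eq , lo , hi) = y , sum 0<D y-eq , 0≤-subst (e y t) lo , hi

      step₃ : ∀ {y₂ h₃} → 0ℚ ≤ y₂ - (+ 2 / 1 + + 2 / 1 * t) → 0ℚ ≤ + 20007 / 10000 - y₂ → GapRange h₃ →
        ∃[ y ] (Sum τ y₂ h₃ y × 0ℚ ≤ y - (+ 3 / 1 + + 8 / 1 * t) × 0ℚ ≤ + 30027 / 10000 - y)
      step₃ {y₂} {h₃} y₂≥ y₂≤ (1≤h₃ , h₃≤) = finish
        (tangent-sum 0≤t t≤tMax {y₂} {h₃} {+ 2 / 1 + + 2 / 1 * t} {+ 20007 / 10000} {+ 30027 / 10000}
           (0≤+ {+ 2 / 1} 0≤! (0≤* {+ 2 / 1} 0≤! 0≤t)) y₂≥ y₂≤ 1≤h₃ h₃≤ 0<! 0≤! 0≤!)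
        where
        e : ∀ y t → (y - ((+ 2 / 1 + + 2 / 1 * t) + 1ℚ
               + t * ((+ 2 / 1 + + 2 / 1 * t) * ((+ 2 / 1 + + 2 / 1 * t) + 1ℚ))))
             + t * (+ 10 / 1 * t + + 4 / 1 * (t * t)) ≡ y - (+ 3 / 1 + + 8 / 1 * t)
        e = solve-∀ ring

        finish : _ → _
        finish (0<D , y , y-eq , lo , hi) = y , sum 0<D y-eq
          , 0≤-subst (e y t) (0≤+ lo (0≤* 0≤t (0≤+ (0≤* {+ 10 / 1} 0≤! 0≤t) (0≤* {+ 4 / 1} 0≤! (0≤* 0≤t 0≤t)))))
          , hi

      step₄ : ∀ {y₃ h₄} → 0ℚ ≤ y₃ - (+ 3 / 1 + + 8 / 1 * t) → 0ℚ ≤ + 30027 / 10000 - y₃ → GapRange h₄ →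
        ∃[ y ] (Sum τ y₃ h₄ y × 0ℚ ≤ y - (+ 4 / 1 + + 20 / 1 * t))
      step₄ {y₃} {h₄} y₃≥ y₃≤ (1≤h₄ , h₄≤) = finish
        (tangent-sum 0≤t t≤tMax {y₃} {h₄} {+ 3 / 1 + + 8 / 1 * t} {+ 30027 / 10000} {+ 5 / 1}
           (0≤+ {+ 3 / 1} 0≤! (0≤* {+ 8 / 1} 0≤! 0≤t)) y₃≥ y₃≤ 1≤h₄ h₄≤ 0<! 0≤! 0≤!)
        where
        e : ∀ y t → (y - ((+ 3 / 1 + + 8 / 1 * t) + 1ℚ
               + t * ((+ 3 / 1 + + 8 / 1 * t) * ((+ 3 / 1 + + 8 / 1 * t) + 1ℚ))))
             + t * (+ 56 / 1 * t + + 64 / 1 * (t * t)) ≡ y - (+ 4 / 1 + + 20 / 1 * t)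
        e = solve-∀ ring

        finish : _ → _
        finish (0<D , y , y-eq , lo , hi) = y , sum 0<D y-eq
          , 0≤-subst (e y t) (0≤+ lo (0≤* 0≤t (0≤+ (0≤* {+ 56 / 1} 0≤! 0≤t) (0≤* {+ 64 / 1} 0≤! (0≤* 0≤t 0≤t)))))

    WalkTo₄ : (h₁ h₂ h₃ h₄ y₂ y₃ y₄ : ℚ) → Set
    WalkTo₄ h₁ h₂ h₃ h₄ y₂ y₃ y₄ = Sum τ h₁ h₂ y₂ × Sum τ y₂ h₃ y₃ × Sum τ y₃ h₄ y₄

    Bounds : (y₂ y₃ y₄ : ℚ) → Set
    Bounds y₂ y₃ y₄ = 0ℚ ≤ y₂ - (+ 2 / 1 + + 2 / 1 * t)
      × 0ℚ ≤ y₃ - (+ 3 / 1 + + 8 / 1 * t) × 0ℚ ≤ + 30027 / 10000 - y₃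
      × 0ℚ ≤ y₄ - (+ 4 / 1 + + 20 / 1 * t)

    walk : ∀ {h₁ h₂ h₃ h₄} → GapRange h₁ → GapRange h₂ → GapRange h₃ → GapRange h₄ →
      ∃[ y₂ ] ∃[ y₃ ] ∃[ y₄ ] (WalkTo₄ h₁ h₂ h₃ h₄ y₂ y₃ y₄ × Bounds y₂ y₃ y₄)
    walk {h₁} {h₂} {h₃} {h₄} r₁ r₂ r₃ r₄ = from₂ (step₂ r₁ r₂)
      where
      Result : Set
      Result = ∃[ y₂ ] ∃[ y₃ ] ∃[ y₄ ] (WalkTo₄ h₁ h₂ h₃ h₄ y₂ y₃ y₄ × Bounds y₂ y₃ y₄)

      from₂ : ∃[ y ] (Sum τ h₁ h₂ y × 0ℚ ≤ y - (+ 2 / 1 + + 2 / 1 * t) × 0ℚ ≤ + 20007 / 10000 - y) → Result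
      from₂ (y₂ , s₂ , lo₂ , hi₂) = from₃ (step₃ lo₂ hi₂ r₃)
        where
        from₃ : ∃[ y ] (Sum τ y₂ h₃ y × 0ℚ ≤ y - (+ 3 / 1 + + 8 / 1 * t) × 0ℚ ≤ + 30027 / 10000 - y) → Result
        from₃ (y₃ , s₃ , lo₃ , hi₃) = from₄ (step₄ lo₃ hi₃ r₄)
          where
          from₄ : ∃[ y ] (Sum τ y₃ h₄ y × 0ℚ ≤ y - (+ 4 / 1 + + 20 / 1 * t)) → Result
          from₄ (y₄ , s₄ , lo₄) = y₂ , y₃ , y₄ , (s₂ , s₃ , s₄) , lo₂ , lo₃ , hi₃ , lo₄

    private
      scaled-1+ : ∀ {y z} → 0ℚ ≤ y → 0ℚ ≤ z → 0ℚ < 1ℚ + τ * y * (τ * z)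
      scaled-1+ {y} {z} 0≤y 0≤z =
        0<+≤ {1ℚ} 0<! (0≤* (0≤* {τ} (0<⇒0≤ 0<τ) 0≤y) (0≤* {τ} (0<⇒0≤ 0<τ) 0≤z))

      scaled-< : ∀ {y z} → 0ℚ < z - y → 0ℚ < τ * z - τ * y
      scaled-< {y} {z} y<z = 0<-subst (e τ y z) (0<* 0<τ y<z)
        where e : ∀ t y z → t * (z - y) ≡ t * z - t * y
              e = solve-∀ ring

      scaled-Δ : ∀ {c d y z} → 0ℚ < Y * ((z - c) * (c - y) - d * d * t) - d * (t * ((k - y) * (k - z)) + Y * Y) →
        0ℚ < Y * ((τ * z - τ * c) * (τ * c - τ * y) - d * (τ * τ) * (d * (τ * τ)))
             - d * (τ * τ) * ((τ * k - τ * y) * (τ * k - τ * z) + Y * Y)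
      scaled-Δ {c} {d} {y} {z} 0<Δ = 0<-subst (e τ Y k c d y z) (0<* 0<t 0<Δ)
        where
        e : ∀ τ Y k c d y z →
          τ * τ * (Y * ((z - c) * (c - y) - d * d * (τ * τ)) - d * (τ * τ * ((k - y) * (k - z)) + Y * Y))
          ≡ Y * ((τ * z - τ * c) * (τ * c - τ * y) - d * (τ * τ) * (d * (τ * τ)))
             - d * (τ * τ) * ((τ * k - τ * y) * (τ * k - τ * z) + Y * Y)
        e = solve-∀ ring

      scaled-inside : ∀ {c d h} → 0ℚ < d - (c * c + h * c + d * d * t) →
        0ℚ < d * (τ * τ) - (τ * c * (τ * c) + τ * h * (τ * c) + d * (τ * τ) * (d * (τ * τ)))
      scaled-inside {c} {d} {h} 0<in = 0<-subst (e τ c d h) (0<* 0<t 0<in)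
        where
        e : ∀ τ c d h → τ * τ * (d - (c * c + h * c + d * d * (τ * τ)))
          ≡ d * (τ * τ) - (τ * c * (τ * c) + τ * h * (τ * c) + d * (τ * τ) * (d * (τ * τ)))
        e = solve-∀ ring

      lower : ∀ a b y → 0ℚ ≤ b → 0ℚ ≤ y - (a + b * t) → 0ℚ ≤ y - a
      lower a b y 0≤b lo = 0≤-subst (e a (b * t) y) (0≤+ lo (0≤* 0≤b 0≤t))
        where e : ∀ a b y → (y - (a + b)) + b ≡ y - a
              e = solve-∀ ring

      nonneg : ∀ a y → 0ℚ ≤ a → 0ℚ ≤ y - a → 0ℚ ≤ y
      nonneg a y 0≤a lo = 0≤-subst (e a y) (0≤+ lo 0≤a)
        where e : ∀ a y → (y - a) + a ≡ y
              e = solve-∀ ring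

      gap : ∀ a b y z → 0ℚ < b - a → 0ℚ ≤ a - y → 0ℚ ≤ z - b → 0ℚ < z - y
      gap a b y z a<b y≤a b≤z = 0<-subst (e a b y z) (0<+≤ a<b (0≤+ y≤a b≤z))
        where e : ∀ a b y z → (b - a) + ((a - y) + (z - b)) ≡ z - y
              e = solve-∀ ring

    -- The disk f₀ touches the hub and the contact point 0, while f₁ and f₂ touch
    -- the first two consecutive pairs of points on one side of it.  Squeezed
    -- outwards by f₀, both f₁ and f₂ contain the point (τ k , - Y).
    no-three-disks : ∀ {h₀ h₁ y₂ y₃ y₄} {f₀ f₁ f₂ : Form} →
      GapRange h₀ → GapRange h₁ → Bounds y₂ y₃ y₄ →
      Zero∞ (value f₀ 0ℚ 0ℚ) → Zero∞ (value f₀ 0ℚ 1ℚ) → NonNeg∞ (value f₀ (- (τ * h₀)) 0ℚ) →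
      Zero∞ (value f₁ (τ * h₁) 0ℚ) → Zero∞ (value f₁ (τ * y₂) 0ℚ) → NonNeg∞ (value f₁ 0ℚ 1ℚ) →
      Zero∞ (value f₂ (τ * y₃) 0ℚ) → Zero∞ (value f₂ (τ * y₄) 0ℚ) → NonNeg∞ (value f₂ 0ℚ 1ℚ) →
      Disjoint f₀ f₁ → Disjoint f₀ f₂ → Disjoint f₁ f₂ → Stable f₁ → Stable f₂ → ⊥
    no-three-disks {h₀} {h₁} {y₂} {y₃} {y₄} {f₀} {f₁} {f₂} (1≤h₀ , h₀≤) (1≤h₁ , h₁≤)
      (lo₂ , lo₃ , hi₃ , lo₄) f₀-0 f₀-hub f₀-back f₁-1 f₁-2 f₁-hub f₂-3 f₂-4 f₂-hub
      f₀⊥f₁ f₀⊥f₂ f₁⊥f₂ stable₁ stable₂ =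
      f₁⊥f₂ (τ * k) (- Y) (0<* 0<τ 0<!)
        (bulge f₁ {τ * h₁} {τ * y₂} (scaled-< {h₁} {y₂} (gap gapMax (+ 2 / 1) h₁ y₂ 0<! h₁≤ 2≤y₂))
          (scaled-1+ (nonneg 1ℚ h₁ 0≤! 1≤h₁) (nonneg (+ 2 / 1) y₂ 0≤! 2≤y₂)) f₁-1 f₁-2 f₁-hub
          {τ * c₁} {d₁ * (τ * τ)} {τ * k} {Y} (0<* {d₁} 0<! 0<t) 0≤!
          (scaled-Δ {c₁} {d₁} {h₁} {y₂} (bulge-first {t} {h₁} {y₂} 0≤t t≤tMax 1≤h₁ h₁≤ 2≤y₂))
          (stable₁ _ _ (0<* {d₁} 0<! 0<t) (f₀⊥f₁ (τ * c₁) (d₁ * (τ * τ)) (0<* 0<τ 0<!)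
            (inside {c₁} {d₁} 0<! 0<!))))
        (bulge f₂ {τ * y₃} {τ * y₄} (scaled-< {y₃} {y₄} (gap (+ 30027 / 10000) (+ 4 / 1) y₃ y₄ 0<! hi₃ 4≤y₄))
          (scaled-1+ (nonneg (+ 3 / 1) y₃ 0≤! (lower (+ 3 / 1) (+ 8 / 1) y₃ 0≤! lo₃)) (nonneg (+ 4 / 1) y₄ 0≤! 4≤y₄))
          f₂-3 f₂-4 f₂-hub
          {τ * c₂} {d₂ * (τ * τ)} {τ * k} {Y} (0<* {d₂} 0<! 0<t) 0≤!
          (scaled-Δ {c₂} {d₂} {y₃} {y₄} (bulge-second {t} {y₃} {y₄} 0≤t t≤tMax hi₃ lo₄))
          (stable₂ _ _ (0<* {d₂} 0<! 0<t) (f₀⊥f₂ (τ * c₂) (d₂ * (τ * τ)) (0<* 0<τ 0<!)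
            (inside {c₂} {d₂} 0<! 0<!))))
      where
      2≤y₂ : 0ℚ ≤ y₂ - + 2 / 1
      2≤y₂ = lower (+ 2 / 1) (+ 2 / 1) y₂ 0≤! lo₂

      4≤y₄ : 0ℚ ≤ y₄ - + 4 / 1
      4≤y₄ = lower (+ 4 / 1) (+ 20 / 1) y₄ 0≤! lo₄

      inside : ∀ {c d} → 0ℚ < c → 0ℚ < d - (c * c + c * gapMax + d * d * tMax) →
        Pos∞ (λ n → - value f₀ (τ * c) (d * (τ * τ)) n)
      inside {c} {d} 0<c room = contact-disk f₀ f₀-0 f₀-hub {τ * h₀} (0<* 0<τ 0<h₀) f₀-back
        {τ * c} {d * (τ * τ)} (0<⇒0≤ (0<* 0<τ 0<c))
        (scaled-inside {c} {d} {h₀} (inside-contact {t} {h₀} {c} {d} t≤tMax h₀≤ (0<⇒0≤ 0<c) room))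
        where
        0<h₀ : 0ℚ < h₀
        0<h₀ = 0<-subst (e h₀) (0<+≤ {1ℚ} 0<! 1≤h₀)
          where e : ∀ h → 1ℚ + (h - 1ℚ) ≡ h
                e = solve-∀ ring

-- From disks of real data to forms: the Cayley transform

module Frames where

  open Limits
  open Forms
  open ThreeDisks using (Disjoint; Stable)
  open import Defs as D
    using (seq; cauchy; fromℚ; Disk; centre; radius; dist²; _∈Interior_; _∈Boundary_; InteriorDisjoint)
  open import Data.Empty using (⊥-elim)
  open import Data.Integer.Base using (+_)
  open import Data.Nat.Base as ℕ using (ℕ)
  import Data.Nat.Properties as ℕ
  open import Data.Product.Base using (_×_; _,_; proj₁; proj₂; ∃-syntax)
  open import Data.Rational.Base
  import Data.Rational.Properties as ℚ
  open import Data.Sum.Base using (inj₁; inj₂)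
  open import Relation.Binary.PropositionalEquality using (_≡_; sym; trans; cong; cong₂)
  open import Relation.Nullary using (¬_; yes; no)
  open import Tactic.RingSolver using (solve-∀)

  ≤∣_∣ : ∀ p → 0ℚ ≤ ∣ p ∣ - p
  ≤∣ p ∣ with ℚ.≤-total 0ℚ p
  ... | inj₁ 0≤p = ≤⇒0≤ (ℚ.≤-reflexive (sym (ℚ.0≤p⇒∣p∣≡p 0≤p)))
  ... | inj₂ p≤0 = ≤⇒0≤ (ℚ.≤-trans p≤0 (ℚ.0≤∣p∣ p))

  -≤∣_∣ : ∀ p → 0ℚ ≤ ∣ p ∣ + p
  -≤∣ p ∣ = 0≤-subst (trans (cong (_- (- p)) (ℚ.∣-p∣≡∣p∣ p)) (e ∣ p ∣ p)) (≤∣ - p ∣)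
    where e : ∀ a p → a - (- p) ≡ a + p
          e = solve-∀ ring

  -- For each `ε` one late term settles the matter by a rational comparison with `½ * ε`: if it is
  -- larger, the Cauchy property gives a positive margin, which is excluded; otherwise the tail
  -- stays below `ε`.
  ¬Pos∞⇒NonNeg∞ : ∀ x → ¬ Pos∞ (seq x) → NonNeg∞ (λ n → - seq x n)
  ¬Pos∞⇒NonNeg∞ x ¬x>0 = nonNeg∞ λ ε 0<ε → decide ε 0<ε (cauchy x (½ * ε) (0<* {½} 0<! 0<ε))
    where
    halves : ∀ ε → ½ * ε + ½ * ε ≡ ε
    halves ε = trans (sym (ℚ.*-distribʳ-+ ε ½ ½)) (ℚ.*-identityˡ ε)

    decide : ∀ ε → 0ℚ < ε → ∃[ N ] (∀ m n → N ℕ.≤ m → N ℕ.≤ n → ∣ seq x m - seq x n ∣ < ½ * ε) →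
      Eventually (λ n → 0ℚ < - seq x n + ε)
    decide ε 0<ε (N , close) with ½ * ε ℚ.<? seq x N
    ... | no x≤ = N , λ n N≤n → 0<-subst
        (trans (e₁ ∣ seq x n - seq x N ∣ (seq x n) (seq x N) (½ * ε)) (cong (λ z → - seq x n + z) (halves ε)))
        (0<+≤ (<⇒0< (close n N N≤n ℕ.≤-refl))
          (0≤+ (≤∣ seq x n - seq x N ∣) (≤⇒0≤ (ℚ.≮⇒≥ x≤))))
      where
      e₁ : ∀ a xn xN h → (h - a) + ((a - (xn - xN)) + (h - xN)) ≡ - xn + (h + h)
      e₁ = solve-∀ ring
    ... | yes x> = ⊥-elim (¬x>0 above-half)
      where
      above-half : Pos∞ (seq x)
      above-half = pos∞ (seq x N - ½ * ε) (<⇒0< x>) (N , λ n N≤n → 0<-subst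
        (e₂ ∣ seq x n - seq x N ∣ (seq x n) (seq x N) (½ * ε))
        (0<+≤ (<⇒0< (close n N N≤n ℕ.≤-refl)) (-≤∣ seq x n - seq x N ∣)))
        where
        e₂ : ∀ a xn xN h → (h - a) + (a + (xn - xN)) ≡ xn - (xN - h)
        e₂ = solve-∀ ring

  ≈⇒Zero∞ : ∀ x y → x D.≈ y → Zero∞ (λ n → seq x n - seq y n)
  ≈⇒Zero∞ x y x≈y = nonNeg∞ (λ ε 0<ε → ev-map
      (λ n close → 0<-subst (e₁ ∣ seq x n - seq y n ∣ (seq x n) (seq y n) ε)
        (0<+≤ (<⇒0< close) (-≤∣ seq x n - seq y n ∣))) (x≈y ε 0<ε))
    , nonNeg∞ (λ ε 0<ε → ev-map
      (λ n close → 0<-subst (e₂ ∣ seq x n - seq y n ∣ (seq x n) (seq y n) ε)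
        (0<+≤ (<⇒0< close) (≤∣ seq x n - seq y n ∣))) (x≈y ε 0<ε))
    where
    e₁ : ∀ a x y ε → (ε - a) + (a + (x - y)) ≡ (x - y) + ε
    e₁ = solve-∀ ring

    e₂ : ∀ a x y ε → (ε - a) + (a - (x - y)) ≡ - (x - y) + ε
    e₂ = solve-∀ ring

  Pos∞⇒< : ∀ x y → Pos∞ (λ n → seq y n - seq x n) → x D.< y
  Pos∞⇒< x y (pos∞ ε 0<ε above) = ε , 0<ε , ev-map
    (λ n p → 0<⇒< (0<-subst (e (seq x n) (seq y n) ε) p)) above
    where
    e : ∀ x y ε → y - x - ε ≡ y - (x + ε)
    e = solve-∀ ring

  <⇒Pos∞ : ∀ x y → x D.< y → Pos∞ (λ n → seq y n - seq x n)
  <⇒Pos∞ x y (ε , 0<ε , above) = pos∞ ε 0<ε (ev-map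
    (λ n p → 0<-subst (e (seq x n) (seq y n) ε) (<⇒0< p)) above)
    where
    e : ∀ x y ε → y - (x + ε) ≡ y - x - ε
    e = solve-∀ ring

  ℚ² : Set
  ℚ² = ℚ × ℚ

  fromℚ² : ℚ² → D.ℝ²
  fromℚ² (x , y) = fromℚ x , fromℚ y

  power : Disk → ℚ² → Seq
  power 𝔻 p n = seq (dist² (fromℚ² p) (centre 𝔻)) n - seq (radius 𝔻 D.* radius 𝔻) n

  touching : ∀ 𝔻 p → fromℚ² p ∈Boundary 𝔻 → Zero∞ (power 𝔻 p)
  touching 𝔻 p = ≈⇒Zero∞ (dist² (fromℚ² p) (centre 𝔻)) (radius 𝔻 D.* radius 𝔻)

  interior : ∀ 𝔻 p → Pos∞ (λ n → - power 𝔻 p n) → fromℚ² p ∈Interior 𝔻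
  interior 𝔻 p inside = Pos∞⇒< (dist² (fromℚ² p) (centre 𝔻)) (radius 𝔻 D.* radius 𝔻)
    (Pos∞-resp (λ n → e (seq (dist² (fromℚ² p) (centre 𝔻)) n) (seq (radius 𝔻 D.* radius 𝔻) n)) inside)
    where
    e : ∀ d r → - (d - r) ≡ r - d
    e = solve-∀ ring

  avoiding : ∀ 𝔻 p → ¬ fromℚ² p ∈Interior 𝔻 → NonNeg∞ (power 𝔻 p)
  avoiding 𝔻 p ¬inside = NonNeg∞-resp
    (λ n → e (seq (dist² (fromℚ² p) (centre 𝔻)) n) (seq (radius 𝔻 D.* radius 𝔻) n))
    (¬Pos∞⇒NonNeg∞ (radius 𝔻 D.* radius 𝔻 D.- dist² (fromℚ² p) (centre 𝔻))
      (λ above → ¬inside (Pos∞⇒< (dist² (fromℚ² p) (centre 𝔻)) (radius 𝔻 D.* radius 𝔻) above)))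
    where
    e : ∀ d r → - (r - d) ≡ d - r
    e = solve-∀ ring

  -- Half-angle vectors: `pt v` is the square of v as a complex number, so unit
  -- vectors v and - v stand for the same point of the unit circle.
  pt : ℚ² → ℚ²
  pt (a , b) = a * a - b * b , + 2 / 1 * (a * b)

  infixl 7 _⊗_
  _⊗_ : ℚ² → ℚ² → ℚ²
  (a , b) ⊗ (c , d) = a * c - b * d , a * d + b * c

  Unit : ℚ² → Set
  Unit (a , b) = a * a + b * b ≡ 1ℚ

  origin : ℚ²
  origin = 0ℚ , 0ℚ

  -- The disk in the half-plane coordinates that send pt v to 0, the centre of
  -- the unit circle to (0 , 1) and the circle to the x-axis.
  frame : Disk → ℚ² → Form
  frame 𝔻 v = record
    { A = λ n → 1ℚ + κ n + + 2 / 1 * a n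
    ; B = λ n → - (+ 4 / 1) * b n
    ; E = λ n → 1ℚ + κ n - + 2 / 1 * a n
    }
    where
    a b κ : Seq
    a n = seq (proj₁ (centre 𝔻)) n * proj₁ (pt v) + seq (proj₂ (centre 𝔻)) n * proj₂ (pt v)
    b n = seq (proj₂ (centre 𝔻)) n * proj₁ (pt v) - seq (proj₁ (centre 𝔻)) n * proj₂ (pt v)
    κ n = power 𝔻 origin n

  mirror : Form → Form
  mirror f = record { A = Form.A f ; B = λ n → - Form.B f n ; E = Form.E f }

  -- The form on the x-axis in homogeneous coordinates, with `x = s / c`. Unlike `value` it also
  -- covers the antipode of the contact point, which the chart sends to infinity.
  quad : Form → ℚ² → Seq
  quad f (c , s) n = Form.E f n * (c * c) + Form.B f n * (c * s) + Form.A f n * (s * s)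

  value-mirror : ∀ f x y n → value (mirror f) x y n ≡ value f (- x) y n
  value-mirror f x y n = e (Form.A f n) (Form.B f n) (Form.E f n) x y
    where
    e : ∀ A B E x y → A * (x * x + y * y) + (- B) * x + (A + E - + 4 / 1) * y + E
      ≡ A * ((- x) * (- x) + y * y) + B * (- x) + (A + E - + 4 / 1) * y + E
    e = solve-∀ ring

  quad-value : ∀ f c x n → quad f (c , c * x) n ≡ c * c * value f x 0ℚ n
  quad-value f c x n = e (Form.A f n) (Form.B f n) (Form.E f n) c x
    where
    e : ∀ A B E c x → E * (c * c) + B * (c * (c * x)) + A * (c * x * (c * x))
      ≡ c * c * (A * (x * x + 0ℚ * 0ℚ) + B * x + (A + E - + 4 / 1) * 0ℚ + E)
    e = solve-∀ ring

  power-circle : ∀ 𝔻 v w → Unit v → Unit w → ∀ n →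
    quad (frame 𝔻 v) w n ≡ power 𝔻 (pt (v ⊗ w)) n
  power-circle 𝔻 (p , q) (c , s) v-unit w-unit n =
    trans (e p q c s (seq (proj₁ (centre 𝔻)) n) (seq (proj₂ (centre 𝔻)) n) (seq (radius 𝔻) n))
      (trans (cong₂ (λ N M → power 𝔻 (pt ((p , q) ⊗ (c , s))) n + (1ℚ - N * N * (M * M))
                    + (1ℚ + power 𝔻 origin n) * (M - 1ℚ)) v-unit w-unit)
        (e′ (power 𝔻 (pt ((p , q) ⊗ (c , s))) n) (power 𝔻 origin n)))
    where
    e : ∀ p q c s x y r →
      (1ℚ + ((0ℚ - x) * (0ℚ - x) + (0ℚ - y) * (0ℚ - y) - r * r)
          - + 2 / 1 * (x * (p * p - q * q) + y * (+ 2 / 1 * (p * q)))) * (c * c)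
      + - (+ 4 / 1) * (y * (p * p - q * q) - x * (+ 2 / 1 * (p * q))) * (c * s)
      + (1ℚ + ((0ℚ - x) * (0ℚ - x) + (0ℚ - y) * (0ℚ - y) - r * r)
          + + 2 / 1 * (x * (p * p - q * q) + y * (+ 2 / 1 * (p * q)))) * (s * s)
      ≡ ((((p * c - q * s) * (p * c - q * s) - (p * s + q * c) * (p * s + q * c)) - x)
           * (((p * c - q * s) * (p * c - q * s) - (p * s + q * c) * (p * s + q * c)) - x)
         + (+ 2 / 1 * ((p * c - q * s) * (p * s + q * c)) - y)
           * (+ 2 / 1 * ((p * c - q * s) * (p * s + q * c)) - y) - r * r)
        + (1ℚ - (p * p + q * q) * (p * p + q * q) * ((c * c + s * s) * (c * c + s * s)))
        + (1ℚ + ((0ℚ - x) * (0ℚ - x) + (0ℚ - y) * (0ℚ - y) - r * r)) * ((c * c + s * s) - 1ℚ)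
    e = solve-∀ ring

    e′ : ∀ P k → P + (1ℚ - 1ℚ * 1ℚ * (1ℚ * 1ℚ)) + (1ℚ + k) * (1ℚ - 1ℚ) ≡ P
    e′ = solve-∀ ring

  power-origin : ∀ 𝔻 v n → + 4 / 1 * power 𝔻 origin n ≡ value (frame 𝔻 v) 0ℚ 1ℚ n
  power-origin 𝔻 v n = e (power 𝔻 origin n)
    (seq (proj₁ (centre 𝔻)) n * proj₁ (pt v) + seq (proj₂ (centre 𝔻)) n * proj₂ (pt v))
    (seq (proj₂ (centre 𝔻)) n * proj₁ (pt v) - seq (proj₁ (centre 𝔻)) n * proj₂ (pt v))
    where
    e : ∀ k a b → + 4 / 1 * k
      ≡ (1ℚ + k + + 2 / 1 * a) * (0ℚ * 0ℚ + 1ℚ * 1ℚ) + - (+ 4 / 1) * b * 0ℚ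
        + ((1ℚ + k + + 2 / 1 * a) + (1ℚ + k - + 2 / 1 * a) - + 4 / 1) * 1ℚ + (1ℚ + k - + 2 / 1 * a)
    e = solve-∀ ring

  module _ (x y : ℚ) (0<Q : 0ℚ < x * x + (1ℚ + y) * (1ℚ + y)) (v : ℚ²) (v-unit : Unit v) where

    private
      Q r : ℚ
      Q = x * x + (1ℚ + y) * (1ℚ + y)
      r = proj₁ (reciprocal Q 0<Q)

      Qr≡1 : Q * r ≡ 1ℚ
      Qr≡1 = proj₂ (proj₂ (reciprocal Q 0<Q))

    -- The inverse Cayley transform `(1 + i ζ) / (1 - i ζ)` of `ζ = x + i y`, rotated by `pt v`. Its
    -- squared denominator `Q` vanishes only at `(0 , - 1)`.
    witness : ℚ²
    witness = proj₁ (pt v) * ((1ℚ - (x * x + y * y)) * r) - proj₂ (pt v) * (+ 2 / 1 * x * r)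
            , proj₁ (pt v) * (+ 2 / 1 * x * r) + proj₂ (pt v) * ((1ℚ - (x * x + y * y)) * r)

    -- A frame is thus the power of a point with the denominator of the Cayley transform cleared,
    -- and since `Q` is positive the signs agree.
    power-witness : ∀ 𝔻 n → value (frame 𝔻 v) x y n ≡ Q * power 𝔻 witness n
    power-witness 𝔻 n = trans
      (e (proj₁ v) (proj₂ v) x y r (seq (proj₁ (centre 𝔻)) n) (seq (proj₂ (centre 𝔻)) n) (seq (radius 𝔻) n))
      (trans (cong₂ (λ N u → Q * power 𝔻 witness n
                + ((x * x + (1ℚ - y) * (1ℚ - y)) * (1ℚ - N * N * (u * u))
                - + 2 / 1 * ((1ℚ - u) * linear))) v-unit Qr≡1)
        (e′ (Q * power 𝔻 witness n) (x * x + (1ℚ - y) * (1ℚ - y)) linear))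
      where
      linear : ℚ
      linear = (seq (proj₁ (centre 𝔻)) n * proj₁ (pt v) + seq (proj₂ (centre 𝔻)) n * proj₂ (pt v))
               * (1ℚ - (x * x + y * y))
             + + 2 / 1 * ((seq (proj₂ (centre 𝔻)) n * proj₁ (pt v) - seq (proj₁ (centre 𝔻)) n * proj₂ (pt v)) * x)

      e : ∀ p q x y r c d ρ →
        (1ℚ + ((0ℚ - c) * (0ℚ - c) + (0ℚ - d) * (0ℚ - d) - ρ * ρ)
            + + 2 / 1 * (c * (p * p - q * q) + d * (+ 2 / 1 * (p * q)))) * (x * x + y * y)
        + - (+ 4 / 1) * (d * (p * p - q * q) - c * (+ 2 / 1 * (p * q))) * x
        + ((1ℚ + ((0ℚ - c) * (0ℚ - c) + (0ℚ - d) * (0ℚ - d) - ρ * ρ)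
              + + 2 / 1 * (c * (p * p - q * q) + d * (+ 2 / 1 * (p * q))))
            + (1ℚ + ((0ℚ - c) * (0ℚ - c) + (0ℚ - d) * (0ℚ - d) - ρ * ρ)
              - + 2 / 1 * (c * (p * p - q * q) + d * (+ 2 / 1 * (p * q)))) - + 4 / 1) * y
        + (1ℚ + ((0ℚ - c) * (0ℚ - c) + (0ℚ - d) * (0ℚ - d) - ρ * ρ)
            - + 2 / 1 * (c * (p * p - q * q) + d * (+ 2 / 1 * (p * q))))
        ≡ (x * x + (1ℚ + y) * (1ℚ + y))
          * (((((p * p - q * q) * ((1ℚ - (x * x + y * y)) * r) - + 2 / 1 * (p * q) * (+ 2 / 1 * x * r)) - c)
             * (((p * p - q * q) * ((1ℚ - (x * x + y * y)) * r) - + 2 / 1 * (p * q) * (+ 2 / 1 * x * r)) - c)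
            + (((p * p - q * q) * (+ 2 / 1 * x * r) + + 2 / 1 * (p * q) * ((1ℚ - (x * x + y * y)) * r)) - d)
             * (((p * p - q * q) * (+ 2 / 1 * x * r) + + 2 / 1 * (p * q) * ((1ℚ - (x * x + y * y)) * r)) - d))
            - ρ * ρ)
          + ((x * x + (1ℚ - y) * (1ℚ - y))
              * (1ℚ - (p * p + q * q) * (p * p + q * q)
                 * ((x * x + (1ℚ + y) * (1ℚ + y)) * r * ((x * x + (1ℚ + y) * (1ℚ + y)) * r)))
            - + 2 / 1 * ((1ℚ - (x * x + (1ℚ + y) * (1ℚ + y)) * r)
              * ((c * (p * p - q * q) + d * (+ 2 / 1 * (p * q))) * (1ℚ - (x * x + y * y))
                + + 2 / 1 * ((d * (p * p - q * q) - c * (+ 2 / 1 * (p * q))) * x))))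
      e = solve-∀ ring

      e′ : ∀ P a l → P + (a * (1ℚ - 1ℚ * 1ℚ * (1ℚ * 1ℚ)) - + 2 / 1 * ((1ℚ - 1ℚ) * l)) ≡ P
      e′ = solve-∀ ring

    private
      -power-witness : ∀ 𝔻 n → - value (frame 𝔻 v) x y n ≡ Q * - power 𝔻 witness n
      -power-witness 𝔻 n = trans (cong -_ (power-witness 𝔻 n)) (ℚ.neg-distribʳ-* Q (power 𝔻 witness n))

    witness-inside : ∀ 𝔻 → Pos∞ (λ n → - value (frame 𝔻 v) x y n) → fromℚ² witness ∈Interior 𝔻
    witness-inside 𝔻 below = interior 𝔻 witness (Pos∞-cancel 0<Q (Pos∞-resp (-power-witness 𝔻) below))

    witness-outside : ∀ 𝔻 → ¬ Pos∞ (λ n → - value (frame 𝔻 v) x y n) → NonNeg∞ (value (frame 𝔻 v) x y)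
    witness-outside 𝔻 ¬below = NonNeg∞-resp (λ n → sym (power-witness 𝔻 n))
      (NonNeg∞-* (0<⇒0≤ 0<Q) (avoiding 𝔻 witness λ inside → ¬below
        (Pos∞-resp (λ n → trans (cong (Q *_) (flip (seq (dist² (fromℚ² witness) (centre 𝔻)) n)
                                                   (seq (radius 𝔻 D.* radius 𝔻) n)))
                                 (sym (-power-witness 𝔻 n)))
          (Pos∞-* 0<Q (<⇒Pos∞ (dist² (fromℚ² witness) (centre 𝔻)) (radius 𝔻 D.* radius 𝔻) inside)))))
      where
      flip : ∀ d r → r - d ≡ - (d - r)
      flip = solve-∀ ring

  private
    0<Q-x : ∀ x y → 0ℚ < x → 0ℚ < x * x + (1ℚ + y) * (1ℚ + y)
    0<Q-x x y 0<x = 0<+≤ (0<* 0<x 0<x) (0≤sq (1ℚ + y))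

    0<Q-mirror : ∀ x y → 0ℚ < x → 0ℚ < - x * - x + (1ℚ + y) * (1ℚ + y)
    0<Q-mirror x y 0<x = 0<-subst (e x y) (0<Q-x x y 0<x)
      where
      e : ∀ x y → x * x + (1ℚ + y) * (1ℚ + y) ≡ - x * - x + (1ℚ + y) * (1ℚ + y)
      e = solve-∀ ring

    0<Q-y : ∀ x y → 0ℚ < y → 0ℚ < x * x + (1ℚ + y) * (1ℚ + y)
    0<Q-y x y 0<y = 0≤+< (0≤sq x) (0<* 0<1+y 0<1+y)
      where
      0<1+y : 0ℚ < 1ℚ + y
      0<1+y = 0<+ {1ℚ} 0<! 0<y

  module _ (v : ℚ²) (v-unit : Unit v) where

    disjoint-frames : ∀ 𝔻 𝔼 → InteriorDisjoint 𝔻 𝔼 → Disjoint (frame 𝔻 v) (frame 𝔼 v)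
    disjoint-frames 𝔻 𝔼 𝔻⊥𝔼 x y 0<x in𝔻 in𝔼 =
      𝔻⊥𝔼 (fromℚ² (witness x y (0<Q-x x y 0<x) v v-unit)) (witness-inside x y (0<Q-x x y 0<x) v v-unit 𝔻 in𝔻) (witness-inside x y (0<Q-x x y 0<x) v v-unit 𝔼 in𝔼)

    disjoint-mirrors : ∀ 𝔻 𝔼 → InteriorDisjoint 𝔻 𝔼 →
      Disjoint (mirror (frame 𝔻 v)) (mirror (frame 𝔼 v))
    disjoint-mirrors 𝔻 𝔼 𝔻⊥𝔼 x y 0<x in𝔻 in𝔼 = 𝔻⊥𝔼
      (fromℚ² (witness (- x) y (0<Q-mirror x y 0<x) v v-unit))
      (witness-inside (- x) y (0<Q-mirror x y 0<x) v v-unit 𝔻 (Pos∞-resp (λ n → cong -_ (value-mirror (frame 𝔻 v) x y n)) in𝔻))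
      (witness-inside (- x) y (0<Q-mirror x y 0<x) v v-unit 𝔼 (Pos∞-resp (λ n → cong -_ (value-mirror (frame 𝔼 v) x y n)) in𝔼))

    stable-frame : ∀ 𝔻 → Stable (frame 𝔻 v)
    stable-frame 𝔻 x y 0<y = witness-outside x y (0<Q-y x y 0<y) v v-unit 𝔻

    stable-mirror : ∀ 𝔻 → Stable (mirror (frame 𝔻 v))
    stable-mirror 𝔻 x y 0<y ¬below =
      NonNeg∞-resp (λ n → sym (value-mirror (frame 𝔻 v) x y n))
        (witness-outside (- x) y (0<Q-y (- x) y 0<y) v v-unit 𝔻 λ below → ¬below
          (Pos∞-resp (λ n → cong -_ (sym (value-mirror (frame 𝔻 v) x y n))) below))

-- Points on the circle and the disks touching two of them

module Rings where

  open Limits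
  open Forms
  open ThreeDisks
  open Frames
  open import Defs as D using (Disk)
  open import Data.Empty using (⊥; ⊥-elim)
  open import Data.Integer.Base using (+_)
  open import Data.Nat.Base as ℕ using (ℕ; zero; suc)
  import Data.Nat.Properties as ℕ
  import Data.Nat.DivMod as ℕ
  open import Data.Product.Base using (_×_; _,_; proj₁; proj₂)
  open import Data.Rational.Base
  import Data.Rational.Properties as ℚ
  open import Data.Sum.Base using (_⊎_; inj₁; inj₂)
  open import Relation.Binary.PropositionalEquality
    using (_≡_; refl; sym; trans; cong; cong₂; subst)
  open import Relation.Nullary using (yes; no)
  open import Tactic.RingSolver using (solve-∀)

  conj : ℚ² → ℚ²
  conj (a , b) = a , - b

  -ᵥ_ : ℚ² → ℚ²
  -ᵥ (a , b) = - a , - b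

  ⊗-assoc : ∀ u v w → (u ⊗ v) ⊗ w ≡ u ⊗ (v ⊗ w)
  ⊗-assoc (a , b) (c , d) (e , f) = cong₂ _,_ (re a b c d e f) (im a b c d e f)
    where
    re : ∀ a b c d e f → (a * c - b * d) * e - (a * d + b * c) * f
      ≡ a * (c * e - d * f) - b * (c * f + d * e)
    re = solve-∀ ring

    im : ∀ a b c d e f → (a * c - b * d) * f + (a * d + b * c) * e
      ≡ a * (c * f + d * e) + b * (c * e - d * f)
    im = solve-∀ ring

  ⊗-identityʳ : ∀ v → v ⊗ (1ℚ , 0ℚ) ≡ v
  ⊗-identityʳ (a , b) = cong₂ _,_ (re a b) (im a b)
    where
    re : ∀ a b → a * 1ℚ - b * 0ℚ ≡ a
    re = solve-∀ ring

    im : ∀ a b → a * 0ℚ + b * 1ℚ ≡ b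
    im = solve-∀ ring

  ⊗-identityˡ : ∀ v → (1ℚ , 0ℚ) ⊗ v ≡ v
  ⊗-identityˡ (a , b) = cong₂ _,_ (re a b) (im a b)
    where
    re : ∀ a b → 1ℚ * a - 0ℚ * b ≡ a
    re = solve-∀ ring

    im : ∀ a b → 1ℚ * b + 0ℚ * a ≡ b
    im = solve-∀ ring

  conj-⊗ : ∀ u v → conj u ⊗ conj v ≡ conj (u ⊗ v)
  conj-⊗ (a , b) (c , d) = cong₂ _,_ (re a b c d) (im a b c d)
    where
    re : ∀ a b c d → a * c - (- b) * (- d) ≡ a * c - b * d
    re = solve-∀ ring

    im : ∀ a b c d → a * (- d) + (- b) * c ≡ - (a * d + b * c)
    im = solve-∀ ring

  ⊗-conj : ∀ v w → Unit w → (v ⊗ w) ⊗ conj w ≡ v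
  ⊗-conj (a , b) (c , d) w-unit = cong₂ _,_
    (trans (re a b c d) (trans (cong (a *_) w-unit) (ℚ.*-identityʳ a)))
    (trans (im a b c d) (trans (cong (b *_) w-unit) (ℚ.*-identityʳ b)))
    where
    re : ∀ a b c d → (a * c - b * d) * c - (a * d + b * c) * (- d) ≡ a * (c * c + d * d)
    re = solve-∀ ring

    im : ∀ a b c d → (a * c - b * d) * (- d) + (a * d + b * c) * c ≡ b * (c * c + d * d)
    im = solve-∀ ring

  -ᵥ-⊗ : ∀ v w → (-ᵥ v) ⊗ w ≡ -ᵥ (v ⊗ w)
  -ᵥ-⊗ (a , b) (c , d) = cong₂ _,_ (re a b c d) (im a b c d)
    where
    re : ∀ a b c d → (- a) * c - (- b) * d ≡ - (a * c - b * d)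
    re = solve-∀ ring

    im : ∀ a b c d → (- a) * d + (- b) * c ≡ - (a * d + b * c)
    im = solve-∀ ring

  pt-neg : ∀ v → pt (-ᵥ v) ≡ pt v
  pt-neg (a , b) = cong₂ _,_ (re a b) (im a b)
    where
    re : ∀ a b → (- a) * (- a) - (- b) * (- b) ≡ a * a - b * b
    re = solve-∀ ring

    im : ∀ a b → + 2 / 1 * ((- a) * (- b)) ≡ + 2 / 1 * (a * b)
    im = solve-∀ ring

  Unit-⊗ : ∀ v w → Unit v → Unit w → Unit (v ⊗ w)
  Unit-⊗ (a , b) (c , d) v-unit w-unit = trans (e a b c d) (cong₂ _*_ v-unit w-unit)
    where
    e : ∀ a b c d → (a * c - b * d) * (a * c - b * d) + (a * d + b * c) * (a * d + b * c)
      ≡ (a * a + b * b) * (c * c + d * d)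
    e = solve-∀ ring

  Unit-conj : ∀ v → Unit v → Unit (conj v)
  Unit-conj (a , b) v-unit = trans (e a b) v-unit
    where
    e : ∀ a b → a * a + (- b) * (- b) ≡ a * a + b * b
    e = solve-∀ ring

  Unit-one : Unit (1ℚ , 0ℚ)
  Unit-one = refl

  Unit-neg : ∀ v → Unit v → Unit (-ᵥ v)
  Unit-neg (a , b) v-unit = trans (e a b) v-unit
    where
    e : ∀ a b → (- a) * (- a) + (- b) * (- b) ≡ a * a + b * b
    e = solve-∀ ring

  -- `A` is the value of `quad` at the antipode `(0 , 1)` of the contact point. Touching gives
  -- `E = 0`, and avoiding the hub then gives `A ≥ 2`.
  pole-pos : ∀ f → Zero∞ (quad f (1ℚ , 0ℚ)) → NonNeg∞ (value f 0ℚ 1ℚ) → Pos∞ (Form.A f)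
  pole-pos f here hub = Pos∞-cancel {+ 2 / 1} 0<!
    (Pos∞-resp (λ n → e (Form.A f n) (Form.B f n) (Form.E f n))
      (Pos∞-+ (Pos∞-const {+ 4 / 1} 0<!) (NonNeg∞-+ hub (proj₁ (Zero∞-* (- (+ 2 / 1)) here)))))
    where
    e : ∀ A B E → + 4 / 1 + ((A * (0ℚ * 0ℚ + 1ℚ * 1ℚ) + B * 0ℚ + (A + E - + 4 / 1) * 1ℚ + E)
        + - (+ 2 / 1) * (E * (1ℚ * 1ℚ) + B * (1ℚ * 0ℚ) + A * (0ℚ * 0ℚ))) ≡ + 2 / 1 * A
    e = solve-∀ ring

  -- The sign of c tells on which side the shorter arc from (1 , 0) to (c , s)
  -- lies.  A disk through both that avoids the hub contains the interior of this
  -- arc, and thus a neighbour of (1 , 0).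
  no-skipping : ∀ f {c s C₊ S₊ C₋ S₋} → 0ℚ < s → 0ℚ < S₊ → 0ℚ < S₋ →
    0ℚ < s * C₊ - c * S₊ → 0ℚ < s * C₋ + c * S₋ →
    Zero∞ (quad f (1ℚ , 0ℚ)) → Zero∞ (quad f (c , s)) →
    NonNeg∞ (quad f (C₊ , S₊)) → NonNeg∞ (quad f (C₋ , - S₋)) →
    NonNeg∞ (value f 0ℚ 1ℚ) → ⊥
  no-skipping f {c} {s} {C₊} {S₊} {C₋} {S₋} 0<s 0<S₊ 0<S₋ 0<P₊ 0<P₋ here there next prev hub
    with ℚ.≤-total 0ℚ c
  ... | inj₁ 0≤c = Pos∞-NonNeg∞⇒⊥ (Pos∞-* (0<* (0<* 0<s 0<S₊) 0<P₊) (pole-pos f here hub))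
      (NonNeg∞-resp (λ n → e (Form.A f n) (Form.B f n) (Form.E f n) c s C₊ S₊)
        (NonNeg∞-+ (NonNeg∞-* (0≤* 0≤c (0<⇒0≤ 0<s)) next)
          (NonNeg∞-+ (proj₁ (Zero∞-* (- (S₊ * C₊)) there))
                     (proj₁ (Zero∞-* (S₊ * C₊ * (c * c) - c * s * (C₊ * C₊)) here)))))
    where
    e : ∀ A B E c s C S →
      c * s * (E * (C * C) + B * (C * S) + A * (S * S))
      + (- (S * C) * (E * (c * c) + B * (c * s) + A * (s * s))
        + (S * C * (c * c) - c * s * (C * C)) * (E * (1ℚ * 1ℚ) + B * (1ℚ * 0ℚ) + A * (0ℚ * 0ℚ)))
      ≡ - (s * S * (s * C - c * S) * A)
    e = solve-∀ ring
  ... | inj₂ c≤0 = Pos∞-NonNeg∞⇒⊥ (Pos∞-* (0<* (0<* 0<s 0<S₋) 0<P₋) (pole-pos f here hub))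
      (NonNeg∞-resp (λ n → e (Form.A f n) (Form.B f n) (Form.E f n) c s C₋ S₋)
        (NonNeg∞-+ (NonNeg∞-* (0≤* (ℚ.neg-antimono-≤ c≤0) (0<⇒0≤ 0<s)) prev)
          (NonNeg∞-+ (proj₁ (Zero∞-* (- (S₋ * C₋)) there))
                     (proj₁ (Zero∞-* (S₋ * C₋ * (c * c) + c * s * (C₋ * C₋)) here)))))
    where
    e : ∀ A B E c s C S →
      - c * s * (E * (C * C) + B * (C * - S) + A * (- S * - S))
      + (- (S * C) * (E * (c * c) + B * (c * s) + A * (s * s))
        + (S * C * (c * c) + c * s * (C * C)) * (E * (1ℚ * 1ℚ) + B * (1ℚ * 0ℚ) + A * (0ℚ * 0ℚ)))
      ≡ - (s * S * (s * C + c * S) * A)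
    e = solve-∀ ring

  power-of : ℚ² → ℕ → ℚ²
  power-of ω zero    = 1ℚ , 0ℚ
  power-of ω (suc j) = power-of ω j ⊗ ω

  -- The last gap, between the points M and 0, differs from the others.
  module Ring (M : ℕ) (ω : ℚ²) (ω-unit : Unit ω)
    (above : ∀ j → 1 ℕ.≤ j → j ℕ.≤ M → 0ℚ < proj₂ (power-of ω j))
    where

    m : ℕ
    m = suc M

    ω^ : ℕ → ℚ²
    ω^ = power-of ω

    -- The step that takes `ω^ M` to `- 1`. A full turn of the circle is a half-turn of half-angle
    -- vectors, and `pt` identifies `- 1` with `1`, so the points close up although `vec` changes
    -- sign.
    seam : ℚ²
    seam = -ᵥ conj (ω^ M)

    residue-step : ℕ → ℚ²
    residue-step r with r ℕ.≟ M
    ... | yes _ = seam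
    ... | no _  = ω

    step : ℕ → ℚ²
    step a = residue-step (a ℕ.% m)

    step-cases : ∀ {ℓ} (P : ℚ² → Set ℓ) → P seam → P ω → ∀ a → P (step a)
    step-cases P at-seam at-ω a = residue (a ℕ.% m)
      where
      residue : ∀ r → P (residue-step r)
      residue r with r ℕ.≟ M
      ... | yes _ = at-seam
      ... | no _  = at-ω

    vec : ℕ → ℚ²
    vec zero    = 1ℚ , 0ℚ
    vec (suc a) = vec a ⊗ step a

    ringPoint : ℕ → ℚ²
    ringPoint a = pt (vec a)

    ω^-unit : ∀ j → Unit (ω^ j)
    ω^-unit zero    = Unit-one
    ω^-unit (suc j) = Unit-⊗ (ω^ j) ω (ω^-unit j) ω-unit

    seam-unit : Unit seam
    seam-unit = Unit-neg (conj (ω^ M)) (Unit-conj (ω^ M) (ω^-unit M))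

    step-unit : ∀ a → Unit (step a)
    step-unit = step-cases Unit seam-unit ω-unit

    vec-unit : ∀ a → Unit (vec a)
    vec-unit zero    = Unit-one
    vec-unit (suc a) = Unit-⊗ (vec a) (step a) (vec-unit a) (step-unit a)

    ω^-+ : ∀ i d → ω^ (d ℕ.+ i) ≡ ω^ i ⊗ ω^ d
    ω^-+ i zero    = sym (⊗-identityʳ (ω^ i))
    ω^-+ i (suc d) = trans (cong (_⊗ ω) (ω^-+ i d)) (⊗-assoc (ω^ i) (ω^ d) ω)

    step-inner : ∀ a → a ℕ.< M → step a ≡ ω
    step-inner a a<M with a ℕ.% m ℕ.≟ M
    ... | yes a%m≡M = ⊥-elim (ℕ.<⇒≢ a<M (trans (sym (ℕ.m<n⇒m%n≡m (ℕ.m<n⇒m<1+n a<M))) a%m≡M))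
    ... | no _      = refl

    step-last : step M ≡ seam
    step-last with M ℕ.% m ℕ.≟ M
    ... | yes _      = refl
    ... | no M%m≢M = ⊥-elim (M%m≢M (ℕ.m<n⇒m%n≡m ℕ.≤-refl))

    vec-inner : ∀ a → a ℕ.≤ M → vec a ≡ ω^ a
    vec-inner zero    _   = refl
    vec-inner (suc a) a<M = cong₂ _⊗_ (vec-inner a (ℕ.<⇒≤ a<M)) (step-inner a a<M)

    step-periodic : ∀ a → step (a ℕ.+ m) ≡ step a
    step-periodic a = cong residue-step (ℕ.[m+n]%n≡m%n a m)

    vec-m : vec m ≡ -ᵥ (1ℚ , 0ℚ)
    vec-m = trans (cong₂ _⊗_ (vec-inner M ℕ.≤-refl) step-last) (e (ω^ M) (ω^-unit M))
      where
      e : ∀ w → Unit w → w ⊗ (-ᵥ conj w) ≡ -ᵥ (1ℚ , 0ℚ)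
      e (a , b) w-unit = cong₂ _,_ (trans (re a b) (cong -_ w-unit)) (im a b)
        where
        re : ∀ a b → a * - a - b * - (- b) ≡ - (a * a + b * b)
        re = solve-∀ ring

        im : ∀ a b → a * - (- b) + b * - a ≡ - 0ℚ
        im = solve-∀ ring

    vec-periodic : ∀ a → vec (a ℕ.+ m) ≡ -ᵥ vec a
    vec-periodic zero    = vec-m
    vec-periodic (suc a) = trans (cong₂ _⊗_ (vec-periodic a) (step-periodic a)) (-ᵥ-⊗ (vec a) (step a))

    ringPoint-periodic : ∀ a → ringPoint (a ℕ.+ m) ≡ ringPoint a
    ringPoint-periodic a = trans (cong pt (vec-periodic a)) (pt-neg (vec a))

    ringPoint-+* : ∀ a j → ringPoint (a ℕ.+ j ℕ.* m) ≡ ringPoint a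
    ringPoint-+* a zero    = cong ringPoint (ℕ.+-identityʳ a)
    ringPoint-+* a (suc j) = trans
      (cong ringPoint (trans (cong (a ℕ.+_) (ℕ.+-comm m (j ℕ.* m))) (sym (ℕ.+-assoc a (j ℕ.* m) m))))
      (trans (ringPoint-periodic (a ℕ.+ j ℕ.* m)) (ringPoint-+* a j))

    ringPoint-% : ∀ a → ringPoint (a ℕ.% m) ≡ ringPoint a
    ringPoint-% a = sym (trans (cong ringPoint (ℕ.m≡m%n+[m/n]*n a m)) (ringPoint-+* (a ℕ.% m) (a ℕ./ m)))

    record Avoids (𝔻 : Disk) : Set where
      field
        hub    : NonNeg∞ (power 𝔻 origin)
        points : ∀ a → NonNeg∞ (power 𝔻 (ringPoint a))

    open Avoids

    Touches : Disk → ℕ → Set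
    Touches 𝔻 a = Zero∞ (power 𝔻 (ringPoint a))

    via : ∀ 𝔻 v w u → v ⊗ w ≡ u → Unit v → Unit w → ∀ n →
      power 𝔻 (pt u) n ≡ quad (frame 𝔻 v) w n
    via 𝔻 v w u vw≡u v-unit w-unit n = trans (cong (λ p → power 𝔻 (pt p) n) (sym vw≡u))
      (sym (power-circle 𝔻 v w v-unit w-unit n))

    hub-value : ∀ 𝔻 v → NonNeg∞ (power 𝔻 origin) → NonNeg∞ (value (frame 𝔻 v) 0ℚ 1ℚ)
    hub-value 𝔻 v 0≤hub = NonNeg∞-resp (power-origin 𝔻 v) (NonNeg∞-* {+ 4 / 1} 0≤! 0≤hub)

    -- For `d ≥ 2` this is `no-skipping` in the frame at `i`. Its sign conditions are sines of sums
    -- of half-gaps: `d - 1` of them towards the next point and `d + 1` towards the previous one,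
    -- both covered by `above`. The exceptional pair of `0` and `M` consists of neighbours across
    -- the seam.
    adjacent : ∀ {𝔻} i d → 1 ℕ.≤ d → d ℕ.+ i ℕ.≤ M → Avoids 𝔻 → Touches 𝔻 i → Touches 𝔻 (d ℕ.+ i) →
      d ≡ 1 ⊎ (i ≡ 0 × d ≡ M)
    adjacent i (suc zero) _ _ _ _ _ = inj₁ refl
    adjacent {𝔻} i (suc (suc d)) _ i+d≤M avoids at-i at-j = far i i+d≤M at-i at-j
      where
      δ : ℕ
      δ = suc (suc d)

      δ≤M : δ ℕ.≤ M
      δ≤M = ℕ.m+n≤o⇒m≤o δ i+d≤M

      C S : ℚ
      C = proj₁ ω
      S = proj₂ ω

      0<S : 0ℚ < S
      0<S = 0<-subst (cong proj₂ (⊗-identityˡ ω)) (above 1 ℕ.≤-refl (ℕ.≤-trans (ℕ.s≤s ℕ.z≤n) δ≤M))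

      0<s : 0ℚ < proj₂ (ω^ δ)
      0<s = above δ (ℕ.s≤s ℕ.z≤n) δ≤M

      0<next : 0ℚ < proj₂ (ω^ δ) * C - proj₁ (ω^ δ) * S
      0<next = 0<-subst (trans (sym (cong proj₂ (⊗-conj (ω^ (suc d)) ω ω-unit)))
          (e (proj₁ (ω^ δ)) (proj₂ (ω^ δ)) C S))
        (above (suc d) (ℕ.s≤s ℕ.z≤n) (ℕ.<⇒≤ δ≤M))
        where
        e : ∀ c s C S → c * (- S) + s * C ≡ s * C - c * S
        e = solve-∀ ring

      at : ∀ v w a → v ⊗ w ≡ vec a → Unit v → Unit w → Touches 𝔻 a → Zero∞ (quad (frame 𝔻 v) w)
      at v w a vw≡a v-unit w-unit = Zero∞-resp (via 𝔻 v w (vec a) vw≡a v-unit w-unit)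

      off : ∀ v w a → v ⊗ w ≡ vec a → Unit v → Unit w → NonNeg∞ (quad (frame 𝔻 v) w)
      off v w a vw≡a v-unit w-unit = NonNeg∞-resp (via 𝔻 v w (vec a) vw≡a v-unit w-unit) (points avoids a)

      far : ∀ i → δ ℕ.+ i ℕ.≤ M → Touches 𝔻 i → Touches 𝔻 (δ ℕ.+ i) → δ ≡ 1 ⊎ (i ≡ 0 × δ ≡ M)
      far (suc i) j≤M at-i at-j = ⊥-elim (no-skipping (frame 𝔻 v) {proj₁ (ω^ δ)} {proj₂ (ω^ δ)} {C} {S} {C} {S}
        0<s 0<S 0<S 0<next 0<prev
        (at v (1ℚ , 0ℚ) (suc i) (⊗-identityʳ v) v-unit Unit-one at-i)
        (at v (ω^ δ) (δ ℕ.+ suc i) (sym (trans (vec-inner (δ ℕ.+ suc i) j≤M)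
              (trans (ω^-+ (suc i) δ) (cong (_⊗ ω^ δ) (sym v≡))))) v-unit (ω^-unit δ) at-j)
        (off v ω (suc (suc i)) (cong (v ⊗_) (sym (step-inner (suc i) i<M))) v-unit ω-unit)
        (off v (conj ω) i (trans (cong (λ s → (vec i ⊗ s) ⊗ conj ω) (step-inner i (ℕ.<⇒≤ i<M)))
          (⊗-conj (vec i) ω ω-unit)) v-unit (Unit-conj ω ω-unit))
        (hub-value 𝔻 v (hub avoids)))
        where
        v : ℚ²
        v = vec (suc i)

        v-unit : Unit v
        v-unit = vec-unit (suc i)

        i<M : suc i ℕ.< M
        i<M = ℕ.≤-trans (ℕ.s≤s (ℕ.m≤n+m (suc i) (suc d))) j≤M

        v≡ : v ≡ ω^ (suc i)
        v≡ = vec-inner (suc i) (ℕ.<⇒≤ i<M)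

        0<prev : 0ℚ < proj₂ (ω^ δ) * C + proj₁ (ω^ δ) * S
        0<prev = 0<-subst (ℚ.+-comm (proj₁ (ω^ δ) * S) (proj₂ (ω^ δ) * C))
          (above (suc δ) (ℕ.s≤s ℕ.z≤n)
            (ℕ.≤-trans (ℕ.≤-reflexive (sym (ℕ.+-suc 0 δ))) (ℕ.≤-trans (ℕ.s≤s (ℕ.m≤m+n δ i))
              (ℕ.≤-trans (ℕ.≤-reflexive (sym (ℕ.+-suc δ i))) j≤M))))
      far zero j≤M at-i at-j = seam-side (ℕ.m≤n⇒m<n∨m≡n δ≤M)
       where
       seam-side : δ ℕ.< M ⊎ δ ≡ M → δ ≡ 1 ⊎ (0 ≡ 0 × δ ≡ M)
       seam-side (inj₂ δ≡M) = inj₂ (refl , δ≡M)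
       -- The point before 0 is `M`, reached by `- ω^ M` from there, so the condition on that side
       -- becomes the sine of `M - δ` half-gaps.
       seam-side (inj₁ δ<M) = ⊥-elim (no-skipping (frame 𝔻 v) {proj₁ (ω^ δ)} {proj₂ (ω^ δ)} {C} {S}
        {C₋ = - proj₁ (ω^ M)} {S₋ = proj₂ (ω^ M)}
        0<s 0<S (above M (ℕ.≤-trans (ℕ.s≤s ℕ.z≤n) δ≤M) ℕ.≤-refl) 0<next 0<prev
        (at v (1ℚ , 0ℚ) 0 (⊗-identityʳ v) Unit-one Unit-one at-i)
        (at v (ω^ δ) (δ ℕ.+ 0) (trans (⊗-identityˡ (ω^ δ)) (sym (trans (vec-inner (δ ℕ.+ 0) j≤M) (cong ω^ (ℕ.+-identityʳ δ)))))
          Unit-one (ω^-unit δ) at-j)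
        (off v ω 1 (cong (v ⊗_) (sym (step-inner 0 (ℕ.≤-trans (ℕ.s≤s ℕ.z≤n) δ≤M)))) Unit-one ω-unit)
        (NonNeg∞-resp (λ n → sym (power-circle 𝔻 v (-ᵥ ω^ M) Unit-one (Unit-neg (ω^ M) (ω^-unit M)) n))
          (subst (λ p → NonNeg∞ (power 𝔻 p)) seam-point (points avoids M)))
        (hub-value 𝔻 v (hub avoids)))
        where
        v : ℚ²
        v = 1ℚ , 0ℚ

        seam-point : ringPoint M ≡ pt (v ⊗ (-ᵥ ω^ M))
        seam-point = trans (cong pt (vec-inner M ℕ.≤-refl))
          (trans (sym (pt-neg (ω^ M))) (cong pt (sym (⊗-identityˡ (-ᵥ ω^ M)))))

        0<prev : 0ℚ < proj₂ (ω^ δ) * - proj₁ (ω^ M) + proj₁ (ω^ δ) * proj₂ (ω^ M)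
        0<prev = 0<-subst (trans (cong proj₂ (sym (trans
              (cong (_⊗ conj (ω^ δ)) (trans (cong ω^ (sym (ℕ.m+[n∸m]≡n δ≤M))) (ω^-+ (M ℕ.∸ δ) δ)))
              (⊗-conj (ω^ (M ℕ.∸ δ)) (ω^ δ) (ω^-unit δ)))))
            (e (proj₁ (ω^ δ)) (proj₂ (ω^ δ)) (proj₁ (ω^ M)) (proj₂ (ω^ M))))
          (above (M ℕ.∸ δ) (ℕ.m<n⇒0<n∸m δ<M) (ℕ.m∸n≤m M δ))
          where
          e : ∀ c s C S → C * (- s) + S * c ≡ s * - C + c * S
          e = solve-∀ ring

-- The obstruction on either side of a contact point

module Neighbours where

  open Limits
  open Forms
  open Estimates using (tMax)
  open ThreeDisks
  open Frames
  open Rings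
  open import Defs as D using (InteriorDisjoint)
  open import Data.Empty using (⊥)
  open import Data.Integer.Base using (+_)
  open import Data.Nat.Base as ℕ using (ℕ; suc)
  import Data.Nat.Properties as ℕ
  open import Data.Product.Base using (_×_; _,_; proj₁; proj₂; ∃-syntax)
  open import Data.Rational.Base
  import Data.Rational.Properties as ℚ
  open import Relation.Binary.PropositionalEquality
    using (_≡_; refl; sym; trans; cong; cong₂; subst)
  open import Tactic.RingSolver using (solve-∀)

  -- Half-angle tangents are measured in units of `τ`. The positive factor `κ` enters `quad` only as
  -- the positive factor `κ * κ`, and thus does not affect signs.
  Along : ℚ → ℚ² → ℚ → Set
  Along τ w y = ∃[ κ ] (0ℚ < κ × w ≡ (κ , κ * (τ * y)))

  Along-⊗ : ∀ τ w γ y h z → Along τ w y → Along τ γ h → Sum τ y h z → Along τ (w ⊗ γ) z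
  Along-⊗ τ w γ y h z (κ , 0<κ , refl) (c , 0<c , refl) (sum 0<D zD≡y+h) =
    κ * c * (1ℚ - τ * τ * (y * h)) , 0<* (0<* 0<κ 0<c) 0<D
    , cong₂ _,_ (re κ c τ y h)
        (trans (im κ c τ y h) (trans (cong (κ * c * τ *_) (sym zD≡y+h)) (regroup κ c τ z (1ℚ - τ * τ * (y * h)))))
    where
    re : ∀ κ c τ y h → κ * c - κ * (τ * y) * (c * (τ * h)) ≡ κ * c * (1ℚ - τ * τ * (y * h))
    re = solve-∀ ring

    im : ∀ κ c τ y h → κ * (c * (τ * h)) + κ * (τ * y) * c ≡ κ * c * τ * (y + h)
    im = solve-∀ ring

    regroup : ∀ κ c τ z d → κ * c * τ * (z * d) ≡ κ * c * d * (τ * z)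
    regroup = solve-∀ ring

  quad-along : ∀ f κ x {w} → w ≡ (κ , κ * x) → ∀ n → quad f w n ≡ κ * κ * value f x 0ℚ n
  quad-along f κ x refl n = quad-value f κ x n

  Along-conj : ∀ τ w y → (a : Along τ w y) → conj w ≡ (proj₁ a , proj₁ a * - (τ * y))
  Along-conj τ w y (κ , _ , refl) = cong (κ ,_) (ℚ.neg-distribʳ-* κ (τ * y))

  module Sides (M : ℕ) (ω : ℚ²) (ω-unit : Unit ω)
    (above : ∀ j → 1 ℕ.≤ j → j ℕ.≤ M → 0ℚ < proj₂ (power-of ω j))
    (τ : ℚ) (0<τ : 0ℚ < τ) (t≤tMax : 0ℚ ≤ tMax - τ * τ)
    (gap : ∀ a → ∃[ h ] (GapRange h × Along τ (Ring.step M ω ω-unit above a) h))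
    where

    open Ring M ω ω-unit above
    open Avoids

    private
      gapSize : ℕ → ℚ
      gapSize a = proj₁ (gap a)

      gap-range : ∀ a → GapRange (gapSize a)
      gap-range a = proj₁ (proj₂ (gap a))

      gap-along : ∀ a → Along τ (step a) (gapSize a)
      gap-along a = proj₂ (proj₂ (gap a))

    module Frame (v : ℚ²) (v-unit : Unit v) where

      zero-forward : ∀ 𝔻 w y a → v ⊗ w ≡ vec a → Unit w → Along τ w y →
        Touches 𝔻 a → Zero∞ (value (frame 𝔻 v) (τ * y) 0ℚ)
      zero-forward 𝔻 w y a vw≡a w-unit (κ , 0<κ , w≡) touches = Zero∞-cancel (0<* 0<κ 0<κ)
        (Zero∞-resp (λ n → trans (via 𝔻 v w (vec a) vw≡a v-unit w-unit n)
          (quad-along (frame 𝔻 v) κ (τ * y) w≡ n)) touches)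

      nonNeg-forward : ∀ 𝔻 w y a → v ⊗ w ≡ vec a → Unit w → Along τ w y →
        Avoids 𝔻 → NonNeg∞ (value (frame 𝔻 v) (τ * y) 0ℚ)
      nonNeg-forward 𝔻 w y a vw≡a w-unit (κ , 0<κ , w≡) avoids = NonNeg∞-cancel (0<* 0<κ 0<κ)
        (NonNeg∞-resp (λ n → trans (via 𝔻 v w (vec a) vw≡a v-unit w-unit n)
          (quad-along (frame 𝔻 v) κ (τ * y) w≡ n)) (points avoids a))

      zero-backward : ∀ 𝔻 w y a → v ⊗ conj w ≡ vec a → Unit w → Along τ w y →
        Touches 𝔻 a → Zero∞ (value (frame 𝔻 v) (- (τ * y)) 0ℚ)
      zero-backward 𝔻 w y a vw≡a w-unit along touches = Zero∞-cancel (0<* (proj₁ (proj₂ along)) (proj₁ (proj₂ along)))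
        (Zero∞-resp (λ n → trans (via 𝔻 v (conj w) (vec a) vw≡a v-unit (Unit-conj w w-unit) n)
          (quad-along (frame 𝔻 v) (proj₁ along) (- (τ * y)) (Along-conj τ w y along) n)) touches)

      nonNeg-backward : ∀ 𝔻 w y a → v ⊗ conj w ≡ vec a → Unit w → Along τ w y →
        Avoids 𝔻 → NonNeg∞ (value (frame 𝔻 v) (- (τ * y)) 0ℚ)
      nonNeg-backward 𝔻 w y a vw≡a w-unit along avoids = NonNeg∞-cancel (0<* (proj₁ (proj₂ along)) (proj₁ (proj₂ along)))
        (NonNeg∞-resp (λ n → trans (via 𝔻 v (conj w) (vec a) vw≡a v-unit (Unit-conj w w-unit) n)
          (quad-along (frame 𝔻 v) (proj₁ along) (- (τ * y)) (Along-conj τ w y along) n)) (points avoids a))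

      zero-contact : ∀ 𝔻 a → v ≡ vec a → Touches 𝔻 a → Zero∞ (value (frame 𝔻 v) 0ℚ 0ℚ)
      zero-contact 𝔻 a v≡a touches = Zero∞-resp
        (λ n → trans (via 𝔻 v (1ℚ , 0ℚ) (vec a) (trans (⊗-identityʳ v) v≡a) v-unit Unit-one n)
          (trans (quad-along (frame 𝔻 v) 1ℚ 0ℚ refl n) (ℚ.*-identityˡ _))) touches

      zero-hub : ∀ 𝔻 → Zero∞ (power 𝔻 origin) → Zero∞ (value (frame 𝔻 v) 0ℚ 1ℚ)
      zero-hub 𝔻 hub = Zero∞-resp (power-origin 𝔻 v) (Zero∞-* (+ 4 / 1) hub)

      mirror-zero : ∀ 𝔻 x y → Zero∞ (value (frame 𝔻 v) (- x) y) → Zero∞ (value (mirror (frame 𝔻 v)) x y)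
      mirror-zero 𝔻 x y = Zero∞-resp (λ n → sym (value-mirror (frame 𝔻 v) x y n))

      mirror-nonNeg : ∀ 𝔻 x y → NonNeg∞ (value (frame 𝔻 v) (- x) y) → NonNeg∞ (value (mirror (frame 𝔻 v)) x y)
      mirror-nonNeg 𝔻 x y = NonNeg∞-resp (λ n → sym (value-mirror (frame 𝔻 v) x y n))

    -- The contact point is `1 + a` because the point `a` behind it is needed as well: avoiding `a`
    -- limits how far the disk at the hub can lean backwards.
    no-forward-pairs : ∀ a 𝔻₀ 𝔻₁ 𝔻₂ → Avoids 𝔻₀ → Avoids 𝔻₁ → Avoids 𝔻₂ →
      InteriorDisjoint 𝔻₀ 𝔻₁ → InteriorDisjoint 𝔻₀ 𝔻₂ → InteriorDisjoint 𝔻₁ 𝔻₂ →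
      Zero∞ (power 𝔻₀ origin) → Touches 𝔻₀ (1 ℕ.+ a) →
      Touches 𝔻₁ (2 ℕ.+ a) → Touches 𝔻₁ (3 ℕ.+ a) →
      Touches 𝔻₂ (4 ℕ.+ a) → Touches 𝔻₂ (5 ℕ.+ a) → ⊥
    no-forward-pairs a 𝔻₀ 𝔻₁ 𝔻₂ avoids₀ avoids₁ avoids₂ 0⊥1 0⊥2 1⊥2 hub₀ at₁ at₂ at₃ at₄ at₅ =
      conclude (walk 0<τ t≤tMax (gap-range (1 ℕ.+ a)) (gap-range (2 ℕ.+ a)) (gap-range (3 ℕ.+ a)) (gap-range (4 ℕ.+ a)))
      where
      v s₁ s₂ s₃ s₄ w₂ w₃ w₄ : ℚ²
      v = vec (1 ℕ.+ a)
      s₁ = step (1 ℕ.+ a)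
      s₂ = step (2 ℕ.+ a)
      s₃ = step (3 ℕ.+ a)
      s₄ = step (4 ℕ.+ a)
      w₂ = s₁ ⊗ s₂
      w₃ = w₂ ⊗ s₃
      w₄ = w₃ ⊗ s₄

      v-unit : Unit v
      v-unit = vec-unit (1 ℕ.+ a)

      u₂ : Unit w₂
      u₂ = Unit-⊗ s₁ s₂ (step-unit (1 ℕ.+ a)) (step-unit (2 ℕ.+ a))

      u₃ : Unit w₃
      u₃ = Unit-⊗ w₂ s₃ u₂ (step-unit (3 ℕ.+ a))

      u₄ : Unit w₄
      u₄ = Unit-⊗ w₃ s₄ u₃ (step-unit (4 ℕ.+ a))

      vw₂ : v ⊗ w₂ ≡ vec (3 ℕ.+ a)
      vw₂ = sym (⊗-assoc v s₁ s₂)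

      vw₃ : v ⊗ w₃ ≡ vec (4 ℕ.+ a)
      vw₃ = trans (sym (⊗-assoc v w₂ s₃)) (cong (_⊗ s₃) vw₂)

      vw₄ : v ⊗ w₄ ≡ vec (5 ℕ.+ a)
      vw₄ = trans (sym (⊗-assoc v w₃ s₄)) (cong (_⊗ s₄) vw₃)

      open Frame v v-unit

      conclude : ∃[ y₂ ] ∃[ y₃ ] ∃[ y₄ ]
        (WalkTo₄ 0<τ t≤tMax (gapSize (1 ℕ.+ a)) (gapSize (2 ℕ.+ a)) (gapSize (3 ℕ.+ a)) (gapSize (4 ℕ.+ a)) y₂ y₃ y₄
          × Bounds 0<τ t≤tMax y₂ y₃ y₄) → ⊥
      conclude (y₂ , y₃ , y₄ , (sum₂ , sum₃ , sum₄) , bounds) =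
        no-three-disks 0<τ t≤tMax {gapSize a} {gapSize (1 ℕ.+ a)} {y₂} {y₃} {y₄}
          {frame 𝔻₀ v} {frame 𝔻₁ v} {frame 𝔻₂ v}
          (gap-range a) (gap-range (1 ℕ.+ a)) bounds
          (zero-contact 𝔻₀ (1 ℕ.+ a) refl at₁)
          (zero-hub 𝔻₀ hub₀)
          (nonNeg-backward 𝔻₀ (step a) (gapSize a) a (⊗-conj (vec a) (step a) (step-unit a)) (step-unit a) (gap-along a) avoids₀)
          (zero-forward 𝔻₁ s₁ (gapSize (1 ℕ.+ a)) (2 ℕ.+ a) refl (step-unit (1 ℕ.+ a)) (gap-along (1 ℕ.+ a)) at₂)
          (zero-forward 𝔻₁ w₂ y₂ (3 ℕ.+ a) vw₂ u₂ along₂ at₃)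
          (hub-value 𝔻₁ v (hub avoids₁))
          (zero-forward 𝔻₂ w₃ y₃ (4 ℕ.+ a) vw₃ u₃ along₃ at₄)
          (zero-forward 𝔻₂ w₄ y₄ (5 ℕ.+ a) vw₄ u₄ along₄ at₅)
          (hub-value 𝔻₂ v (hub avoids₂))
          (disjoint-frames v v-unit 𝔻₀ 𝔻₁ 0⊥1) (disjoint-frames v v-unit 𝔻₀ 𝔻₂ 0⊥2)
          (disjoint-frames v v-unit 𝔻₁ 𝔻₂ 1⊥2)
          (stable-frame v v-unit 𝔻₁) (stable-frame v v-unit 𝔻₂)
        where
        along₂ : Along τ w₂ y₂
        along₂ = Along-⊗ τ s₁ s₂ _ _ y₂ (gap-along (1 ℕ.+ a)) (gap-along (2 ℕ.+ a)) sum₂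

        along₃ : Along τ w₃ y₃
        along₃ = Along-⊗ τ w₂ s₃ y₂ _ y₃ along₂ (gap-along (3 ℕ.+ a)) sum₃

        along₄ : Along τ w₄ y₄
        along₄ = Along-⊗ τ w₃ s₄ y₃ _ y₄ along₃ (gap-along (4 ℕ.+ a)) sum₄

    -- The same argument for the mirrored frames at `4 + a`; the point that limits the leaning is
    -- now `5 + a`.
    no-backward-pairs : ∀ a 𝔻₀ 𝔻₁ 𝔻₂ → Avoids 𝔻₀ → Avoids 𝔻₁ → Avoids 𝔻₂ →
      InteriorDisjoint 𝔻₀ 𝔻₁ → InteriorDisjoint 𝔻₀ 𝔻₂ → InteriorDisjoint 𝔻₁ 𝔻₂ →
      Zero∞ (power 𝔻₀ origin) → Touches 𝔻₀ (4 ℕ.+ a) →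
      Touches 𝔻₁ (3 ℕ.+ a) → Touches 𝔻₁ (2 ℕ.+ a) →
      Touches 𝔻₂ (1 ℕ.+ a) → Touches 𝔻₂ a → ⊥
    no-backward-pairs a 𝔻₀ 𝔻₁ 𝔻₂ avoids₀ avoids₁ avoids₂ 0⊥1 0⊥2 1⊥2 hub₀ at₀ at₁ at₂ at₃ at₄ =
      conclude (walk 0<τ t≤tMax (gap-range (3 ℕ.+ a)) (gap-range (2 ℕ.+ a)) (gap-range (1 ℕ.+ a)) (gap-range a))
      where
      v s₁ s₂ s₃ s₄ w₂ w₃ w₄ : ℚ²
      v = vec (4 ℕ.+ a)
      s₁ = step (3 ℕ.+ a)
      s₂ = step (2 ℕ.+ a)
      s₃ = step (1 ℕ.+ a)
      s₄ = step a
      w₂ = s₁ ⊗ s₂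
      w₃ = w₂ ⊗ s₃
      w₄ = w₃ ⊗ s₄

      v-unit : Unit v
      v-unit = vec-unit (4 ℕ.+ a)

      u₂ : Unit w₂
      u₂ = Unit-⊗ s₁ s₂ (step-unit (3 ℕ.+ a)) (step-unit (2 ℕ.+ a))

      u₃ : Unit w₃
      u₃ = Unit-⊗ w₂ s₃ u₂ (step-unit (1 ℕ.+ a))

      u₄ : Unit w₄
      u₄ = Unit-⊗ w₃ s₄ u₃ (step-unit a)

      back : ∀ w b → v ⊗ conj w ≡ vec (suc b) → v ⊗ conj (w ⊗ step b) ≡ vec b
      back w b vw≡ = trans (cong (v ⊗_) (sym (conj-⊗ w (step b))))
        (trans (sym (⊗-assoc v (conj w) (conj (step b))))
          (trans (cong (_⊗ conj (step b)) vw≡) (⊗-conj (vec b) (step b) (step-unit b))))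

      vw₁ : v ⊗ conj s₁ ≡ vec (3 ℕ.+ a)
      vw₁ = ⊗-conj (vec (3 ℕ.+ a)) s₁ (step-unit (3 ℕ.+ a))

      vw₂ : v ⊗ conj w₂ ≡ vec (2 ℕ.+ a)
      vw₂ = back s₁ (2 ℕ.+ a) vw₁

      vw₃ : v ⊗ conj w₃ ≡ vec (1 ℕ.+ a)
      vw₃ = back w₂ (1 ℕ.+ a) vw₂

      vw₄ : v ⊗ conj w₄ ≡ vec a
      vw₄ = back w₃ a vw₃

      open Frame v v-unit

      conclude : ∃[ y₂ ] ∃[ y₃ ] ∃[ y₄ ]
        (WalkTo₄ 0<τ t≤tMax (gapSize (3 ℕ.+ a)) (gapSize (2 ℕ.+ a)) (gapSize (1 ℕ.+ a)) (gapSize a) y₂ y₃ y₄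
          × Bounds 0<τ t≤tMax y₂ y₃ y₄) → ⊥
      conclude (y₂ , y₃ , y₄ , (sum₂ , sum₃ , sum₄) , bounds) =
        no-three-disks 0<τ t≤tMax {gapSize (4 ℕ.+ a)} {gapSize (3 ℕ.+ a)} {y₂} {y₃} {y₄}
          {mirror (frame 𝔻₀ v)} {mirror (frame 𝔻₁ v)} {mirror (frame 𝔻₂ v)}
          (gap-range (4 ℕ.+ a)) (gap-range (3 ℕ.+ a)) bounds
          (mirror-zero 𝔻₀ 0ℚ 0ℚ (zero-contact 𝔻₀ (4 ℕ.+ a) refl at₀))
          (mirror-zero 𝔻₀ 0ℚ 1ℚ (zero-hub 𝔻₀ hub₀))
          (mirror-nonNeg 𝔻₀ (- (τ * gapSize (4 ℕ.+ a))) 0ℚ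
            (subst (λ x → NonNeg∞ (value (frame 𝔻₀ v) x 0ℚ)) (double-neg (τ * gapSize (4 ℕ.+ a)))
              (nonNeg-forward 𝔻₀ (step (4 ℕ.+ a)) (gapSize (4 ℕ.+ a)) (5 ℕ.+ a) refl
                (step-unit (4 ℕ.+ a)) (gap-along (4 ℕ.+ a)) avoids₀)))
          (mirror-zero 𝔻₁ (τ * gapSize (3 ℕ.+ a)) 0ℚ
            (zero-backward 𝔻₁ s₁ (gapSize (3 ℕ.+ a)) (3 ℕ.+ a) vw₁ (step-unit (3 ℕ.+ a)) (gap-along (3 ℕ.+ a)) at₁))
          (mirror-zero 𝔻₁ (τ * y₂) 0ℚ (zero-backward 𝔻₁ w₂ y₂ (2 ℕ.+ a) vw₂ u₂ along₂ at₂))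
          (mirror-nonNeg 𝔻₁ 0ℚ 1ℚ (hub-value 𝔻₁ v (hub avoids₁)))
          (mirror-zero 𝔻₂ (τ * y₃) 0ℚ (zero-backward 𝔻₂ w₃ y₃ (1 ℕ.+ a) vw₃ u₃ along₃ at₃))
          (mirror-zero 𝔻₂ (τ * y₄) 0ℚ (zero-backward 𝔻₂ w₄ y₄ a vw₄ u₄ along₄ at₄))
          (mirror-nonNeg 𝔻₂ 0ℚ 1ℚ (hub-value 𝔻₂ v (hub avoids₂)))
          (disjoint-mirrors v v-unit 𝔻₀ 𝔻₁ 0⊥1) (disjoint-mirrors v v-unit 𝔻₀ 𝔻₂ 0⊥2)
          (disjoint-mirrors v v-unit 𝔻₁ 𝔻₂ 1⊥2)
          (stable-mirror v v-unit 𝔻₁) (stable-mirror v v-unit 𝔻₂)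
        where
        double-neg : ∀ x → x ≡ - (- x)
        double-neg = solve-∀ ring

        along₂ : Along τ w₂ y₂
        along₂ = Along-⊗ τ s₁ s₂ _ _ y₂ (gap-along (3 ℕ.+ a)) (gap-along (2 ℕ.+ a)) sum₂

        along₃ : Along τ w₃ y₃
        along₃ = Along-⊗ τ w₂ s₃ y₂ _ y₃ along₂ (gap-along (1 ℕ.+ a)) sum₃

        along₄ : Along τ w₄ y₄
        along₄ = Along-⊗ τ w₃ s₄ y₃ _ y₄ along₃ (gap-along a) sum₄

-- Powers of rational rotations

module Turns where

  open Limits
  open Estimates using (tMax)
  open Frames
  open Rings
  open import Data.Integer.Base as ℤ using (+_)
  import Data.Integer.Properties as ℤ
  open import Data.Nat.Base as ℕ using (ℕ; zero; suc)
  import Data.Nat.Properties as ℕ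
  open import Data.Product.Base using (_×_; _,_; proj₁; proj₂; ∃-syntax)
  open import Data.Rational.Base
  open import Data.Rational.Literals using (fromℤ)
  import Data.Rational.Properties as ℚ
  import Data.Rational.Unnormalised.Base as ℚᵘ
  import Data.Rational.Unnormalised.Properties as ℚᵘ
  open import Relation.Binary.PropositionalEquality
    using (_≡_; refl; sym; trans; cong; cong₂; subst)
  open import Tactic.RingSolver using (solve-∀)

  ⟦_⟧ : ℕ → ℚ
  ⟦ k ⟧ = fromℤ (+ k)

  ⟦⟧-* : ∀ j k → ⟦ j ℕ.* k ⟧ ≡ ⟦ j ⟧ * ⟦ k ⟧
  ⟦⟧-* j k = ℚ.toℚᵘ-injective (ℚᵘ.≃-sym (ℚᵘ.≃-trans (ℚ.toℚᵘ-homo-* ⟦ j ⟧ ⟦ k ⟧)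
    (ℚᵘ.*≡* (cong (ℤ._* + 1) (sym (ℤ.pos-* j k))))))

  ⟦suc⟧ : ∀ k → ⟦ suc k ⟧ ≡ 1ℚ + ⟦ k ⟧
  ⟦suc⟧ k = ℚ.toℚᵘ-injective (ℚᵘ.≃-sym (ℚᵘ.≃-trans (ℚ.toℚᵘ-homo-+ 1ℚ ⟦ k ⟧)
    (ℚᵘ.*≡* (cong (ℤ._* + 1) (cong (ℤ._+_ (+ 1)) (ℤ.*-identityʳ (+ k)))))))

  ⟦⟧-mono : ∀ {j k} → j ℕ.≤ k → 0ℚ ≤ ⟦ k ⟧ - ⟦ j ⟧
  ⟦⟧-mono {j} {k} j≤k = ≤⇒0≤ {⟦ j ⟧} {⟦ k ⟧} (*≤* (ℤ.*-monoʳ-≤-nonNeg (+ 1) (ℤ.+≤+ j≤k)))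

  0≤⟦⟧ : ∀ k → 0ℚ ≤ ⟦ k ⟧
  0≤⟦⟧ k = *≤* (ℤ.*-monoʳ-≤-nonNeg (+ 1) {+ 0} {+ k} (ℤ.+≤+ ℕ.z≤n))

  0<⟦suc⟧ : ∀ k → 0ℚ < ⟦ suc k ⟧
  0<⟦suc⟧ k = 0<-subst (sym (⟦suc⟧ k)) (0<+≤ {1ℚ} 0<! (0≤⟦⟧ k))

  ⊗-interchange : ∀ u v w x → (u ⊗ v) ⊗ (w ⊗ x) ≡ (u ⊗ w) ⊗ (v ⊗ x)
  ⊗-interchange (a , b) (c , d) (e , f) (g , h) = cong₂ _,_ (re a b c d e f g h) (im a b c d e f g h)
    where
    re : ∀ a b c d e f g h →
      (a * c - b * d) * (e * g - f * h) - (a * d + b * c) * (e * h + f * g)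
      ≡ (a * e - b * f) * (c * g - d * h) - (a * f + b * e) * (c * h + d * g)
    re = solve-∀ ring

    im : ∀ a b c d e f g h →
      (a * c - b * d) * (e * h + f * g) + (a * d + b * c) * (e * g - f * h)
      ≡ (a * e - b * f) * (c * h + d * g) + (a * f + b * e) * (c * g - d * h)
    im = solve-∀ ring

  power-⊗ : ∀ u v k → power-of (u ⊗ v) k ≡ power-of u k ⊗ power-of v k
  power-⊗ u v zero    = sym (⊗-identityʳ (1ℚ , 0ℚ))
  power-⊗ u v (suc k) = trans (cong (_⊗ (u ⊗ v)) (power-⊗ u v k))
    (⊗-interchange (power-of u k) (power-of v k) u v)

  module SmallAngle {c s θ : ℚ} (N : ℕ) (0<c : 0ℚ < c) (0≤s : 0ℚ ≤ s) (0≤θ : 0ℚ ≤ θ)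
    (s≤θc : 0ℚ ≤ θ * c - s) (small : 0ℚ ≤ 1ℚ - + 4 / 1 * (⟦ N ⟧ * ⟦ N ⟧ * (θ * θ))) where

    Slow : ℕ → ℚ × ℚ → Set
    Slow k (R , I) = 0ℚ < R × 0ℚ ≤ I × 0ℚ ≤ + 2 / 1 * (⟦ k ⟧ * θ) * R - I

    -- The tangent of the `k`-fold angle is bounded by `2 k θ`. The factor two leaves room for the
    -- convexity of the tangent: by its addition formula each step adds at most `2 θ` as long as
    -- `2 N θ ≤ 1`.
    slow : ∀ k → k ℕ.≤ N → Slow k (power-of (c , s) k)
    slow zero    _   = 0<! , 0≤! , 0≤-subst (e θ) (0≤! {0ℚ})
      where
      e : ∀ θ → 0ℚ ≡ + 2 / 1 * (0ℚ * θ) * 1ℚ - 0ℚ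
      e = solve-∀ ring
    slow (suc k) k<N = advance (power-of (c , s) k) (slow k (ℕ.<⇒≤ k<N))
      where
      K : ℚ
      K = ⟦ k ⟧

      small-K : 0ℚ ≤ 1ℚ - + 4 / 1 * ((1ℚ + K) * (1ℚ + K) * (θ * θ))
      small-K = 0≤-subst (e ⟦ N ⟧ (1ℚ + K) θ)
        (0≤+ small (0≤* {+ 4 / 1} 0≤! (0≤* (0≤sq θ)
          (0≤* gap (0≤+ (0≤⟦⟧ N) (0≤+ {1ℚ} 0≤! (0≤⟦⟧ k)))))))
        where
        gap : 0ℚ ≤ ⟦ N ⟧ - (1ℚ + K)
        gap = subst (λ z → 0ℚ ≤ ⟦ N ⟧ - z) (⟦suc⟧ k) (⟦⟧-mono k<N)

        e : ∀ N K θ → (1ℚ - + 4 / 1 * (N * N * (θ * θ))) + + 4 / 1 * (θ * θ * ((N - K) * (N + K)))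
          ≡ 1ℚ - + 4 / 1 * (K * K * (θ * θ))
        e = solve-∀ ring

      advance : ∀ w → Slow k w → Slow (suc k) (w ⊗ (c , s))
      advance (R , I) (0<R , 0≤I , I≤) = 0<R′ , 0≤+ (0≤* (0<⇒0≤ 0<R) 0≤s) (0≤* 0≤I (0<⇒0≤ 0<c))
        , subst (λ z → 0ℚ ≤ + 2 / 1 * (z * θ) * (R * c - I * s) - (R * s + I * c)) (sym (⟦suc⟧ k)) upper
        where
        0<R′ : 0ℚ < R * c - I * s
        0<R′ = 0<-subst (e R I c s K θ)
          (0<+≤ (0<* 0<c (0<* 0<R 0<1-))
            (0≤+ (0≤* (0<⇒0≤ 0<c) (0≤* 0≤θ I≤)) (0≤* 0≤I s≤θc)))
          where
          0<1- : 0ℚ < 1ℚ - + 2 / 1 * (K * (θ * θ))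
          0<1- = 0<-subst (e₁ K θ) (0<+≤ {½} 0<! (0≤+ (0≤* {½} 0≤! small-K)
            (0≤* {+ 2 / 1} 0≤! (0≤* (0≤sq θ) (0≤+ {1ℚ} 0≤! (0≤+ (0≤⟦⟧ k) (0≤sq K)))))))
            where
            e₁ : ∀ K θ → ½ + (½ * (1ℚ - + 4 / 1 * ((1ℚ + K) * (1ℚ + K) * (θ * θ)))
              + + 2 / 1 * (θ * θ * (1ℚ + (K + K * K)))) ≡ 1ℚ - + 2 / 1 * (K * (θ * θ))
            e₁ = solve-∀ ring

          e : ∀ R I c s K θ →
            c * (R * (1ℚ - + 2 / 1 * (K * (θ * θ))))
            + (c * (θ * (+ 2 / 1 * (K * θ) * R - I)) + I * (θ * c - s)) ≡ R * c - I * s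
          e = solve-∀ ring

        upper : 0ℚ ≤ + 2 / 1 * ((1ℚ + K) * θ) * (R * c - I * s) - (R * s + I * c)
        upper = 0≤-subst (e R I c s K θ)
          (0≤+ (0≤+ (0≤* (0≤* 0≤θ (0≤* (0<⇒0≤ 0<R) (0<⇒0≤ 0<c)))
                  (0≤+ small-K (0≤* {+ 4 / 1} 0≤! (0≤* 0≤1+K (0≤sq θ)))))
                (0≤* (0≤* {+ 2 / 1} 0≤! (0≤* 0≤1+K 0≤θ))
                  (0≤+ (0≤* (0≤* {+ 2 / 1} 0≤! (0≤* (0≤* (0≤⟦⟧ k) 0≤θ) (0<⇒0≤ 0<R))) s≤θc)
                       (0≤* I≤ 0≤s))))
               (0≤+ (0≤* (0<⇒0≤ 0<R) s≤θc) (0≤* I≤ (0<⇒0≤ 0<c))))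
          where
          0≤1+K : 0ℚ ≤ 1ℚ + K
          0≤1+K = 0≤+ {1ℚ} 0≤! (0≤⟦⟧ k)

          e : ∀ R I c s K θ →
            (θ * (R * c) * ((1ℚ - + 4 / 1 * ((1ℚ + K) * (1ℚ + K) * (θ * θ))) + + 4 / 1 * ((1ℚ + K) * (θ * θ)))
              + + 2 / 1 * ((1ℚ + K) * θ)
                * (+ 2 / 1 * (K * θ * R) * (θ * c - s) + (+ 2 / 1 * (K * θ) * R - I) * s))
            + (R * (θ * c - s) + (+ 2 / 1 * (K * θ) * R - I) * c)
            ≡ + 2 / 1 * ((1ℚ + K) * θ) * (R * c - I * s) - (R * s + I * c)
          e = solve-∀ ring

    slow-above : 0ℚ < s → ∀ k → 1 ℕ.≤ k → k ℕ.≤ N → 0ℚ < proj₂ (power-of (c , s) k)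
    slow-above 0<s (suc k) _ k<N = 0<+≤ (0<* (proj₁ (slow k (ℕ.<⇒≤ k<N))) 0<s)
      (0≤* (proj₁ (proj₂ (slow k (ℕ.<⇒≤ k<N)))) (0<⇒0≤ 0<c))

  -- Slightly above `tan (π / 346)`, about 0.0090800, so that 173 turns overshoot, and below
  -- 0.0090822, where the square of the half-angle tangent would reach `tMax`.
  pMax : ℚ
  pMax = + 9081 / 1000000

  private
    half-sq : ∀ p → 0ℚ < 1ℚ + p * p
    half-sq p = 0<+≤ {1ℚ} 0<! (0≤sq p)

    scale : ℚ → ℚ
    scale p = proj₁ (reciprocal (1ℚ + p * p) (half-sq p))

    0<scale : ∀ p → 0ℚ < scale p
    0<scale p = proj₁ (proj₂ (reciprocal (1ℚ + p * p) (half-sq p)))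

    scale-inverse : ∀ p → (1ℚ + p * p) * scale p ≡ 1ℚ
    scale-inverse p = proj₂ (proj₂ (reciprocal (1ℚ + p * p) (half-sq p)))

  -- p is the tangent of a quarter of the central angle of a gap.
  turn : ℚ → ℚ²
  turn p = (1ℚ - p * p) * scale p , + 2 / 1 * p * scale p

  turn-unit : ∀ p → Unit (turn p)
  turn-unit p = trans (e p (scale p)) (cong₂ _*_ (scale-inverse p) (scale-inverse p))
    where
    e : ∀ p r → (1ℚ - p * p) * r * ((1ℚ - p * p) * r) + + 2 / 1 * p * r * (+ 2 / 1 * p * r)
      ≡ (1ℚ + p * p) * r * ((1ℚ + p * p) * r)
    e = solve-∀ ring

  -- The rotation from `turn a` to `turn (a + e)`. By `power-⊗` the k-th powers of these two differ
  -- by the k-th power of the increment.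
  increment : ℚ → ℚ → ℚ²
  increment a e = conj (turn a) ⊗ turn (a + e)

  turn-increment : ∀ a e → turn a ⊗ increment a e ≡ turn (a + e)
  turn-increment a e = trans (sym (⊗-assoc (turn a) (conj (turn a)) (turn (a + e))))
    (trans (cong (_⊗ turn (a + e)) (conj-inverse (turn a) (turn-unit a))) (⊗-identityˡ (turn (a + e))))
    where
    conj-inverse : ∀ w → Unit w → w ⊗ conj w ≡ (1ℚ , 0ℚ)
    conj-inverse (c , s) w-unit = cong₂ _,_ (trans (re c s) w-unit) (im c s)
      where
      re : ∀ c s → c * c - s * (- s) ≡ c * c + s * s
      re = solve-∀ ring

      im : ∀ c s → c * (- s) + s * c ≡ 0ℚ
      im = solve-∀ ring

  module _ {a e : ℚ} (0≤a : 0ℚ ≤ a) (0<e : 0ℚ < e) (e<½ : 0ℚ ≤ ½ - e) where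

    private
      x r : ℚ
      x = 1ℚ + a * (a + e)
      r = scale a * scale (a + e)

      0<r : 0ℚ < r
      0<r = 0<* (0<scale a) (0<scale (a + e))

      re : proj₁ (increment a e) ≡ (x * x - e * e) * r
      re = id a e (scale a) (scale (a + e))
        where
        id : ∀ a e r r′ →
          (1ℚ - a * a) * r * ((1ℚ - (a + e) * (a + e)) * r′) - - (+ 2 / 1 * a * r) * (+ 2 / 1 * (a + e) * r′)
          ≡ ((1ℚ + a * (a + e)) * (1ℚ + a * (a + e)) - e * e) * (r * r′)
        id = solve-∀ ring

      im : proj₂ (increment a e) ≡ + 2 / 1 * x * e * r
      im = id a e (scale a) (scale (a + e))
        where
        id : ∀ a e r r′ →
          (1ℚ - a * a) * r * (+ 2 / 1 * (a + e) * r′) + - (+ 2 / 1 * a * r) * ((1ℚ - (a + e) * (a + e)) * r′)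
          ≡ + 2 / 1 * (1ℚ + a * (a + e)) * e * (r * r′)
        id = solve-∀ ring

      0≤x-1 : 0ℚ ≤ a * (a + e)
      0≤x-1 = 0≤* 0≤a (0≤+ 0≤a (0<⇒0≤ 0<e))

      0<1-e² : 0ℚ < 1ℚ - e * e
      0<1-e² = 0<-subst (id e) (0<+≤ {+ 3 / 4} 0<! (0≤* e<½ (0≤+ {½} 0≤! (0<⇒0≤ 0<e))))
        where
        id : ∀ e → + 3 / 4 + (½ - e) * (½ + e) ≡ 1ℚ - e * e
        id = solve-∀ ring

    increment-re : 0ℚ < proj₁ (increment a e)
    increment-re = 0<-subst (trans (id (a * (a + e)) e r) (sym re))
      (0<* (0<+≤ 0<1-e² (0≤* {+ 2 / 1 + a * (a + e)} (0≤+ {+ 2 / 1} 0≤! 0≤x-1) 0≤x-1)) 0<r)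
      where
      id : ∀ y e r → ((1ℚ - e * e) + (+ 2 / 1 + y) * y) * r ≡ ((1ℚ + y) * (1ℚ + y) - e * e) * r
      id = solve-∀ ring

    increment-im : 0ℚ < proj₂ (increment a e)
    increment-im = 0<-subst (sym im) (0<* (0<* (0<* {+ 2 / 1} 0<! (0<+≤ {1ℚ} 0<! 0≤x-1)) 0<e) 0<r)

    -- The slope is `2 x e / (x² - e²)` with `x ≥ 1`, hence at most `2 e / (1 - e²)`, and `e ≤ ½`
    -- brings this below `3 e`.
    increment-slope : 0ℚ ≤ + 3 / 1 * e * proj₁ (increment a e) - proj₂ (increment a e)
    increment-slope = 0≤-subst
      (trans (id (a * (a + e)) e r) (cong₂ (λ c s → + 3 / 1 * e * c - s) (sym re) (sym im)))
      (0≤* (0<⇒0≤ (0<* 0<e 0<r))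
        (0≤+ (0≤* {+ 4 / 1 + + 3 / 1 * (a * (a + e))} (0≤+ {+ 4 / 1} 0≤! (0≤* {+ 3 / 1} 0≤! 0≤x-1)) 0≤x-1) slack))
      where
      slack : 0ℚ ≤ 1ℚ - + 3 / 1 * (e * e)
      slack = 0≤-subst (id′ e) (0≤+ {+ 1 / 4} 0≤! (0≤* {+ 3 / 1} 0≤! (0≤* e<½ (0≤+ {½} 0≤! (0<⇒0≤ 0<e)))))
        where
        id′ : ∀ e → + 1 / 4 + + 3 / 1 * ((½ - e) * (½ + e)) ≡ 1ℚ - + 3 / 1 * (e * e)
        id′ = solve-∀ ring

      id : ∀ y e r → e * r * ((+ 4 / 1 + + 3 / 1 * y) * y + (1ℚ - + 3 / 1 * (e * e)))
        ≡ + 3 / 1 * e * (((1ℚ + y) * (1ℚ + y) - e * e) * r) - + 2 / 1 * (1ℚ + y) * e * r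
      id = solve-∀ ring

  module _ {p : ℚ} (0<p : 0ℚ < p) (p≤pMax : 0ℚ ≤ pMax - p) where

    private
      C S r : ℚ
      C = proj₁ (turn p)
      S = proj₂ (turn p)
      r = scale p

      0≤p : 0ℚ ≤ p
      0≤p = 0<⇒0≤ 0<p

      p²≤ : 0ℚ ≤ pMax * pMax - p * p
      p²≤ = 0≤-subst (id p pMax) (0≤* p≤pMax (0≤+ {pMax} 0≤! 0≤p))
        where
        id : ∀ p m → (m - p) * (m + p) ≡ m * m - p * p
        id = solve-∀ ring

      1-p² : 0ℚ < 1ℚ - p * p
      1-p² = 0<-subst (id (p * p) (pMax * pMax)) (0<+≤ {1ℚ - pMax * pMax} 0<! p²≤)
        where
        id : ∀ x m → (1ℚ - m) + (m - x) ≡ 1ℚ - x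
        id = solve-∀ ring

      r≥ : 0ℚ ≤ r - (1ℚ - p * p)
      r≥ = 0≤-subst (trans (id p r) (trans (cong (λ z → r - (1ℚ - p * p) * z) (scale-inverse p))
          (cong (λ z → r - z) (ℚ.*-identityʳ (1ℚ - p * p)))))
        (0≤* (0≤sq (p * p)) (0<⇒0≤ (0<scale p)))
        where
        id : ∀ p r → p * p * (p * p) * r ≡ r - (1ℚ - p * p) * ((1ℚ + p * p) * r)
        id = solve-∀ ring

    turn-re : 0ℚ ≤ C - + 3 / 4
    turn-re = 0≤-subst (id p r (pMax * pMax))
      (0≤+ (0≤* (0<⇒0≤ 1-p²) r≥) (0≤+ {+ 1 / 4 - + 2 / 1 * (pMax * pMax)} 0≤! (0≤+ (0≤* {+ 2 / 1} 0≤! p²≤) (0≤sq (p * p)))))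
      where
      id : ∀ p r m → (1ℚ - p * p) * (r - (1ℚ - p * p)) + ((+ 1 / 4 - + 2 / 1 * m) + (+ 2 / 1 * (m - p * p) + p * p * (p * p)))
        ≡ (1ℚ - p * p) * r - + 3 / 4
      id = solve-∀ ring

    turn-im : 0ℚ < S
    turn-im = 0<* (0<* {+ 2 / 1} 0<! 0<p) (0<scale p)

    turn-im-lower : 0ℚ ≤ S - p
    turn-im-lower = 0≤-subst (id p r (pMax * pMax))
      (0≤* 0≤p (0≤+ (0≤* {+ 2 / 1} 0≤! r≥) (0≤+ {1ℚ - + 2 / 1 * (pMax * pMax)} 0≤! (0≤* {+ 2 / 1} 0≤! p²≤))))
      where
      id : ∀ p r m → p * (+ 2 / 1 * (r - (1ℚ - p * p)) + ((1ℚ - + 2 / 1 * m) + + 2 / 1 * (m - p * p)))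
        ≡ + 2 / 1 * p * r - p
      id = solve-∀ ring

    turn-im-upper : 0ℚ ≤ + 1 / 8 - S
    turn-im-upper = 0≤-subst
        (trans (id p r pMax) (trans (cong (λ z → + 1 / 8 - + 2 / 1 * p * (r + (1ℚ - z))) (scale-inverse p)) (id′ p r)))
      (0≤+ {+ 1 / 8 - + 2 / 1 * pMax} 0≤! (0≤+ (0≤* {+ 2 / 1} 0≤! p≤pMax)
        (0≤* (0≤* {+ 2 / 1} 0≤! 0≤p) (0≤* (0≤sq p) (0<⇒0≤ (0<scale p))))))
      where
      id : ∀ p r m → (+ 1 / 8 - + 2 / 1 * m) + (+ 2 / 1 * (m - p) + + 2 / 1 * p * (p * p * r))
        ≡ + 1 / 8 - + 2 / 1 * p * (r + (1ℚ - (1ℚ + p * p) * r))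
      id = solve-∀ ring

      id′ : ∀ p r → + 1 / 8 - + 2 / 1 * p * (r + (1ℚ - 1ℚ)) ≡ + 1 / 8 - + 2 / 1 * p * r
      id′ = solve-∀ ring

    0<turn-re : 0ℚ < C
    0<turn-re = 0<* 1-p² (0<scale p)

    turn-tMax : 0ℚ ≤ tMax * (C * C) - S * S
    turn-tMax = 0≤-subst (id p r tMax (pMax * pMax))
      (0≤* (0≤sq r) (0≤+ {tMax - (+ 4 / 1 + + 2 / 1 * tMax) * (pMax * pMax)} 0≤!
        (0≤+ (0≤* {+ 4 / 1 + + 2 / 1 * tMax} 0≤! p²≤) (0≤* {tMax} 0≤! (0≤sq (p * p))))))
      where
      id : ∀ p r t m →
        r * r * ((t - (+ 4 / 1 + + 2 / 1 * t) * m) + ((+ 4 / 1 + + 2 / 1 * t) * (m - p * p) + t * (p * p * (p * p))))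
        ≡ t * ((1ℚ - p * p) * r * ((1ℚ - p * p) * r)) - + 2 / 1 * p * r * (+ 2 / 1 * p * r)
      id = solve-∀ ring

    turn-re-upper : 0ℚ ≤ 1ℚ - C
    turn-re-upper = 0≤-subst (trans (id p r) (cong (_- C) (scale-inverse p)))
      (0≤* (0≤* {+ 2 / 1} 0≤! (0≤sq p)) (0<⇒0≤ (0<scale p)))
      where
      id : ∀ p r → + 2 / 1 * (p * p) * r ≡ (1ℚ + p * p) * r - (1ℚ - p * p) * r
      id = solve-∀ ring

    turn-slope : 0ℚ ≤ + 3 / 1 * p * C - S
    turn-slope = 0≤-subst (id p r (pMax * pMax))
      (0≤* (0≤* 0≤p (0<⇒0≤ (0<scale p))) (0≤+ {1ℚ - + 3 / 1 * (pMax * pMax)} 0≤! (0≤* {+ 3 / 1} 0≤! p²≤)))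
      where
      id : ∀ p r m → p * r * ((1ℚ - + 3 / 1 * m) + + 3 / 1 * (m - p * p))
        ≡ + 3 / 1 * p * ((1ℚ - p * p) * r) - + 2 / 1 * p * r
      id = solve-∀ ring

  -- 10¹² (1 + pMax²) turn pMax is integral, so its 173rd power is computed exactly:
  -- 173 turns by pMax exceed a half-turn.
  private
    numerator : ℚ²
    numerator = + 999917535439 / 1 , + 18162000000 / 1

    numerator-173 : 0ℚ ≤ - proj₂ (power-of numerator 173)
    numerator-173 = 0≤!

    im-scaled : ∀ u κ w → u ≡ (κ , 0ℚ) → - proj₂ (u ⊗ w) ≡ κ * - proj₂ w
    im-scaled u κ w refl = id κ (proj₁ w) (proj₂ w)
      where
      id : ∀ κ c s → - (κ * s + 0ℚ * c) ≡ κ * - s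
      id = solve-∀ ring

  -- Scaling by the positive real `lam` multiplies the k-th power by a positive real, which leaves
  -- the sign of the imaginary part unchanged.
  turn-numerator : ∀ k → 0ℚ ≤ - proj₂ (power-of numerator k) → 0ℚ ≤ - proj₂ (power-of (turn pMax) k)
  turn-numerator k computed = 0≤-cancel (proj₁ (proj₂ scaled))
    (0≤-subst (trans (cong (λ w → - proj₂ w) (trans (cong (λ w → power-of w k) (sym integral))
        (power-⊗ (lam , 0ℚ) (turn pMax) k)))
        (im-scaled (power-of (lam , 0ℚ) k) (proj₁ scaled) (power-of (turn pMax) k) (proj₂ (proj₂ scaled))))
      computed)
    where
    lam : ℚ
    lam = + 1000000000000 / 1 * (1ℚ + pMax * pMax)

    real-power : ∀ l → 0ℚ < l → ∀ k → ∃[ κ ] (0ℚ < κ × power-of (l , 0ℚ) k ≡ (κ , 0ℚ))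
    real-power l 0<l zero    = 1ℚ , 0<! , refl
    real-power l 0<l (suc k) = extend (real-power l 0<l k)
      where
      extend : ∃[ κ ] (0ℚ < κ × power-of (l , 0ℚ) k ≡ (κ , 0ℚ)) →
        ∃[ κ ] (0ℚ < κ × power-of (l , 0ℚ) (suc k) ≡ (κ , 0ℚ))
      extend (κ , 0<κ , eq) = κ * l , 0<* 0<κ 0<l
        , trans (cong (_⊗ (l , 0ℚ)) eq) (cong₂ _,_ (re κ l) (zeros κ l))
        where
        re : ∀ κ l → κ * l - 0ℚ * 0ℚ ≡ κ * l
        re = solve-∀ ring

        zeros : ∀ κ l → κ * 0ℚ + 0ℚ * l ≡ 0ℚ
        zeros = solve-∀ ring

    scaled : ∃[ κ ] (0ℚ < κ × power-of (lam , 0ℚ) k ≡ (κ , 0ℚ))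
    scaled = real-power lam 0<! k

    integral : (lam , 0ℚ) ⊗ turn pMax ≡ numerator
    integral = cong₂ _,_
      (trans (re (+ 1000000000000 / 1) pMax (scale pMax))
        (cong (λ z → + 1000000000000 / 1 * (1ℚ - pMax * pMax) * z) (scale-inverse pMax)))
      (trans (im′ (+ 1000000000000 / 1) pMax (scale pMax))
        (cong (λ z → + 1000000000000 / 1 * (+ 2 / 1 * pMax) * z) (scale-inverse pMax)))
      where
      re : ∀ N p r → N * (1ℚ + p * p) * ((1ℚ - p * p) * r) - 0ℚ * (+ 2 / 1 * p * r)
        ≡ N * (1ℚ - p * p) * ((1ℚ + p * p) * r)
      re = solve-∀ ring

      im′ : ∀ N p r → N * (1ℚ + p * p) * (+ 2 / 1 * p * r) + 0ℚ * ((1ℚ - p * p) * r)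
        ≡ N * (+ 2 / 1 * p) * ((1ℚ + p * p) * r)
      im′ = solve-∀ ring

  turn-overshoot : 0ℚ ≤ - proj₂ (power-of (turn pMax) 173)
  turn-overshoot = turn-numerator 173 numerator-173

-- A rational gap size that almost closes the circle

module Closing where

  open Limits
  open Estimates using (tMax; gapMax)
  open ThreeDisks using (GapRange)
  open Frames
  open Rings
  open Neighbours using (Along)
  open Turns
  open import Data.Empty using (⊥-elim)
  open import Data.Integer.Base using (+_)
  open import Data.Nat.Base as ℕ using (ℕ; zero; suc)
  import Data.Nat.Properties as ℕ
  import Data.Nat.DivMod as ℕ
  open import Data.Product.Base using (Σ; _×_; _,_; proj₁; proj₂; ∃-syntax)
  open import Data.Rational.Base
  import Data.Rational.Properties as ℚ
  open import Data.Sum.Base using (_⊎_; inj₁; inj₂)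
  open import Relation.Binary.PropositionalEquality
    using (_≡_; refl; sym; trans; cong; cong₂; subst)
  open import Relation.Nullary using (yes; no)
  open import Tactic.RingSolver using (solve-∀)

  -- Turning (c , s) by (R , I), of slope at most Φ, crosses the negative axis, so
  -- (c , s) is already close to this axis.
  near-half-turn : ∀ {Φ c s R I} → 0ℚ < s → 0ℚ < R → 0ℚ ≤ I → 0ℚ ≤ Φ * R - I →
    0ℚ ≤ - (c * I + s * R) → 0ℚ < - c × 0ℚ ≤ Φ * - c - s
  near-half-turn {Φ} {c} {s} {R} {I} 0<s 0<R 0≤I I≤ΦR past = c<0
    , 0≤-cancel 0<R (0≤-subst (id c s R I Φ) (0≤+ past (0≤* I≤ΦR (0<⇒0≤ c<0))))
    where
    c<0 : 0ℚ < - c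
    c<0 with 0ℚ ℚ.<? - c
    ... | yes 0<-c = 0<-c
    ... | no ≮ = ⊥-elim (0<-0≤⇒⊥ (0≤+< (0≤* 0≤c 0≤I) (0<* 0<s 0<R)) past)
      where
      0≤c : 0ℚ ≤ c
      0≤c = 0≤-subst (double-neg c) (ℚ.neg-antimono-≤ (ℚ.≮⇒≥ ≮))
        where
        double-neg : ∀ x → - (- x) ≡ x
        double-neg = solve-∀ ring

    id : ∀ c s R I Φ → - (c * I + s * R) + (Φ * R - I) * - c ≡ R * (Φ * - c - s)
    id = solve-∀ ring

  module SeamGap {C S : ℚ} (ω-unit : Unit (C , S)) (0<C : 0ℚ < C) (0<S : 0ℚ < S) where

    τ : ℚ
    τ = S * proj₁ (reciprocal C 0<C)

    0<τ : 0ℚ < τ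
    0<τ = 0<* 0<S (proj₁ (proj₂ (reciprocal C 0<C)))

    Cτ≡S : C * τ ≡ S
    Cτ≡S = trans (id C S (proj₁ (reciprocal C 0<C)))
      (trans (cong (S *_) (proj₂ (proj₂ (reciprocal C 0<C)))) (ℚ.*-identityʳ S))
      where
      id : ∀ C S r → C * (S * r) ≡ S * (C * r)
      id = solve-∀ ring

    regular-along : Along τ (C , S) 1ℚ
    regular-along = C , 0<C , cong (C ,_) (trans (sym Cτ≡S) (cong (C *_) (sym (ℚ.*-identityʳ τ))))

    τ²≤ : ∀ {t} → 0ℚ ≤ t * (C * C) - S * S → 0ℚ ≤ t - τ * τ
    τ²≤ {t} bound = 0≤-cancel (0<* 0<C 0<C)
      (0≤-subst (trans (cong (λ z → t * (C * C) - z * z) (sym Cτ≡S)) (id C t τ)) bound)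
      where
      id : ∀ C t τ → t * (C * C) - C * τ * (C * τ) ≡ C * C * (t - τ * τ)
      id = solve-∀ ring

    -- The seam closes the remaining angle, whose tangent lies between τ and
    -- gapMax τ since (c , s) is almost - 1.
    seam-along : ∀ {c s Φ g} → 0ℚ < s → 0ℚ < - c → 0ℚ ≤ Φ * - c - s → 0ℚ < C - Φ * S →
      0ℚ ≤ (g - 1ℚ) → 0ℚ ≤ (g - 1ℚ) * S * (C - Φ * S) - Φ →
      ∃[ h ] ((0ℚ ≤ h - 1ℚ × 0ℚ ≤ g - h) × Along τ (-ᵥ conj ((c , s) ⊗ conj (C , S))) h)
    seam-along {c} {s} {Φ} {g} 0<s c<0 s≤ 0<C-ΦS 1≤g room = h , (lower , upper) , C′ , 0<C′
      , cong (C′ ,_) (trans (double-neg (c * - S + s * C)) S′≡)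
      where
      C′ S′ : ℚ
      C′ = - (c * C - s * - S)
      S′ = c * - S + s * C

      double-neg : ∀ x → - (- x) ≡ x
      double-neg = solve-∀ ring

      0<C′ : 0ℚ < C′
      0<C′ = 0<-subst (id c s C S Φ) (0<+≤ (0<* c<0 0<C-ΦS) (0≤* (0<⇒0≤ 0<S) s≤))
        where
        id : ∀ c s C S Φ → - c * (C - Φ * S) + S * (Φ * - c - s) ≡ - (c * C - s * - S)
        id = solve-∀ ring

      r : ℚ
      r = proj₁ (reciprocal (C′ * τ) (0<* 0<C′ 0<τ))

      h : ℚ
      h = S′ * r

      S′≡ : S′ ≡ C′ * (τ * h)
      S′≡ = sym (trans (id C′ τ S′ r)
        (trans (cong (S′ *_) (proj₂ (proj₂ (reciprocal (C′ * τ) (0<* 0<C′ 0<τ))))) (ℚ.*-identityʳ S′)))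
        where
        id : ∀ C τ S r → C * (τ * (S * r)) ≡ S * (C * τ * r)
        id = solve-∀ ring

      0<CC′τ : 0ℚ < C * (C′ * τ)
      0<CC′τ = 0<* 0<C (0<* 0<C′ 0<τ)

      S′C-C′S : S′ * C - C′ * S ≡ s
      S′C-C′S = trans (id c s C S) (trans (cong (s *_) ω-unit) (ℚ.*-identityʳ s))
        where
        id : ∀ c s C S → (c * - S + s * C) * C - - (c * C - s * - S) * S ≡ s * (C * C + S * S)
        id = solve-∀ ring

      lower : 0ℚ ≤ h - 1ℚ
      lower = 0≤-cancel 0<CC′τ (0≤-subst (trans (sym S′C-C′S)
          (trans (cong₂ (λ x y → x * C - C′ * y) S′≡ (sym Cτ≡S)) (id C C′ τ h))) (0<⇒0≤ 0<s))
        where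
        id : ∀ C C′ τ h → C′ * (τ * h) * C - C′ * (C * τ) ≡ C * (C′ * τ) * (h - 1ℚ)
        id = solve-∀ ring

      upper : 0ℚ ≤ g - h
      upper = 0≤-cancel 0<CC′τ (0≤-subst
          (trans (id′ c s C S Φ g) (trans (cong (λ z → (g - 1ℚ) * C′ * S - z) (sym S′C-C′S))
            (trans (cong₂ (λ x y → (g - 1ℚ) * C′ * y - (x * C - C′ * y)) S′≡ (sym Cτ≡S)) (id C C′ τ h g))))
          (0≤+ (0≤* (0<⇒0≤ c<0) room) (0≤+ (0≤* (0≤* 1≤g (0≤sq S)) s≤) s≤)))
        where
        id′ : ∀ c s C S Φ g →
          - c * ((g - 1ℚ) * S * (C - Φ * S) - Φ) + ((g - 1ℚ) * (S * S) * (Φ * - c - s) + (Φ * - c - s))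
          ≡ (g - 1ℚ) * - (c * C - s * - S) * S - s
        id′ = solve-∀ ring

        id : ∀ C C′ τ h g → (g - 1ℚ) * C′ * (C * τ) - (C′ * (τ * h) * C - C′ * (C * τ)) ≡ C * (C′ * τ) * (g - h)
        id = solve-∀ ring

  module Existence (M : ℕ) (172≤M : 172 ℕ.≤ M) where

    m : ℕ
    m = suc M

    -- Small enough for `SmallAngle`, since `2 m (3 pMin) = 3 / 8`, and still of order `1 / m`, so
    -- that gaps from `pMin` on dominate the error of the grid search.
    μ pMin : ℚ
    μ = ⟦ m ⟧
    pMin = proj₁ (reciprocal (+ 16 / 1 * μ) (0<* {+ 16 / 1} 0<! (0<⟦suc⟧ M)))

    -- For a good `p` even `m` half-gaps stay short of a half-turn, which makes the seam wider than
    -- the other gaps. `Bad` keeps the exponent of the failure because `near-half-turn` compares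
    -- that power at two consecutive grid points.
    Good Bad : ℚ → Set
    Good p = ∀ k → 1 ℕ.≤ k → k ℕ.≤ m → 0ℚ < proj₂ (power-of (turn p) k)
    Bad p = ∃[ k ] (1 ℕ.≤ k × k ℕ.≤ m × 0ℚ ≤ - proj₂ (power-of (turn p) k))

    private
      0<μ : 0ℚ < μ
      0<μ = 0<⟦suc⟧ M

      173≤μ : 0ℚ ≤ μ - ⟦ 173 ⟧
      173≤μ = ⟦⟧-mono (ℕ.s≤s 172≤M)

      0<pMin : 0ℚ < pMin
      0<pMin = proj₁ (proj₂ (reciprocal (+ 16 / 1 * μ) (0<* {+ 16 / 1} 0<! 0<μ)))

      16μpMin : + 16 / 1 * μ * pMin ≡ 1ℚ
      16μpMin = proj₂ (proj₂ (reciprocal (+ 16 / 1 * μ) (0<* {+ 16 / 1} 0<! 0<μ)))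

      pMin<pMax : 0ℚ < pMax - pMin
      pMin<pMax = 0<-cancel (0<* {+ 16 / 1} 0<! 0<μ)
        (0<-subst (trans (cong (λ z → (+ 16 / 1 * ⟦ 173 ⟧ * pMax - z) + + 16 / 1 * (μ - ⟦ 173 ⟧) * pMax) (sym 16μpMin))
                         (id μ pMin pMax ⟦ 173 ⟧))
          (0<+≤ {+ 16 / 1 * ⟦ 173 ⟧ * pMax - 1ℚ} 0<!
            (0≤* (0≤* {+ 16 / 1} 0≤! 173≤μ) (0≤! {pMax}))))
        where
        id : ∀ μ p P c → (+ 16 / 1 * c * P - + 16 / 1 * μ * p) + + 16 / 1 * (μ - c) * P
          ≡ + 16 / 1 * μ * (P - p)
        id = solve-∀ ring

      check : ∀ p N → (∀ k → 1 ℕ.≤ k → k ℕ.≤ N → 0ℚ < proj₂ (power-of (turn p) k))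
        ⊎ ∃[ k ] (1 ℕ.≤ k × k ℕ.≤ N × 0ℚ ≤ - proj₂ (power-of (turn p) k))
      check p zero = inj₁ λ { zero () _ ; (suc k) _ () }
      check p (suc N) = extend (check p N)
        where
        extend : _ ⊎ _ → _ ⊎ _
        extend (inj₂ (k , 1≤k , k≤N , bad)) = inj₂ (k , 1≤k , ℕ.m≤n⇒m≤1+n k≤N , bad)
        extend (inj₁ good) = decide (0ℚ ℚ.<? proj₂ (power-of (turn p) (suc N)))
          where
          decide : _ → _
          decide (no ≮) = inj₂ (suc N , ℕ.s≤s ℕ.z≤n , ℕ.≤-refl , ℚ.neg-antimono-≤ (ℚ.≮⇒≥ ≮))
          decide (yes 0<) = inj₁ λ k 1≤k k≤1+N → split k 1≤k (ℕ.m≤n⇒m<n∨m≡n k≤1+N)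
            where
            split : ∀ k → 1 ℕ.≤ k → k ℕ.< suc N ⊎ k ≡ suc N → 0ℚ < proj₂ (power-of (turn p) k)
            split k 1≤k (inj₁ k<1+N) = good k 1≤k (ℕ.s≤s⁻¹ k<1+N)
            split k _ (inj₂ refl) = 0<

      good-or-bad : ∀ p → Good p ⊎ Bad p
      good-or-bad p = check p m

      -- A discrete intermediate value theorem: goodness is a finite conjunction of rational
      -- inequalities and hence decidable, so the grid can be searched from its bad end.
      last-good : (p : ℕ → ℚ) → Good (p 0) → ∀ n → Bad (p n) →
        ∃[ i ] (i ℕ.< n × Good (p i) × Bad (p (suc i)))
      last-good p good zero (k , 1≤k , k≤m , bad) = ⊥-elim (0<-0≤⇒⊥ (good k 1≤k k≤m) bad)
      last-good p good (suc n) bad with good-or-bad (p n)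
      ... | inj₁ good-n = n , ℕ.≤-refl , good-n , bad
      ... | inj₂ bad-n  = let (i , i<n , found) = last-good p good n bad-n in
        i , ℕ.m<n⇒m<1+n i<n , found

      good-pMin : Good pMin
      good-pMin = SmallAngle.slow-above {proj₁ (turn pMin)} {proj₂ (turn pMin)} {+ 3 / 1 * pMin} m
        (0<turn-re 0<pMin (0<⇒0≤ pMin<pMax)) (0<⇒0≤ 0<S) (0≤* {+ 3 / 1} 0≤! (0<⇒0≤ 0<pMin))
        slope small 0<S
        where
        0<S : 0ℚ < proj₂ (turn pMin)
        0<S = turn-im 0<pMin (0<⇒0≤ pMin<pMax)

        small : 0ℚ ≤ 1ℚ - + 4 / 1 * (μ * μ * (+ 3 / 1 * pMin * (+ 3 / 1 * pMin)))
        small = 0≤-subst (trans (cong (λ z → 1ℚ - + 9 / 64 * (z * z)) (sym 16μpMin)) (id μ pMin)) (0≤! {+ 55 / 64})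
          where
          id : ∀ μ p → 1ℚ - + 9 / 64 * (+ 16 / 1 * μ * p * (+ 16 / 1 * μ * p))
            ≡ 1ℚ - + 4 / 1 * (μ * μ * (+ 3 / 1 * p * (+ 3 / 1 * p)))
          id = solve-∀ ring

        slope : 0ℚ ≤ + 3 / 1 * pMin * proj₁ (turn pMin) - proj₂ (turn pMin)
        slope = turn-slope 0<pMin (0<⇒0≤ pMin<pMax)

      -- One step on a grid of 250000 m² points turns the m-th power by less than
      -- gapMax - 1 gaps.
      gridSize : ∃[ n ] (⟦ n ⟧ ≡ + 250000 / 1 * (μ * μ))
      gridSize = multiple 250000 refl
        where
        multiple : ∀ N {q} → ⟦ N ⟧ ≡ q → ∃[ n ] (⟦ n ⟧ ≡ q * (μ * μ))
        multiple N refl = N ℕ.* (m ℕ.* m)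
          , trans (⟦⟧-* N (m ℕ.* m)) (cong (⟦ N ⟧ *_) (⟦⟧-* m m))

      0<grid : 0ℚ < + 250000 / 1 * (μ * μ)
      0<grid = 0<* {+ 250000 / 1} 0<! (0<* 0<μ 0<μ)

      1/grid e : ℚ
      1/grid = proj₁ (reciprocal (+ 250000 / 1 * (μ * μ)) 0<grid)
      e = (pMax - pMin) * 1/grid

      grid-inverse : + 250000 / 1 * (μ * μ) * 1/grid ≡ 1ℚ
      grid-inverse = proj₂ (proj₂ (reciprocal (+ 250000 / 1 * (μ * μ)) 0<grid))

      0<e : 0ℚ < e
      0<e = 0<* pMin<pMax (proj₁ (proj₂ (reciprocal (+ 250000 / 1 * (μ * μ)) 0<grid)))

      grid-e : + 250000 / 1 * (μ * μ) * e ≡ pMax - pMin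
      grid-e = trans (id (+ 250000 / 1 * (μ * μ)) (pMax - pMin) 1/grid)
        (trans (cong ((pMax - pMin) *_) grid-inverse) (ℚ.*-identityʳ (pMax - pMin)))
        where
        id : ∀ g w r → g * (w * r) ≡ w * (g * r)
        id = solve-∀ ring

      point : ℕ → ℚ
      point zero    = pMin
      point (suc i) = point i + e

      point-≡ : ∀ i → point i ≡ pMin + ⟦ i ⟧ * e
      point-≡ zero    = id pMin e
        where
        id : ∀ p e → p ≡ p + 0ℚ * e
        id = solve-∀ ring
      point-≡ (suc i) = trans (cong (_+ e) (point-≡ i))
        (trans (id pMin ⟦ i ⟧ e) (cong (λ z → pMin + z * e) (sym (⟦suc⟧ i))))
        where
        id : ∀ p i e → p + i * e + e ≡ p + (1ℚ + i) * e
        id = solve-∀ ring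

      point-grid : ∀ n → ⟦ n ⟧ ≡ + 250000 / 1 * (μ * μ) → point n ≡ pMax
      point-grid n n≡ = trans (point-≡ n) (trans (cong (λ z → pMin + z * e) n≡)
        (trans (cong (λ z → pMin + z) grid-e) (id pMin pMax)))
        where
        id : ∀ p P → p + (P - p) ≡ P
        id = solve-∀ ring

      point-lower : ∀ i → 0ℚ ≤ point i - pMin
      point-lower i = 0≤-subst (trans (id pMin (⟦ i ⟧ * e)) (cong (_- pMin) (sym (point-≡ i))))
        (0≤* (0≤⟦⟧ i) (0<⇒0≤ 0<e))
        where
        id : ∀ p x → x ≡ p + x - p
        id = solve-∀ ring

      point-mono : ∀ {i n} → i ℕ.≤ n → 0ℚ ≤ point n - point i
      point-mono {i} {n} i≤n = 0≤-subst
        (trans (id pMin ⟦ n ⟧ ⟦ i ⟧ e) (cong₂ _-_ (sym (point-≡ n)) (sym (point-≡ i))))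
        (0≤* (⟦⟧-mono i≤n) (0<⇒0≤ 0<e))
        where
        id : ∀ p n i e → (n - i) * e ≡ p + n * e - (p + i * e)
        id = solve-∀ ring

      -- The slope bound `2 m (3 e)` that `SmallAngle` with `θ = 3 e` gives for powers of one grid
      -- increment up to the m-th. The grid size brings `m Φ` below `1 / 4000000`.
      Φ : ℚ
      Φ = + 6 / 1 * (μ * e)

      0≤Φ : 0ℚ ≤ Φ
      0≤Φ = 0≤* {+ 6 / 1} 0≤! (0≤* (0<⇒0≤ 0<μ) (0<⇒0≤ 0<e))

      1≤μ : 0ℚ ≤ μ - 1ℚ
      1≤μ = ⟦⟧-mono {1} {m} (ℕ.s≤s ℕ.z≤n)

      μΦ≤ : 0ℚ ≤ + 1 / 4000000 - μ * Φ
      μΦ≤ = 0≤-subst (trans (cong (λ z → + 1 / 4000000 - + 6 / 250000 * z) (sym grid-e)) (id μ e))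
        (0≤-subst (id′ pMin pMax) (0≤+ {+ 1 / 4000000 - + 6 / 250000 * pMax} 0≤! (0≤* {+ 6 / 250000} 0≤! (0<⇒0≤ 0<pMin))))
        where
        id : ∀ μ e → + 1 / 4000000 - + 6 / 250000 * (+ 250000 / 1 * (μ * μ) * e)
          ≡ + 1 / 4000000 - μ * (+ 6 / 1 * (μ * e))
        id = solve-∀ ring

        id′ : ∀ p P → + 1 / 4000000 - + 6 / 250000 * P + + 6 / 250000 * p
          ≡ + 1 / 4000000 - + 6 / 250000 * (P - p)
        id′ = solve-∀ ring

      Φ≤ : 0ℚ ≤ + 1 / 4000000 - Φ
      Φ≤ = 0≤-subst (id μ Φ) (0≤+ μΦ≤ (0≤* 1≤μ 0≤Φ))
        where
        id : ∀ μ Φ → (+ 1 / 4000000 - μ * Φ) + (μ - 1ℚ) * Φ ≡ + 1 / 4000000 - Φ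
        id = solve-∀ ring

      e≤ : 0ℚ ≤ ½ - e
      e≤ = 0≤-subst (id μ e) (0≤+ {½ - + 1 / 24000000} 0≤!
        (0≤+ (0≤* {+ 1 / 6} 0≤! Φ≤) (0≤* 1≤μ (0<⇒0≤ 0<e))))
        where
        id : ∀ μ e → (½ - + 1 / 24000000) + (+ 1 / 6 * (+ 1 / 4000000 - + 6 / 1 * (μ * e)) + (μ - 1ℚ) * e) ≡ ½ - e
        id = solve-∀ ring

      small-increment : 0ℚ ≤ 1ℚ - + 4 / 1 * (μ * μ * (+ 3 / 1 * e * (+ 3 / 1 * e)))
      small-increment = 0≤-subst (id μ e)
        (0≤* (0≤+ {1ℚ - + 1 / 4000000} 0≤! Φ≤) (0≤+ {1ℚ} 0≤! 0≤Φ))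
        where
        id : ∀ μ e → ((1ℚ - + 1 / 4000000) + (+ 1 / 4000000 - + 6 / 1 * (μ * e))) * (1ℚ + + 6 / 1 * (μ * e))
          ≡ 1ℚ - + 4 / 1 * (μ * μ * (+ 3 / 1 * e * (+ 3 / 1 * e)))
        id = solve-∀ ring

    -- Some power lies within slope `Φ` of the negative axis: one more grid step would carry it
    -- across.
    Past : ℚ → Set
    Past p = ∃[ k ] (1 ℕ.≤ k × k ℕ.≤ m × 0ℚ < - proj₁ (power-of (turn p) k)
      × 0ℚ ≤ Φ * - proj₁ (power-of (turn p) k) - proj₂ (power-of (turn p) k))

    Gap : Set
    Gap = ∃[ p ] (0ℚ < p × 0ℚ ≤ p - pMin × 0ℚ ≤ pMax - p × Good p × Past p)

    gap : Gap
    gap = find (proj₁ gridSize) (proj₂ gridSize)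
      where
      find : ∀ n → ⟦ n ⟧ ≡ + 250000 / 1 * (μ * μ) → Gap
      find n n≡ = build (last-good point good-pMin n (subst Bad (sym (point-grid n n≡))
          (173 , ℕ.s≤s ℕ.z≤n , ℕ.s≤s 172≤M , turn-overshoot)))
        where
        build : ∃[ i ] (i ℕ.< n × Good (point i) × Bad (point (suc i))) → Gap
        build (i , i<n , good-i , k , 1≤k , k≤m , bad) = a , 0<a , point-lower i
          , subst (λ z → 0ℚ ≤ z - a) (point-grid n n≡) (point-mono (ℕ.<⇒≤ i<n))
          , good-i
          , k , 1≤k , k≤m , near-half-turn {Φ} {c} {s} {R} {I} (good-i k 1≤k k≤m) (proj₁ sl) (proj₁ (proj₂ sl)) I≤
              (0≤-subst (cong (λ w → - proj₂ w)
                (trans (cong (λ w → power-of w k) (sym (turn-increment a e))) (power-⊗ (turn a) (increment a e) k))) bad)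
          where
          a : ℚ
          a = point i

          0<a : 0ℚ < a
          0<a = 0<-subst (id pMin a) (0<+≤ 0<pMin (point-lower i))
            where
            id : ∀ p a → p + (a - p) ≡ a
            id = solve-∀ ring

          0≤a : 0ℚ ≤ a
          0≤a = 0<⇒0≤ 0<a

          c s R I : ℚ
          c = proj₁ (power-of (turn a) k)
          s = proj₂ (power-of (turn a) k)
          R = proj₁ (power-of (increment a e) k)
          I = proj₂ (power-of (increment a e) k)

          sl : 0ℚ < R × 0ℚ ≤ I × 0ℚ ≤ + 2 / 1 * (⟦ k ⟧ * (+ 3 / 1 * e)) * R - I
          sl = SmallAngle.slow {proj₁ (increment a e)} {proj₂ (increment a e)} {+ 3 / 1 * e} m
            (increment-re {a} {e} 0≤a 0<e e≤) (0<⇒0≤ (increment-im {a} {e} 0≤a 0<e e≤))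
            (0≤* {+ 3 / 1} 0≤! (0<⇒0≤ 0<e)) (increment-slope {a} {e} 0≤a 0<e e≤) small-increment k k≤m

          I≤ : 0ℚ ≤ Φ * R - I
          I≤ = 0≤-subst (id μ ⟦ k ⟧ e R I)
            (0≤+ (proj₂ (proj₂ sl)) (0≤* (0≤* {+ 6 / 1} 0≤! (0≤* (⟦⟧-mono k≤m) (0<⇒0≤ 0<e))) (0<⇒0≤ (proj₁ sl))))
            where
            id : ∀ μ k e R I → (+ 2 / 1 * (k * (+ 3 / 1 * e)) * R - I) + + 6 / 1 * ((μ - k) * e) * R
              ≡ + 6 / 1 * (μ * e) * R - I
            id = solve-∀ ring

    private
      module Closing (p : ℚ) (0<p : 0ℚ < p) (pMin≤p : 0ℚ ≤ p - pMin) (p≤pMax : 0ℚ ≤ pMax - p)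
        (good : Good p) where

        C S : ℚ
        C = proj₁ (turn p)
        S = proj₂ (turn p)

        0<S : 0ℚ < S
        0<S = turn-im 0<p p≤pMax

        16μS≥1 : 0ℚ ≤ + 16 / 1 * μ * S - 1ℚ
        16μS≥1 = 0≤-subst (trans (id μ S p pMin) (cong (λ z → + 16 / 1 * μ * S - z) 16μpMin))
          (0≤* (0≤* {+ 16 / 1} 0≤! (0<⇒0≤ 0<μ)) (0≤+ (turn-im-lower 0<p p≤pMax) pMin≤p))
          where
          id : ∀ μ S p q → + 16 / 1 * μ * ((S - p) + (p - q)) ≡ + 16 / 1 * μ * S - + 16 / 1 * μ * q
          id = solve-∀ ring

        0<S-ΦC : 0ℚ < S - Φ * C
        0<S-ΦC = 0<-cancel (0<* {+ 16 / 1} 0<! 0<μ) (0<-subst (id μ S C Φ)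
          (0<+≤ {1ℚ - + 16 / 4000000} 0<! (0≤+ 16μS≥1 (0≤+ (0≤* {+ 16 / 1} 0≤! μΦ≤)
            (0≤* (0≤* {+ 16 / 1} 0≤! (0≤* (0<⇒0≤ 0<μ) 0≤Φ)) (turn-re-upper 0<p p≤pMax))))))
          where
          id : ∀ μ S C Φ → (1ℚ - + 16 / 4000000) + ((+ 16 / 1 * μ * S - 1ℚ)
              + (+ 16 / 1 * (+ 1 / 4000000 - μ * Φ) + + 16 / 1 * (μ * Φ) * (1ℚ - C)))
            ≡ + 16 / 1 * μ * (S - Φ * C)
          id = solve-∀ ring

        C-ΦS≥ : 0ℚ ≤ C - Φ * S - ½
        C-ΦS≥ = 0≤-subst (id S C Φ) (0≤+ (turn-re 0<p p≤pMax) (0≤+ {+ 1 / 4 - + 1 / 32000000} 0≤!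
          (0≤+ (0≤* {+ 1 / 8} 0≤! Φ≤) (0≤* 0≤Φ (turn-im-upper 0<p p≤pMax)))))
          where
          id : ∀ S C Φ → (C - + 3 / 4) + ((+ 1 / 4 - + 1 / 32000000)
              + (+ 1 / 8 * (+ 1 / 4000000 - Φ) + Φ * (+ 1 / 8 - S))) ≡ C - Φ * S - ½
          id = solve-∀ ring

        0<C-ΦS : 0ℚ < C - Φ * S
        0<C-ΦS = 0<-subst (id (C - Φ * S)) (0<+≤ {½} 0<! C-ΦS≥)
          where
          id : ∀ x → ½ + (x - ½) ≡ x
          id = solve-∀ ring

        -- After multiplication by `16 μ`, the bounds `16 μ S ≥ 1` and `C - Φ S ≥ ½` leave at least
        -- `(gapMax - 1) / 2 = 5 / 1000000` against `16 μ Φ ≤ 4 / 1000000`. This comparison dictates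
        -- the fineness of the grid.
        room : 0ℚ ≤ (gapMax - 1ℚ) * S * (C - Φ * S) - Φ
        room = 0≤-cancel (0<* {+ 16 / 1} 0<! 0<μ) (0≤-subst (id μ S (C - Φ * S) Φ (gapMax - 1ℚ))
          (0≤+ {(gapMax - 1ℚ) * ½ - + 16 / 4000000} 0≤! (0≤+ (0≤* {gapMax - 1ℚ} 0≤! (0≤+ (0≤* 16μS≥1 (0<⇒0≤ 0<C-ΦS)) C-ΦS≥))
            (0≤* {+ 16 / 1} 0≤! μΦ≤))))
          where
          id : ∀ μ S X Φ g → (g * ½ - + 16 / 4000000) + (g * ((+ 16 / 1 * μ * S - 1ℚ) * X + (X - ½))
              + + 16 / 1 * (+ 1 / 4000000 - μ * Φ))
            ≡ + 16 / 1 * μ * (g * S * X - Φ)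
          id = solve-∀ ring

        above : ∀ j → 1 ℕ.≤ j → j ℕ.≤ M → 0ℚ < proj₂ (power-of (turn p) j)
        above j 1≤j j≤M = good j 1≤j (ℕ.m≤n⇒m≤1+n j≤M)

        -- Only the full circle can have been passed: for k < m the next power
        -- would lie below the axis.
        past-last : Past p → 0ℚ < - proj₁ (power-of (turn p) m)
          × 0ℚ ≤ Φ * - proj₁ (power-of (turn p) m) - proj₂ (power-of (turn p) m)
        past-last (k , 1≤k , k≤m , c<0 , s≤) = split (ℕ.m≤n⇒m<n∨m≡n k≤m)
          where
          split : k ℕ.< m ⊎ k ≡ m → _
          split (inj₂ refl) = c<0 , s≤
          split (inj₁ k<m) = ⊥-elim (0<-0≤⇒⊥ (good (suc k) (ℕ.s≤s ℕ.z≤n) k<m)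
            (0≤-subst (id (proj₁ (power-of (turn p) k)) (proj₂ (power-of (turn p) k)) C S Φ)
              (0≤+ (0≤* (0<⇒0≤ c<0) (0<⇒0≤ 0<S-ΦC)) (0≤* s≤ (0<⇒0≤ (0<turn-re 0<p p≤pMax))))))
            where
            id : ∀ c s C S Φ → - c * (S - Φ * C) + (Φ * - c - s) * C ≡ - (c * S + s * C)
            id = solve-∀ ring

        open Ring M (turn p) (turn-unit p) above using (seam; step; step-cases)
        open SeamGap (turn-unit p) (0<turn-re 0<p p≤pMax) 0<S public

        seam-gap : Past p → ∃[ h ] (GapRange h × Along τ seam h)
        seam-gap past = subst (λ w → ∃[ h ] (GapRange h × Along τ (-ᵥ conj w) h))
          (⊗-conj (power-of (turn p) M) (turn p) (turn-unit p))
          (seam-along {proj₁ (power-of (turn p) m)} {proj₂ (power-of (turn p) m)} {Φ} {gapMax}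
            (good m (ℕ.s≤s ℕ.z≤n) ℕ.≤-refl) (proj₁ (past-last past)) (proj₂ (past-last past))
            0<C-ΦS 0≤! room)

        step-gap : Past p → ∀ a → ∃[ h ] (GapRange h × Along τ (step a) h)
        step-gap past = step-cases (λ w → ∃[ h ] (GapRange h × Along τ w h)) (seam-gap past)
          (1ℚ , (0≤! , 0≤!) , regular-along)

    RingExists : Set
    RingExists = ∃[ ω ] Σ (Unit ω) λ ω-unit →
      Σ (∀ j → 1 ℕ.≤ j → j ℕ.≤ M → 0ℚ < proj₂ (power-of ω j)) λ above →
      ∃[ τ ] (0ℚ < τ × 0ℚ ≤ tMax - τ * τ
        × (∀ a → ∃[ h ] (GapRange h × Along τ (Ring.step M ω ω-unit above a) h)))

    private
      close : Gap → RingExists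
      close (p , 0<p , pMin≤p , p≤pMax , good , past) = turn p , turn-unit p , K.above , K.τ
        , K.0<τ , K.τ²≤ {tMax} (turn-tMax 0<p p≤pMax) , K.step-gap past
        where
        module K = Closing p 0<p pMin≤p p≤pMax good

    ring-exists : RingExists
    ring-exists = close gap

-- Counting disks around the cycle

module Cycles where

  open import Data.Bool.Base using (T)
  open import Data.Empty using (⊥; ⊥-elim)
  open import Data.Fin.Base using (Fin; zero; suc; toℕ; combine)
  open import Data.Fin.Properties as Fin
    using (toℕ<n; toℕ-injective; combine-injective; injective⇒≤)
  open import Data.Nat.Base
  open import Data.Nat.Properties
  open import Data.Nat.DivMod using (_%_; _/_; m≡m%n+[m/n]*n; m%n<n)
  open import Data.Nat.Tactic.RingSolver using (solve-∀)
  open import Data.Product.Base using (_×_; _,_; proj₁; proj₂)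
  open import Data.Sum.Base using (_⊎_; inj₁; inj₂)
  open import Relation.Binary.Definitions using (tri<; tri≈; tri>)
  open import Relation.Binary.PropositionalEquality
    using (_≡_; _≢_; refl; sym; trans; cong; cong₂; subst)
  open import Relation.Nullary using (Dec; yes; no)

  -- F a is the disk assigned to the point a mod m of a cycle of m = suc M points.
  module Cycle (M : ℕ) (9≤M : 9 ≤ M) {k : ℕ} (F : ℕ → Fin k)
    (periodic : ∀ a → F (a + suc M) ≡ F a)
    (near : ∀ a e → 1 ≤ e → e ≤ M → F a ≡ F (a + e) → e ≡ 1 ⊎ e ≡ M)
    where

    m : ℕ
    m = suc M

    apart : ∀ a e → 2 ≤ e → e < M → F a ≢ F (a + e)
    apart a e 2≤e e<M eq with near a e (≤-trans (s≤s z≤n) 2≤e) (<⇒≤ e<M) eq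
    ... | inj₁ refl = 1+n≰n 2≤e
    ... | inj₂ refl = 1+n≰n e<M

    -- The counting argument compares points at most 7 apart, and `9 ≤ M` keeps such offsets from
    -- wrapping around to a neighbour.
    apart-by : ∀ e {_ : T (2 ≤ᵇ e)} {_ : T (e <ᵇ 9)} a → F a ≢ F (e + a)
    apart-by e {2≤e} {e<9} a eq = apart a e (≤ᵇ⇒≤ 2 e 2≤e) (≤-trans (<ᵇ⇒< e 9 e<9) 9≤M)
      (trans eq (cong F (+-comm e a)))

    wrap : ∀ a {b} → b ≡ a + m → F b ≡ F a
    wrap a refl = periodic a

    periodic-* : ∀ a q → F (a + q * m) ≡ F a
    periodic-* a zero    = cong F (+-identityʳ a)
    periodic-* a (suc q) = trans (cong F (regroup a (q * m) m))
      (trans (periodic (a + q * m)) (periodic-* a q))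
      where
      regroup : ∀ a b c → a + (c + b) ≡ a + b + c
      regroup = solve-∀

    residue : ∀ a c → F (a % m + c) ≡ F (a + c)
    residue a c = sym (trans (cong F (trans (cong (_+ c) (m≡m%n+[m/n]*n a m))
        (regroup (a % m) (a / m * m) c))) (periodic-* (a % m + c) (a / m)))
      where
      regroup : ∀ a b c → a + b + c ≡ a + c + b
      regroup = solve-∀

    residue₀ : ∀ a → F (a % m) ≡ F a
    residue₀ a = trans (cong F (sym (+-identityʳ (a % m))))
      (trans (residue a 0) (cong F (+-identityʳ a)))

    back : ∀ a → suc a + M ≡ a + m
    back a = sym (+-suc a M)

    1+M : ∀ a → a + 1 + M ≡ a + m
    1+M a = +-assoc a 1 M

    M+1 : ∀ a → a + M + 1 ≡ a + m
    M+1 a = trans (+-assoc a M 1) (cong (a +_) (+-comm M 1))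

    pred-M : ℕ
    pred-M = pred M

    M≡ : M ≡ suc pred-M
    M≡ = sym (suc-pred M {{>-nonZero (≤-trans (s≤s z≤n) 9≤M)}})

    2≤pred-M : 2 ≤ pred-M
    2≤pred-M = s≤s⁻¹ (subst (3 ≤_) M≡ (≤-trans (s≤s (s≤s (s≤s z≤n))) 9≤M))

    pred-M<M : pred-M < M
    pred-M<M = ≤-reflexive (sym M≡)

    twice-M : ∀ a → a + M + M ≡ a + pred-M + m
    twice-M a = trans (cong (λ z → a + z + M) M≡) (regroup a pred-M M)
      where
      regroup : ∀ a p M → a + suc p + M ≡ a + p + suc M
      regroup = solve-∀

    not-three : ∀ a → F a ≡ F (a + 1) → F (a + M) ≢ F a
    not-three a eq₁ eq₂ = apart (a + 1) pred-M 2≤pred-M pred-M<M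
      (trans (sym eq₁) (trans (sym eq₂) (cong F (trans (cong (a +_) M≡) (sym (+-assoc a 1 pred-M))))))

    second : ∀ a → Dec (F (a + M) ≡ F a)
    second a = F (a + M) Fin.≟ F a

    label : ∀ {P : Set} → Dec P → Fin 2
    label (yes _) = suc zero
    label (no _)  = zero

    -- Modulo `m`, `a + M` is the predecessor of `a`. A point takes the second slot of its disk
    -- exactly when its predecessor is assigned to the same disk, so two neighbours on one disk are
    -- told apart.
    slot : Fin m → Fin k × Fin 2
    slot i = F (toℕ i) , label (second (toℕ i))

    clash : ∀ a b → a < b → b < m → F a ≡ F b → label (second a) ≢ label (second b)
    clash a b a<b b<m eq same = by-distance (near a (b ∸ a) (m<n⇒0<n∸m a<b)
        (≤-trans (m∸n≤m b a) (s≤s⁻¹ b<m)) (trans eq (cong F b≡)))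
      where
      b≡ : b ≡ a + (b ∸ a)
      b≡ = sym (m+[n∸m]≡n (<⇒≤ a<b))

      transfer : ∀ {P Q : Set} (P? : Dec P) (Q? : Dec Q) → label P? ≡ label Q? → Q → P
      transfer (yes p) _       _  _ = p
      transfer (no _)  (no ¬q) _  q = ⊥-elim (¬q q)
      transfer (no _)  (yes _) () _

      by-distance : b ∸ a ≡ 1 ⊎ b ∸ a ≡ M → ⊥
      by-distance (inj₁ e≡1) = not-three a (trans eq (cong F b≡a+1))
        (transfer (second a) (second b) same
          (trans (wrap a (trans (cong (_+ M) b≡a+1) (1+M a))) eq))
        where
        b≡a+1 : b ≡ a + 1
        b≡a+1 = trans b≡ (cong (a +_) e≡1)
      by-distance (inj₂ e≡M) = apart a pred-M 2≤pred-M pred-M<M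
        (trans eq (trans (sym (transfer (second b) (second a) (sym same) (sym (trans eq (cong F b≡a+M)))))
          (wrap (a + pred-M) (trans (cong (_+ M) b≡a+M) (twice-M a)))))
        where
        b≡a+M : b ≡ a + M
        b≡a+M = trans b≡ (cong (a +_) e≡M)

    slot-injective : ∀ i j → slot i ≡ slot j → i ≡ j
    slot-injective i j eq with <-cmp (toℕ i) (toℕ j)
    ... | tri≈ _ i≡j _ = toℕ-injective i≡j
    ... | tri< i<j _ _ = ⊥-elim (clash (toℕ i) (toℕ j) i<j (toℕ<n j) (cong proj₁ eq) (cong proj₂ eq))
    ... | tri> _ _ j<i = ⊥-elim (clash (toℕ j) (toℕ i) j<i (toℕ<n i) (cong proj₁ (sym eq)) (cong proj₂ (sym eq)))

    two-free-slots : ∀ x y → x ≢ y → (∀ i → slot i ≢ x) → (∀ i → slot i ≢ y) → 2 + m ≤ k * 2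
    two-free-slots x y x≢y x-free y-free = injective⇒≤ {f = λ i → pack (assign i)} (λ {i} {j} eq →
        assign-injective i j (pack-injective (assign i) (assign j) eq))
      where
      pack : Fin k × Fin 2 → Fin (k * 2)
      pack (d , l) = combine d l

      pack-injective : ∀ s t → pack s ≡ pack t → s ≡ t
      pack-injective (d , l) (d′ , l′) eq = let (d≡ , l≡) = combine-injective d l d′ l′ eq in cong₂ _,_ d≡ l≡

      assign : Fin (2 + m) → Fin k × Fin 2
      assign zero          = x
      assign (suc zero)    = y
      assign (suc (suc i)) = slot i

      assign-injective : ∀ i j → assign i ≡ assign j → i ≡ j
      assign-injective zero          zero          _  = refl
      assign-injective zero          (suc zero)    eq = ⊥-elim (x≢y eq)
      assign-injective zero          (suc (suc j)) eq = ⊥-elim (x-free j (sym eq))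
      assign-injective (suc zero)    zero          eq = ⊥-elim (x≢y (sym eq))
      assign-injective (suc zero)    (suc zero)    _  = refl
      assign-injective (suc zero)    (suc (suc j)) eq = ⊥-elim (y-free j (sym eq))
      assign-injective (suc (suc i)) zero          eq = ⊥-elim (x-free i eq)
      assign-injective (suc (suc i)) (suc zero)    eq = ⊥-elim (y-free i eq)
      assign-injective (suc (suc i)) (suc (suc j)) eq = cong (λ z → suc (suc z)) (slot-injective i j eq)

    Lone : ℕ → Set
    Lone a = F (1 + a) ≢ F a × F (a + M) ≢ F a

    -- A holder of this slot is either `a` itself, sharing its disk with its predecessor, or another
    -- point assigned to the same disk and hence a neighbour of `a`. Both contradict `Lone a`.
    lone-free : ∀ a → Lone a → ∀ i → slot i ≢ (F a , suc zero)
    lone-free a (no-next , no-prev) i eq = conclude (<-cmp (toℕ i) b)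
      where
      b : ℕ
      b = a % m

      Fi≡Fb : F (toℕ i) ≡ F b
      Fi≡Fb = trans (cong proj₁ eq) (sym (residue₀ a))

      next : F (b + 1) ≢ F b
      next eq = no-next (trans (cong F (+-comm 1 a)) (trans (sym (residue a 1)) (trans eq (residue₀ a))))

      prev : F (b + M) ≢ F b
      prev eq = no-prev (trans (sym (residue a M)) (trans eq (residue₀ a)))

      is-second : F (toℕ i + M) ≡ F (toℕ i)
      is-second = holds (second (toℕ i)) (cong proj₂ eq)
        where
        holds : ∀ {P : Set} (P? : Dec P) → label P? ≡ suc zero → P
        holds (yes p) _  = p
        holds (no _)  ()

      split : ∀ {a c} → a < c → c < m → F a ≡ F c → c ≡ a + 1 ⊎ c ≡ a + M
      split {a} {c} a<c c<m eq = shift (near a (c ∸ a) (m<n⇒0<n∸m a<c)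
          (≤-trans (m∸n≤m c a) (s≤s⁻¹ c<m)) (trans eq (cong F c≡)))
        where
        c≡ : c ≡ a + (c ∸ a)
        c≡ = sym (m+[n∸m]≡n (<⇒≤ a<c))

        shift : c ∸ a ≡ 1 ⊎ c ∸ a ≡ M → c ≡ a + 1 ⊎ c ≡ a + M
        shift (inj₁ e) = inj₁ (trans c≡ (cong (a +_) e))
        shift (inj₂ e) = inj₂ (trans c≡ (cong (a +_) e))

      conclude : _ → ⊥
      conclude (tri≈ _ i≡b _) = prev (subst (λ z → F (z + M) ≡ F z) i≡b is-second)
      conclude (tri< i<b _ _) with split i<b (m%n<n a m) Fi≡Fb
      ... | inj₁ b≡i+1 = prev (trans (wrap (toℕ i) (trans (cong (_+ M) b≡i+1) (1+M (toℕ i)))) Fi≡Fb)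
      ... | inj₂ b≡i+M = next (trans (wrap (toℕ i) (trans (cong (_+ 1) b≡i+M) (M+1 (toℕ i)))) Fi≡Fb)
      conclude (tri> _ _ b<i) with split b<i (toℕ<n i) (sym Fi≡Fb)
      ... | inj₁ i≡b+1 = next (trans (cong F (sym i≡b+1)) Fi≡Fb)
      ... | inj₂ i≡b+M = prev (trans (cong F (sym i≡b+M)) Fi≡Fb)

    two-lone-points : ∀ e {_ : T (2 ≤ᵇ e)} {_ : T (e <ᵇ 9)} a → Lone a → Lone (e + a) → 2 + m ≤ k * 2
    two-lone-points e {2≤e} {e<9} a lone-a lone-b = two-free-slots (F a , suc zero) (F (e + a) , suc zero)
      (λ eq → apart-by e {2≤e} {e<9} a (cong proj₁ eq)) (lone-free a lone-a) (lone-free (e + a) lone-b)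

    module Contact (d₀ : Fin k)
      (no-forward : ∀ a → F (1 + a) ≡ d₀ → F (2 + a) ≡ F (3 + a) → F (4 + a) ≡ F (5 + a) →
        d₀ ≢ F (2 + a) → d₀ ≢ F (4 + a) → F (2 + a) ≢ F (4 + a) → ⊥)
      (no-backward : ∀ a → F (4 + a) ≡ d₀ → F (3 + a) ≡ F (2 + a) → F (1 + a) ≡ F a →
        d₀ ≢ F (3 + a) → d₀ ≢ F (1 + a) → F (3 + a) ≢ F (1 + a) → ⊥)
      where

      -- Unless `2 + a` shares its disk with `3 + a` it is lone, its predecessor being on `d₀`. If
      -- it does share, then `4 + a` cannot join `3 + a`, so it is lone unless it is paired with
      -- `5 + a`, which `no-forward` excludes.
      lone-forward : ∀ a → F (1 + a) ≡ d₀ → F (2 + a) ≢ d₀ → Lone (2 + a) ⊎ Lone (4 + a)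
      lone-forward a at₁ off₂ with F (2 + a) Fin.≟ F (3 + a)
      ... | no F₂≢F₃ = inj₁ ((λ eq → F₂≢F₃ (sym eq))
            , λ eq → off₂ (trans (sym eq) (trans (wrap (1 + a) (back (1 + a))) at₁)))
      ... | yes F₂≡F₃ with F (4 + a) Fin.≟ F (5 + a)
      ... | no F₄≢F₅ = inj₂ ((λ eq → F₄≢F₅ (sym eq))
            , λ eq → apart-by 2 (2 + a) (trans F₂≡F₃ (trans (sym (wrap (3 + a) (back (3 + a)))) eq)))
      ... | yes F₄≡F₅ = ⊥-elim (no-forward a at₁ F₂≡F₃ F₄≡F₅ (λ eq → off₂ (sym eq))
        (λ eq → apart-by 3 (1 + a) (trans at₁ eq)) (apart-by 2 (2 + a)))

      lone-backward : ∀ a → F (4 + a) ≡ d₀ → F (3 + a) ≢ d₀ → Lone (3 + a) ⊎ Lone (1 + a)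
      lone-backward a at₄ off₃ with F (3 + a) Fin.≟ F (2 + a)
      ... | no F₃≢F₂ = inj₁ ((λ eq → off₃ (trans (sym eq) at₄))
            , λ eq → F₃≢F₂ (sym (trans (sym (wrap (2 + a) (back (2 + a)))) eq)))
      ... | yes F₃≡F₂ with F (1 + a) Fin.≟ F a
      ... | no F₁≢F₀ = inj₂ ((λ eq → apart-by 2 (1 + a) (trans (sym eq) (sym F₃≡F₂)))
            , λ eq → F₁≢F₀ (sym (trans (sym (wrap a (back a))) eq)))
      ... | yes F₁≡F₀ = ⊥-elim (no-backward a at₄ F₃≡F₂ F₁≡F₀ (λ eq → off₃ (sym eq))
        (λ eq → apart-by 3 (1 + a) (sym (trans at₄ eq))) (λ eq → apart-by 2 (1 + a) (sym eq)))

      -- The points of d₀ are 4 + a and perhaps 5 + a.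
      around : ∀ a → F (4 + a) ≡ d₀ → F (3 + a) ≢ d₀ → 2 + m ≤ k * 2
      around a at₄ off₃ with F (5 + a) Fin.≟ d₀
      ... | no off₅  = join (lone-backward a at₄ off₃) (lone-forward (3 + a) at₄ off₅)
        where
        join : Lone (3 + a) ⊎ Lone (1 + a) → Lone (5 + a) ⊎ Lone (7 + a) → 2 + m ≤ k * 2
        join (inj₁ l) (inj₁ r) = two-lone-points 2 (3 + a) l r
        join (inj₁ l) (inj₂ r) = two-lone-points 4 (3 + a) l r
        join (inj₂ l) (inj₁ r) = two-lone-points 4 (1 + a) l r
        join (inj₂ l) (inj₂ r) = two-lone-points 6 (1 + a) l r
      ... | yes at₅ = join (lone-backward a at₄ off₃)
          (lone-forward (4 + a) at₅ (λ at₆ → apart-by 2 (4 + a) (trans at₄ (sym at₆))))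
        where
        join : Lone (3 + a) ⊎ Lone (1 + a) → Lone (6 + a) ⊎ Lone (8 + a) → 2 + m ≤ k * 2
        join (inj₁ l) (inj₁ r) = two-lone-points 3 (3 + a) l r
        join (inj₁ l) (inj₂ r) = two-lone-points 5 (3 + a) l r
        join (inj₂ l) (inj₁ r) = two-lone-points 5 (1 + a) l r
        join (inj₂ l) (inj₂ r) = two-lone-points 7 (1 + a) l r

      private
        three-before : ∀ r → 3 + (r + (M ∸ 3)) ≡ r + M
        three-before r = trans (regroup r (M ∸ 3)) (cong (r +_) (m+[n∸m]≡n (≤-trans (s≤s (s≤s (s≤s z≤n))) 9≤M)))
          where
          regroup : ∀ r p → 3 + (r + p) ≡ r + (3 + p)
          regroup = solve-∀

        -- Adding `M - 3` writes `r` as `4 + a` modulo `m`, which makes the earlier points available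
        -- without subtraction.
        around′ : ∀ r → F r ≡ d₀ → F (r + M) ≢ d₀ → 2 + m ≤ k * 2
        around′ r at-r off = around (r + (M ∸ 3))
          (trans (wrap r (trans (cong suc (three-before r)) (back r))) at-r)
          (λ at → off (trans (cong F (sym (three-before r))) at))

      reached : ∀ r → F r ≡ d₀ → 2 + m ≤ k * 2
      reached r at-r with F (r + M) Fin.≟ d₀
      ... | no off = around′ r at-r off
      ... | yes at = around′ (r + M) at (λ at′ → apart r pred-M 2≤pred-M pred-M<M
        (trans at-r (trans (sym at′) (wrap (r + pred-M) (twice-M r)))))

      many-disks : 2 + m ≤ k * 2
      many-disks with Fin.any? (λ i → F (toℕ {m} i) Fin.≟ d₀)
      ... | yes (i , at-i) = reached (toℕ i) at-i
      -- If no circle point is assigned to the disk at the hub, both of its slots are free.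
      ... | no off = two-free-slots (d₀ , zero) (d₀ , suc zero) (λ ())
        (λ i eq → off (i , cong proj₁ eq)) (λ i eq → off (i , cong proj₁ eq))

-- The point set and the lower bound for its covers

module HardSets where

  open Limits
  open Estimates using (tMax)
  open ThreeDisks using (GapRange)
  open Frames
  open Rings
  open Neighbours
  open Closing using (module Existence)
  open Cycles using (module Cycle)
  open import Defs as D using (Disk; fromℚ; PointSet; Cover; _≈²_)
  open import Data.Empty using (⊥; ⊥-elim)
  open import Data.Fin.Base using (Fin; zero; suc; toℕ; fromℕ<)
  open import Data.Fin.Properties as Fin using (toℕ<n; toℕ-injective; toℕ-fromℕ<; fromℕ<-cong)
  open import Data.Integer.Base using (+_)
  open import Data.Nat.Base as ℕ using (ℕ; zero; suc)
  import Data.Nat.Properties as ℕ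
  import Data.Nat.DivMod as ℕ
  open import Data.Nat.Tactic.RingSolver using () renaming (solve-∀ to ℕ-solve-∀)
  open import Data.Product.Base using (_×_; _,_; proj₁; proj₂; ∃-syntax)
  open import Data.Rational.Base
  import Data.Rational.Properties as ℚ
  open import Data.Sum.Base using (_⊎_; inj₁; inj₂)
  open import Relation.Binary.Definitions using (tri<; tri≈; tri>)
  open import Relation.Binary.PropositionalEquality
    using (_≡_; _≢_; refl; sym; trans; cong; cong₂; subst)
  open import Tactic.RingSolver using (solve-∀)

  fromℚ-injective : ∀ {x y} → fromℚ x D.≈ fromℚ y → x ≡ y
  fromℚ-injective {x} {y} x≈y = trans (e x y)
      (trans (cong (_+ y) (ℚ.∣p∣≡0⇒p≡0 (x - y) ∣x-y∣≡0)) (ℚ.+-identityˡ y))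
    where
    e : ∀ x y → x ≡ x - y + y
    e = solve-∀ ring

    ∣x-y∣≡0 : ∣ x - y ∣ ≡ 0ℚ
    ∣x-y∣≡0 with ℚ.<-cmp 0ℚ ∣ x - y ∣
    ... | tri≈ _ 0≡ _ = sym 0≡
    ... | tri> _ _ <0 = ⊥-elim (ℚ.<-irrefl refl (ℚ.<-≤-trans <0 (ℚ.0≤∣p∣ (x - y))))
    ... | tri< 0< _ _ = let (N , close) = x≈y ∣ x - y ∣ 0< in ⊥-elim (ℚ.<-irrefl refl (close N ℕ.≤-refl))

  fromℚ²-injective : ∀ p q → fromℚ² p ≈² fromℚ² q → p ≡ q
  fromℚ²-injective _ _ (x≈ , y≈) = cong₂ _,_ (fromℚ-injective x≈) (fromℚ-injective y≈)

  pt-unit : ∀ v → Unit v → Unit (pt v)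
  pt-unit (a , b) v-unit = trans (e a b) (cong₂ _*_ v-unit v-unit)
    where
    e : ∀ a b → (a * a - b * b) * (a * a - b * b) + + 2 / 1 * (a * b) * (+ 2 / 1 * (a * b))
      ≡ (a * a + b * b) * (a * a + b * b)
    e = solve-∀ ring

  pt≢origin : ∀ v → Unit v → pt v ≢ origin
  pt≢origin v v-unit pt≡0 = 0<-0≤⇒⊥ {1ℚ} 0<!
    (0≤-subst (cong -_ (trans (cong₂ (λ x y → x * x + y * y) (sym (cong proj₁ pt≡0)) (sym (cong proj₂ pt≡0))) (pt-unit v v-unit)))
      (0≤! {0ℚ}))

  -- The unit vectors `pt v` and `pt (v ⊗ w)` have inner product `c² - s² = 1 - 2 s²`, which would
  -- be 1 if they coincided.
  pt-⊗≢ : ∀ v w → Unit v → Unit w → 0ℚ < proj₂ w → pt (v ⊗ w) ≢ pt v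
  pt-⊗≢ v@(p , q) w@(c , s) v-unit w-unit 0<s pt≡ = 0<-0≤⇒⊥ (0<* {+ 2 / 1} 0<! (0<* 0<s 0<s))
    (0≤-subst (trans (sym zero-gap) (e₂ c s)) (0≤! {0ℚ}))
    where
    e : ∀ p q c s →
      (p * p - q * q) * ((p * c - q * s) * (p * c - q * s) - (p * s + q * c) * (p * s + q * c))
      + + 2 / 1 * (p * q) * (+ 2 / 1 * ((p * c - q * s) * (p * s + q * c)))
      ≡ (p * p + q * q) * (p * p + q * q) * (c * c - s * s)
    e = solve-∀ ring

    e₂ : ∀ c s → (c * c - s * s) - (c * c + s * s) ≡ - (+ 2 / 1 * (s * s))
    e₂ = solve-∀ ring

    cos≡1 : c * c - s * s ≡ 1ℚ
    cos≡1 = trans (trans (sym (ℚ.*-identityˡ (c * c - s * s)))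
        (cong (_* (c * c - s * s)) (sym (cong₂ _*_ v-unit v-unit))))
      (trans (sym (e p q c s))
        (trans (cong₂ (λ x y → proj₁ (pt v) * x + proj₂ (pt v) * y) (cong proj₁ pt≡) (cong proj₂ pt≡)) (pt-unit v v-unit)))

    zero-gap : (c * c - s * s) - (c * c + s * s) ≡ 0ℚ
    zero-gap = trans (cong₂ _-_ cos≡1 w-unit) (ℚ.+-inverseʳ 1ℚ)

  module Lower (M : ℕ) (172≤M : 172 ℕ.≤ M) (ω : ℚ²) (ω-unit : Unit ω)
    (above : ∀ j → 1 ℕ.≤ j → j ℕ.≤ M → 0ℚ < proj₂ (power-of ω j))
    (τ : ℚ) (0<τ : 0ℚ < τ) (t≤tMax : 0ℚ ≤ tMax - τ * τ)
    (gap : ∀ a → ∃[ h ] (GapRange h × Along τ (Ring.step M ω ω-unit above a) h))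
    where

    open Ring M ω ω-unit above
    open Sides M ω ω-unit above τ 0<τ t≤tMax gap

    location : Fin (suc m) → ℚ²
    location zero    = origin
    location (suc i) = ringPoint (toℕ i)

    ringPoint-distinct : ∀ i j → i ℕ.< j → j ℕ.≤ M → ringPoint j ≢ ringPoint i
    ringPoint-distinct i j i<j j≤M eq = pt-⊗≢ (vec i) (ω^ (j ℕ.∸ i)) (vec-unit i) (ω^-unit (j ℕ.∸ i))
      (above (j ℕ.∸ i) (ℕ.m<n⇒0<n∸m i<j) (ℕ.≤-trans (ℕ.m∸n≤m j i) j≤M))
      (trans (cong pt (sym split)) eq)
      where
      split : vec j ≡ vec i ⊗ ω^ (j ℕ.∸ i)
      split = trans (vec-inner j j≤M) (trans (cong ω^ (sym (ℕ.m∸n+n≡m (ℕ.<⇒≤ i<j))))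
        (trans (ω^-+ i (j ℕ.∸ i)) (cong (_⊗ ω^ (j ℕ.∸ i)) (sym (vec-inner i (ℕ.≤-trans (ℕ.<⇒≤ i<j) j≤M))))))

    location-injective : ∀ i j → location i ≡ location j → i ≡ j
    location-injective zero    zero    _  = refl
    location-injective zero    (suc j) eq = ⊥-elim (pt≢origin (vec (toℕ j)) (vec-unit (toℕ j)) (sym eq))
    location-injective (suc i) zero    eq = ⊥-elim (pt≢origin (vec (toℕ i)) (vec-unit (toℕ i)) eq)
    location-injective (suc i) (suc j) eq = cong suc (compare (ℕ.<-cmp (toℕ i) (toℕ j)))
      where
      compare : _ → i ≡ j
      compare (tri≈ _ i≡j _) = toℕ-injective i≡j
      compare (tri< i<j _ _) = ⊥-elim (ringPoint-distinct (toℕ i) (toℕ j) i<j (ℕ.s≤s⁻¹ (toℕ<n j)) (sym eq))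
      compare (tri> _ _ j<i) = ⊥-elim (ringPoint-distinct (toℕ j) (toℕ i) j<i (ℕ.s≤s⁻¹ (toℕ<n i)) eq)

    points-and-hub : PointSet (suc m)
    points-and-hub = record
      { point    = λ i → fromℚ² (location i)
      ; distinct = λ {i} {j} eq → location-injective i j (fromℚ²-injective (location i) (location j) eq)
      }

    module _ {k : ℕ} (C : Cover points-and-hub k) where

      open Cover C
      open Avoids

      index : ℕ → Fin m
      index a = fromℕ< (ℕ.m%n<n a m)

      location-index : ∀ a → location (suc (index a)) ≡ ringPoint a
      location-index a = trans (cong ringPoint (toℕ-fromℕ< (ℕ.m%n<n a m))) (ringPoint-% a)

      avoids : ∀ j → Avoids (disk j)
      avoids j = record
        { hub    = avoiding (disk j) origin (empty j zero)
        ; points = λ a → subst (λ p → NonNeg∞ (power (disk j) p)) (location-index a)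
            (avoiding (disk j) (location (suc (index a))) (empty j (suc (index a))))
        }

      -- A point may lie on several disks; the count follows the one that `covers` selects.
      -- Reduction modulo `m` inside `index` makes this choice periodic.
      F : ℕ → Fin k
      F a = proj₁ (covers (suc (index a)))

      touches : ∀ a → Touches (disk (F a)) a
      touches a = subst (λ p → Zero∞ (power (disk (F a)) p)) (location-index a)
        (touching (disk (F a)) (location (suc (index a))) (proj₂ (covers (suc (index a)))))

      touches-as : ∀ j a → F a ≡ j → Touches (disk j) a
      touches-as _ a refl = touches a

      periodic : ∀ a → F (a ℕ.+ m) ≡ F a
      periodic a = cong (λ i → proj₁ (covers (suc i)))
        (fromℕ<-cong _ _ (ℕ.[m+n]%n≡m%n a m) (ℕ.m%n<n (a ℕ.+ m) m) (ℕ.m%n<n a m))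

      touches-≡ : ∀ 𝔻 a b → ringPoint a ≡ ringPoint b → Touches 𝔻 a → Touches 𝔻 b
      touches-≡ 𝔻 _ _ = subst (λ p → Zero∞ (power 𝔻 p))

      ringPoint-shift : ∀ a e → ringPoint (a ℕ.+ e) ≡ ringPoint (e ℕ.+ a ℕ.% m)
      ringPoint-shift a e = trans (cong ringPoint (trans (cong (ℕ._+ e) (ℕ.m≡m%n+[m/n]*n a m))
          (regroup (a ℕ.% m) (a ℕ./ m ℕ.* m) e))) (ringPoint-+* (e ℕ.+ a ℕ.% m) (a ℕ./ m))
        where
        regroup : ∀ x y z → x ℕ.+ y ℕ.+ z ≡ z ℕ.+ x ℕ.+ y
        regroup = ℕ-solve-∀

      -- `adjacent` only treats pairs within one round. If `e + i` exceeds `M`, the roles are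
      -- swapped: from `e + i - m` to `i` the offset is `m - e`, which exchanges the outcomes `1`
      -- and `M`.
      near : ∀ a e → 1 ℕ.≤ e → e ℕ.≤ M → F a ≡ F (a ℕ.+ e) → e ≡ 1 ⊎ e ≡ M
      near a e 1≤e e≤M eq = split (ℕ.≤-total (e ℕ.+ i) M)
        where
        i : ℕ
        i = a ℕ.% m

        𝔻 : Disk
        𝔻 = disk (F a)

        at-i : Touches 𝔻 i
        at-i = touches-≡ 𝔻 a i (sym (ringPoint-% a)) (touches a)

        at-e+i : Touches 𝔻 (e ℕ.+ i)
        at-e+i = touches-≡ 𝔻 (a ℕ.+ e) (e ℕ.+ i) (ringPoint-shift a e) (touches-as (F a) (a ℕ.+ e) (sym eq))

        split : e ℕ.+ i ℕ.≤ M ⊎ M ℕ.≤ e ℕ.+ i → e ≡ 1 ⊎ e ≡ M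
        split (inj₁ e+i≤M) = outcome (adjacent {𝔻} i e 1≤e e+i≤M (avoids (F a)) at-i at-e+i)
          where
          outcome : e ≡ 1 ⊎ (i ≡ 0 × e ≡ M) → e ≡ 1 ⊎ e ≡ M
          outcome (inj₁ e≡1)       = inj₁ e≡1
          outcome (inj₂ (_ , e≡M)) = inj₂ e≡M
        split (inj₂ M≤e+i) = boundary (ℕ.m≤n⇒m<n∨m≡n M≤e+i)
          where
          boundary : M ℕ.< e ℕ.+ i ⊎ M ≡ e ℕ.+ i → e ≡ 1 ⊎ e ≡ M
          boundary (inj₂ M≡e+i) = split (inj₁ (ℕ.≤-reflexive (sym M≡e+i)))
          boundary (inj₁ M<e+i) = outcome
              (adjacent {𝔻} j (m ℕ.∸ e) (ℕ.m<n⇒0<n∸m (ℕ.s≤s e≤M)) (subst (ℕ._≤ M) (sym i≡) i≤M) (avoids (F a))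
                (touches-≡ 𝔻 (e ℕ.+ i) j (trans (cong ringPoint (sym (ℕ.m∸n+n≡m M<e+i))) (ringPoint-periodic j)) at-e+i)
                (subst (Touches 𝔻) (sym i≡) at-i))
            where
            j : ℕ
            j = e ℕ.+ i ℕ.∸ m

            i≤M : i ℕ.≤ M
            i≤M = ℕ.s≤s⁻¹ (ℕ.m%n<n a m)

            i≡ : m ℕ.∸ e ℕ.+ j ≡ i
            i≡ = ℕ.+-cancelˡ-≡ e (m ℕ.∸ e ℕ.+ j) i (trans (sym (ℕ.+-assoc e (m ℕ.∸ e) j))
              (trans (cong (ℕ._+ j) (ℕ.m+[n∸m]≡n (ℕ.m≤n⇒m≤1+n e≤M))) (ℕ.m+[n∸m]≡n M<e+i)))

            outcome : m ℕ.∸ e ≡ 1 ⊎ (j ≡ 0 × m ℕ.∸ e ≡ M) → e ≡ 1 ⊎ e ≡ M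
            outcome (inj₁ m∸e≡1) = inj₂ (ℕ.suc-injective (trans (ℕ.+-comm 1 e)
              (trans (cong (e ℕ.+_) (sym m∸e≡1)) (ℕ.m+[n∸m]≡n (ℕ.m≤n⇒m≤1+n e≤M)))))
            outcome (inj₂ (_ , m∸e≡M)) = inj₁ (ℕ.+-cancelʳ-≡ M e 1
              (trans (cong (e ℕ.+_) (sym m∸e≡M)) (ℕ.m+[n∸m]≡n (ℕ.m≤n⇒m≤1+n e≤M))))

      d₀ : Fin k
      d₀ = proj₁ (covers zero)

      hub-touched : Zero∞ (power (disk d₀) origin)
      hub-touched = touching (disk d₀) origin (proj₂ (covers zero))

      open Cycle M (ℕ.≤-trans (ℕ.m≤m+n 9 163) 172≤M) F periodic near using (module Contact)

      no-forward : ∀ a → F (1 ℕ.+ a) ≡ d₀ → F (2 ℕ.+ a) ≡ F (3 ℕ.+ a) → F (4 ℕ.+ a) ≡ F (5 ℕ.+ a) →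
        d₀ ≢ F (2 ℕ.+ a) → d₀ ≢ F (4 ℕ.+ a) → F (2 ℕ.+ a) ≢ F (4 ℕ.+ a) → ⊥
      no-forward a at₁ F₂≡F₃ F₄≡F₅ d≢F₂ d≢F₄ F₂≢F₄ =
        no-forward-pairs a (disk d₀) (disk (F (2 ℕ.+ a))) (disk (F (4 ℕ.+ a)))
          (avoids d₀) (avoids (F (2 ℕ.+ a))) (avoids (F (4 ℕ.+ a)))
          (disjoint _ _ d≢F₂) (disjoint _ _ d≢F₄) (disjoint _ _ F₂≢F₄) hub-touched
          (touches-as d₀ (1 ℕ.+ a) at₁) (touches (2 ℕ.+ a)) (touches-as (F (2 ℕ.+ a)) (3 ℕ.+ a) (sym F₂≡F₃))
          (touches (4 ℕ.+ a)) (touches-as (F (4 ℕ.+ a)) (5 ℕ.+ a) (sym F₄≡F₅))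

      no-backward : ∀ a → F (4 ℕ.+ a) ≡ d₀ → F (3 ℕ.+ a) ≡ F (2 ℕ.+ a) → F (1 ℕ.+ a) ≡ F a →
        d₀ ≢ F (3 ℕ.+ a) → d₀ ≢ F (1 ℕ.+ a) → F (3 ℕ.+ a) ≢ F (1 ℕ.+ a) → ⊥
      no-backward a at₄ F₃≡F₂ F₁≡F₀ d≢F₃ d≢F₁ F₃≢F₁ =
        no-backward-pairs a (disk d₀) (disk (F (3 ℕ.+ a))) (disk (F (1 ℕ.+ a)))
          (avoids d₀) (avoids (F (3 ℕ.+ a))) (avoids (F (1 ℕ.+ a)))
          (disjoint _ _ d≢F₃) (disjoint _ _ d≢F₁) (disjoint _ _ F₃≢F₁) hub-touched
          (touches-as d₀ (4 ℕ.+ a) at₄) (touches (3 ℕ.+ a)) (touches-as (F (3 ℕ.+ a)) (2 ℕ.+ a) (sym F₃≡F₂))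
          (touches (1 ℕ.+ a)) (touches-as (F (1 ℕ.+ a)) a (sym F₁≡F₀))

      open Contact d₀ no-forward no-backward using (many-disks)

      many-disks-needed : 2 ℕ.+ m ℕ.≤ k ℕ.* 2
      many-disks-needed = many-disks

  hard-set : ∀ M → 172 ℕ.≤ M → ∃[ P ] (∀ k → Cover {suc (suc M)} P k → 3 ℕ.+ M ℕ.≤ k ℕ.* 2)
  hard-set M 172≤M = from (Existence.ring-exists M 172≤M)
    where
    from : Existence.RingExists M 172≤M → ∃[ P ] (∀ k → Cover {suc (suc M)} P k → 3 ℕ.+ M ℕ.≤ k ℕ.* 2)
    from (ω , ω-unit , above , τ , 0<τ , t≤tMax , gap) = L.points-and-hub , λ k C → L.many-disks-needed C
      where
      module L = Lower M 172≤M ω ω-unit above τ 0<τ t≤tMax gap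

-- Existence of covers and of extrema up to double negation

module Extrema where

  open Limits
  open Frames using (¬Pos∞⇒NonNeg∞; <⇒Pos∞)
  open import Defs as D
    using (ℝ; seq; fromℚ; Disk; dist²; PointSet; point; distinct; Cover; IsMinimum; IsMaximum; _∈Interior_)
  open import Data.Empty using (⊥; ⊥-elim)
  open import Data.Fin.Base using (Fin; zero; suc)
  import Data.Fin.Properties as Fin
  open import Data.Integer.Base using (+_)
  open import Data.Nat.Base as ℕ using (ℕ; zero; suc)
  import Data.Nat.Properties as ℕ
  open import Data.Product.Base using (_×_; _,_; proj₁; proj₂; ∃-syntax)
  open import Data.Rational.Base
  import Data.Rational.Properties as ℚ
  open import Data.Sum.Base using (inj₁; inj₂)
  open import Relation.Binary.PropositionalEquality
    using (_≡_; _≢_; refl; sym; trans; cong; cong₂; subst)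
  open import Relation.Nullary using (¬_; yes; no)
  open import Relation.Nullary.Decidable using (decidable-stable)
  open import Tactic.RingSolver using (solve-∀)

  NonNeg∞-pointwise : ∀ {F} → (∀ n → 0ℚ ≤ F n) → NonNeg∞ F
  NonNeg∞-pointwise F≥0 = nonNeg∞ λ ε 0<ε → 0 , λ n _ → 0≤+< (F≥0 n) 0<ε

  ≡⇒≈ : ∀ x y → (∀ n → seq x n ≡ seq y n) → x D.≈ y
  ≡⇒≈ x y x≡y ε 0<ε = 0 , λ n _ → subst (_< ε) (sym (cong ∣_∣
    (trans (cong (λ z → z - seq y n) (x≡y n)) (ℚ.+-inverseʳ (seq y n))))) 0<ε

  vanishing : ∀ x y → NonNeg∞ (λ n → - ((seq x n - seq y n) * (seq x n - seq y n))) → x D.≈ y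
  vanishing x y sq≤0 ε 0<ε = ev-map (λ n p → conclude (seq x n - seq y n) p)
      (NonNeg∞.above sq≤0 (ε * ε) (0<* 0<ε 0<ε))
    where
    conclude : ∀ d → 0ℚ < - (d * d) + ε * ε → ∣ d ∣ < ε
    conclude d p with ∣ d ∣ ℚ.<? ε
    ... | yes <ε = <ε
    ... | no ≮ε = ⊥-elim (0<-0≤⇒⊥ p (0≤-subst
        (trans (e ∣ d ∣ ε) (trans (cong (_- ε * ε) (square d)) (e′ (d * d) ε)))
        (0≤* (≤⇒0≤ (ℚ.≮⇒≥ ≮ε)) (0≤+ (ℚ.0≤∣p∣ d) (0<⇒0≤ 0<ε)))))
      where
      square : ∀ d → ∣ d ∣ * ∣ d ∣ ≡ d * d
      square d with ℚ.∣p∣≡p∨∣p∣≡-p d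
      ... | inj₁ eq = cong₂ _*_ eq eq
      ... | inj₂ eq = trans (cong₂ _*_ eq eq) (neg-square d)
        where
        neg-square : ∀ d → - d * - d ≡ d * d
        neg-square = solve-∀ ring

      e : ∀ a ε → (a - ε) * (a + ε) ≡ a * a - ε * ε
      e = solve-∀ ring

      e′ : ∀ s ε → s - ε * ε ≡ - (- s + ε * ε)
      e′ = solve-∀ ring

  distance : ∀ {n} (P : PointSet n) → Fin n → Fin n → Seq
  distance P i j n = seq (dist² (point P i) (point P j)) n

  -- `distinct` only refutes equality, so a margin is obtained only under a double negation. Without
  -- one the squared distance would vanish in the limit, and with it both squared coordinate
  -- differences that it dominates.
  separated : ∀ {n} (P : PointSet n) i j → i ≢ j → ¬ ¬ Pos∞ (distance P i j)
  separated P i j i≢j ¬apart = i≢j (distinct P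
    ( vanishing xᵢ xⱼ (NonNeg∞-resp
        (λ n → dropʳ (dx n * dx n) (dy n * dy n))
        (NonNeg∞-+ close (NonNeg∞-pointwise (λ n → 0≤sq (dy n)))))
    , vanishing yᵢ yⱼ (NonNeg∞-resp
        (λ n → dropˡ (dx n * dx n) (dy n * dy n))
        (NonNeg∞-+ close (NonNeg∞-pointwise (λ n → 0≤sq (dx n)))))))
    where
    xᵢ xⱼ yᵢ yⱼ : ℝ
    xᵢ = proj₁ (point P i)
    xⱼ = proj₁ (point P j)
    yᵢ = proj₂ (point P i)
    yⱼ = proj₂ (point P j)

    dx dy : Seq
    dx n = seq xᵢ n - seq xⱼ n
    dy n = seq yᵢ n - seq yⱼ n

    close : NonNeg∞ (λ n → - (dx n * dx n + dy n * dy n))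
    close = ¬Pos∞⇒NonNeg∞ (dist² (point P i) (point P j)) ¬apart

    dropʳ : ∀ a b → - (a + b) + b ≡ - a
    dropʳ = solve-∀ ring

    dropˡ : ∀ a b → - (a + b) + a ≡ - b
    dropˡ = solve-∀ ring

  ¬¬-Fin : ∀ {n} {Q : Fin n → Set} → (∀ i → ¬ ¬ Q i) → ¬ ¬ (∀ i → Q i)
  ¬¬-Fin {zero}  _  no-all = no-all λ ()
  ¬¬-Fin {suc n} ¬¬Q no-all = ¬¬Q zero λ q₀ → ¬¬-Fin (λ i → ¬¬Q (suc i)) λ q →
    no-all λ { zero → q₀ ; (suc i) → q i }

  -- A finite minimum of margins. Starting it at 1 yields the bound `δ ≤ 1` on which the radius of
  -- the small disks relies.
  uniform : ∀ {n} (Q : Fin n → ℚ → Set) →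
    (∀ i {δ ε} → 0ℚ ≤ δ - ε → Q i δ → Q i ε) →
    (∀ i → ∃[ δ ] (0ℚ < δ × Q i δ)) →
    ∃[ δ ] (0ℚ < δ × 0ℚ ≤ 1ℚ - δ × (∀ i → Q i δ))
  uniform {zero}  Q down each = 1ℚ , 0<! , 0≤! , λ ()
  uniform {suc n} Q down each = combine (each zero) (uniform (λ i → Q (suc i)) (λ i → down (suc i)) (λ i → each (suc i)))
    where
    combine : ∃[ δ ] (0ℚ < δ × Q zero δ) →
      ∃[ δ ] (0ℚ < δ × 0ℚ ≤ 1ℚ - δ × (∀ i → Q (suc i) δ)) →
      ∃[ δ ] (0ℚ < δ × 0ℚ ≤ 1ℚ - δ × (∀ i → Q i δ))
    combine (δ₀ , 0<δ₀ , q₀) (δ , 0<δ , δ≤1 , q) with ℚ.≤-total δ₀ δ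
    ... | inj₁ δ₀≤δ = δ₀ , 0<δ₀ , ≤⇒0≤ (ℚ.≤-trans δ₀≤δ (0≤⇒≤ {δ} {1ℚ} δ≤1))
          , λ { zero → q₀ ; (suc i) → down (suc i) (≤⇒0≤ δ₀≤δ) (q i) }
    ... | inj₂ δ≤δ₀ = δ , 0<δ , δ≤1
          , λ { zero → down zero (≤⇒0≤ δ≤δ₀) q₀ ; (suc i) → q i }

  Separation : ∀ {n} → PointSet n → ℚ → Fin n → Fin n → Set
  Separation P δ i j = i ≢ j → NonNeg∞ (λ n → distance P i j n - δ)

  separation : ∀ {n} (P : PointSet n) →
    ¬ ¬ (∃[ δ ] (0ℚ < δ × 0ℚ ≤ 1ℚ - δ × (∀ i j → Separation P δ i j)))
  separation P no-sep = ¬¬-Fin (λ i → ¬¬-Fin (λ j → pair i j)) λ each →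
    no-sep (uniform (λ i δ → ∀ j → Separation P δ i j)
      (λ i ε≤δ sep j → weaken i j ε≤δ (sep j))
      (λ i → let (δ , 0<δ , _ , sep) = uniform (λ j δ → Separation P δ i j) (λ j → weaken i j) (each i)
             in δ , 0<δ , sep))
    where
    weaken : ∀ i j {δ ε} → 0ℚ ≤ δ - ε → Separation P δ i j → Separation P ε i j
    weaken i j {δ} {ε} ε≤δ sep i≢j = NonNeg∞-resp (λ n → e (distance P i j n) δ ε)
      (NonNeg∞-+ (sep i≢j) (NonNeg∞-const ε≤δ))
      where
      e : ∀ d δ ε → (d - δ) + (δ - ε) ≡ d - ε
      e = solve-∀ ring

    pair : ∀ i j → ¬ ¬ (∃[ δ ] (0ℚ < δ × Separation P δ i j))
    pair i j none with i Fin.≟ j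
    ... | yes i≡j = none (1ℚ , 0<! , λ i≢j → ⊥-elim (i≢j i≡j))
    ... | no i≢j  = separated P i j i≢j λ { (pos∞ δ 0<δ above) → none (δ , 0<δ , λ _ →
            nonNeg∞ λ ε 0<ε → ev-map (λ n p → 0<+ p 0<ε) above) }

  module SmallDisks {n : ℕ} (P : PointSet n) (δ : ℚ) (0<δ : 0ℚ < δ) (δ≤1 : 0ℚ ≤ 1ℚ - δ)
    (sep : ∀ i j → Separation P δ i j) where

    -- Since `δ` bounds squared distances, `½ √δ` would be a natural radius; as `δ ≤ 1`, the
    -- rational `½ δ` is no larger.
    r : ℚ
    r = ½ * δ

    -- Every disk is shifted from its point by the same vector, so the centres have the mutual
    -- distances of the points.
    small : Fin n → Disk
    small i = record
      { centre   = proj₁ (point P i) D.+ fromℚ r , proj₂ (point P i)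
      ; radius   = fromℚ r
      ; positive = r * ½ , 0<* (0<* {½} 0<! 0<δ) (0<! {½}) , 0 , λ _ _ → 0<⇒<
          (0<-subst (e δ) (0<* {½ * ½} 0<! 0<δ))
      }
      where
      e : ∀ δ → ½ * ½ * δ ≡ ½ * δ - (0ℚ + ½ * δ * ½)
      e = solve-∀ ring

    no-room : 0ℚ ≤ - (+ 4 / 1 * (r * r) - δ)
    no-room = 0≤-subst (e δ) (0≤* (0<⇒0≤ 0<δ) δ≤1)
      where
      e : ∀ δ → δ * (1ℚ - δ) ≡ - (+ 4 / 1 * (½ * δ * (½ * δ)) - δ)
      e = solve-∀ ring

    -- Two points at distance at least √δ ≥ 2 r cannot both lie within r of a
    -- third one: the defect 2 a² + 2 b² - (a + b)² is a square.
    too-close : ∀ {F H : Seq} → Pos∞ F → NonNeg∞ H →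
      (∀ n → F n + H n ≡ + 4 / 1 * (r * r) - δ) → ⊥
    too-close F>0 H≥0 total = Pos∞-NonNeg∞⇒⊥ (Pos∞-resp total (Pos∞-+ F>0 H≥0)) (NonNeg∞-const no-room)

    within : ∀ p i → p ∈Interior small i →
      Pos∞ (λ n → r * r - seq (dist² p (Disk.centre (small i))) n)
    within p i = <⇒Pos∞ (dist² p (Disk.centre (small i))) (fromℚ r D.* fromℚ r)

    small-disjoint : ∀ i j → i ≢ j → D.InteriorDisjoint (small i) (small j)
    small-disjoint i j i≢j p in-i in-j = too-close
      (Pos∞-+ (Pos∞-* {+ 2 / 1} 0<! (within p i in-i)) (Pos∞⇒NonNeg∞ (Pos∞-* {+ 2 / 1} 0<! (within p j in-j))))
      (NonNeg∞-+ (sep i j i≢j) (NonNeg∞-+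
        (NonNeg∞-pointwise (λ n → 0≤sq (+ 2 / 1 * seq (proj₁ p) n - (seq (proj₁ (point P i)) n + r) - (seq (proj₁ (point P j)) n + r))))
        (NonNeg∞-pointwise (λ n → 0≤sq (+ 2 / 1 * seq (proj₂ p) n - seq (proj₂ (point P i)) n - seq (proj₂ (point P j)) n)))))
      (λ n → e (seq (proj₁ p) n) (seq (proj₂ p) n) (seq (proj₁ (point P i)) n) (seq (proj₂ (point P i)) n)
               (seq (proj₁ (point P j)) n) (seq (proj₂ (point P j)) n) r δ)
      where
      e : ∀ x y a b c d r δ →
        + 2 / 1 * (r * r - ((x - (a + r)) * (x - (a + r)) + (y - b) * (y - b)))
        + + 2 / 1 * (r * r - ((x - (c + r)) * (x - (c + r)) + (y - d) * (y - d)))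
        + ((((a - c) * (a - c) + (b - d) * (b - d)) - δ)
          + ((+ 2 / 1 * x - (a + r) - (c + r)) * (+ 2 / 1 * x - (a + r) - (c + r))
            + (+ 2 / 1 * y - b - d) * (+ 2 / 1 * y - b - d)))
        ≡ + 4 / 1 * (r * r) - δ
      e = solve-∀ ring

    small-empty : ∀ i → D.Empty P (small i)
    small-empty i j in-i with i Fin.≟ j
    ... | yes refl = Pos∞-NonNeg∞⇒⊥ (within (point P i) i in-i) (NonNeg∞-pointwise (λ n → 0≤-subst
        (e (seq (proj₁ (point P i)) n) (seq (proj₂ (point P i)) n) r) (0≤! {0ℚ})))
      where
      e : ∀ a b r → 0ℚ ≡ - (r * r - ((a - (a + r)) * (a - (a + r)) + (b - b) * (b - b)))
      e = solve-∀ ring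
    ... | no i≢j = too-close
      (Pos∞-* {+ 2 / 1} 0<! (within (point P j) i in-i))
      (NonNeg∞-+ (sep i j i≢j) (NonNeg∞-+
        (NonNeg∞-pointwise (λ n → 0≤sq (seq (proj₁ (point P j)) n - seq (proj₁ (point P i)) n - + 2 / 1 * r)))
        (NonNeg∞-pointwise (λ n → 0≤sq (seq (proj₂ (point P j)) n - seq (proj₂ (point P i)) n)))))
      (λ n → e (seq (proj₁ (point P i)) n) (seq (proj₂ (point P i)) n)
               (seq (proj₁ (point P j)) n) (seq (proj₂ (point P j)) n) r δ)
      where
      e : ∀ a b c d r δ →
        + 2 / 1 * (r * r - ((c - (a + r)) * (c - (a + r)) + (d - b) * (d - b)))
        + ((((a - c) * (a - c) + (b - d) * (b - d)) - δ)
          + ((c - a - + 2 / 1 * r) * (c - a - + 2 / 1 * r) + (d - b) * (d - b)))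
        ≡ + 4 / 1 * (r * r) - δ
      e = solve-∀ ring

  -- Used twice: it makes the set of cover sizes inhabited, so that its minimum exists, and it
  -- bounds every such minimum by `n`, so that the maximum over all `P` exists.
  small-cover : ∀ {n} (P : PointSet n) → ¬ ¬ Cover P n
  small-cover P no-cover = separation P λ { (δ , 0<δ , δ≤1 , sep) →
    let open SmallDisks P δ 0<δ δ≤1 sep in
    no-cover (record { disk = small ; disjoint = small-disjoint ; empty = small-empty ; covers = λ i → i ,
      ≡⇒≈ (dist² (point P i) (Disk.centre (small i))) (fromℚ r D.* fromℚ r)
        (λ n → boundary (seq (proj₁ (point P i)) n) (seq (proj₂ (point P i)) n) r) }) }
    where
    boundary : ∀ a b r → (a - (a + r)) * (a - (a + r)) + (b - b) * (b - b) ≡ r * r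
    boundary = solve-∀ ring

  -- Membership in `S` may be undecidable. If there were no minimum, induction on `b` would empty
  -- `S` up to `b`.
  minimum-exists : ∀ (S : ℕ → Set) {b} → S b → ¬ ¬ (∃[ d ] IsMinimum S d)
  minimum-exists S {b} Sb none = never b b ℕ.≤-refl Sb
    where
    never : ∀ b d → d ℕ.≤ b → ¬ S d
    never b d d≤b Sd = none (d , Sd , λ k Sk → decidable-stable (d ℕ.≤? k) λ d≰k → below b d d≤b k (ℕ.≰⇒> d≰k) Sk)
      where
      below : ∀ b d → d ℕ.≤ b → ∀ k → k ℕ.< d → ¬ S k
      below zero    zero    _   _ ()
      below (suc b) d       d≤b k k<d = never b k (ℕ.s≤s⁻¹ (ℕ.≤-trans k<d d≤b))
      below zero    (suc d) ()

  maximum-exists : ∀ (S : ℕ → Set) b → (∀ k → S k → k ℕ.≤ b) → ∀ {d} → S d → ¬ ¬ (∃[ m ] IsMaximum S m)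
  maximum-exists S b bounded {d} Sd none = never b d (ℕ.m≤n+m b d) Sd
    where
    never : ∀ gap d → b ℕ.≤ d ℕ.+ gap → ¬ S d
    never zero d b≤d Sd = none (d , Sd , λ k Sk →
      ℕ.≤-trans (bounded k Sk) (ℕ.≤-trans b≤d (ℕ.≤-reflexive (ℕ.+-identityʳ d))))
    never (suc gap) d b≤ Sd = none (d , Sd , λ k Sk → decidable-stable (k ℕ.≤? d) λ k≰d →
      never gap k (ℕ.≤-trans b≤ (ℕ.≤-trans (ℕ.≤-reflexive (ℕ.+-suc d gap)) (ℕ.+-monoˡ-≤ gap (ℕ.≰⇒> k≰d)))) Sk)

-- From the slot count to the bound on D(n)

open import Defs using (IsD)
open import Data.Nat.Base using (ℕ; _+_; _≤_)
open import Data.Nat.DivMod using (_/_)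
open import Data.Nat.Divisibility using (_∣_)
open import Data.Product.Base using (_×_; ∃-syntax)
open import Relation.Nullary.Negation using (¬_)
open HardSets using (hard-set)
open Extrema using (small-cover; minimum-exists; maximum-exists)
open import Defs using (Cover; IsDₚ)
open import Data.Nat.Base using (zero; suc; s≤s; _*_; s≤s⁻¹)
open import Data.Nat.DivMod using (m*n/n≡m)
open import Data.Nat.Divisibility using (divides)
open import Data.Nat.Properties using (_≤?_; ≤-trans; +-comm; *-cancelʳ-<)
open import Data.Product.Base using (_,_; proj₁; proj₂)
open import Relation.Binary.PropositionalEquality using (refl; sym; trans; cong; subst)
open import Relation.Nullary.Decidable using (decidable-stable)

-- Evenness is what rounds the bound `(n + 1) / 2` up: for `n = q * 2` the hypothesis says
-- `q * 2 < d * 2`, hence `q < d`.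
half-bound : ∀ n d → 2 ∣ n → suc n ≤ d * 2 → n / 2 + 1 ≤ d
half-bound .(q * 2) d (divides q refl) q*2<d*2 =
  subst (_≤ d) (trans (+-comm 1 q) (cong (_+ 1) (sym (m*n/n≡m q 2)))) (*-cancelʳ-< 2 q d q*2<d*2)

-- `maximum-exists` needs a bound on the attained minima. `small-cover` provides it under a double
-- negation, which the decidable goal `k ≤ n` absorbs.
IsD-exists : ∀ n {d} → (∃[ P ] IsDₚ {n} P d) → ¬ ¬ (∃[ d′ ] (IsD n d′ × d ≤ d′))
IsD-exists n {d} attained none = maximum-exists (λ k → ∃[ P ] IsDₚ {n} P k) n
  (λ { k (P , _ , least) → decidable-stable (k ≤? n) λ k≰n → small-cover P λ cover → k≰n (least n cover) })
  attained λ { (d′ , max) → none (d′ , max , proj₂ max d attained) }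

theorem1 : (n : ℕ) → 2 ∣ n → 174 ≤ n →
    ¬ ¬ (∃[ d ] (IsD n d × n / 2 + 1 ≤ d))
theorem1 (suc zero) _ (s≤s ())
theorem1 (suc (suc M)) 2∣n 174≤n none = lower (hard-set M (s≤s⁻¹ (s≤s⁻¹ 174≤n)))
  where
  lower : (∃[ P ] (∀ k → Cover {suc (suc M)} P k → 3 + M ≤ k * 2)) → _
  lower (P , many) = small-cover P λ cover → minimum-exists (Cover P) cover λ { (d , min) →
    IsD-exists (suc (suc M)) (P , min) λ { (d′ , isD , d≤d′) →
      none (d′ , isD , ≤-trans (half-bound (suc (suc M)) d 2∣n (many d (proj₁ min))) d≤d′) } }
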